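{- Let $\mathbb{K}$ be a commutative semiring (with $0\neq 1$) and let $S:\mathrm{NW}(\Delta)\to\mathbb{K}$ be a nested word series. Then: (a) $S$ is regular iff $S$ is $\mathrm{sRMSO}(\mathbb{K})$-definable iff $S$ is $\mathrm{sREMSO}(\mathbb{K})$-definable. (b) If $\mathbb{K}$ is additively locally finite, then $S$ is regular iff $S$ is $\mathrm{swRMSO}(\mathbb{K})$-definable. (c) If $\mathbb{K}$ is locally finite, then $S$ is regular iff $S$ is $\mathrm{MSO}(\mathbb{K})$-definable. (All logics are over the signature of nested words.)
   Context: $(\mathbb{K},+,\cdot,0,1)$ is a commutative semiring with $0\ne 1$. It is additively locally finite if every finitely generated submonoid of $(\mathbb{K},+,0)$ is finite, and locally finite if every finitely generated subsemiring is finite. Nested words: $\Delta$ is a finite alphabet. A nesting relation of width $n$ is a binary relation $\nu$ on $[n]=\{1,\dots,n\}$ such that: $\nu(i,j)$ implies $i<j$; $\nu(i,j),\nu(i,j')$ imply $j=j'$ and $\nu(i,j),\nu(i',j)$ imply $i=i'$; $\nu(i,j),\nu(i',j')$, $i<i'$ imply $j<i'$ or $j'<j$. A nested word is $nw=(w,\nu)$ with $w=a_1\dots a_n\in\Delta^+$ (nonempty) and $\nu$ a nesting relation of width $n$. If $(i,j)\in\nu$, $i$ is a call position and $j$ a return position; other positions are internal. $\mathrm{NW}(\Delta)$ is the set of nested words; a nested word series is a map $S:\mathrm{NW}(\Delta)\to\mathbb{K}$. Weighted nested word automaton (WNWA): $\mathcal A=(Q,\iota,\delta,\kappa)$ with $Q$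 finite, $\delta=(\delta_{call},\delta_{int},\delta_{ret})$, $\delta_{call},\delta_{int}:Q\times\Delta\times Q\to\mathbb{K}$, $\delta_{ret}:Q\times Q\times\Delta\times Q\to\mathbb{K}$, $\iota,\kappa:Q\to\mathbb{K}$. A run on $(a_1\dots a_n,\nu)$ is a sequence $r=(q_0,\dots,q_n)$ of states; its weight at position $j$ is $\delta_{call}(q_{j-1},a_j,q_j)$ if $j$ is a call position, $\delta_{int}(q_{j-1},a_j,q_j)$ if $j$ is internal, and $\delta_{ret}(q_{j-1},q_{i-1},a_j,q_j)$ if $(i,j)\in\nu$; the weight of $r$ is the product over all $j$. The behavior is $(\|\mathcal A\|,nw)=\sum_{q_0,q_n\in Q}\iota(q_0)\sum_{r \text{ run from } q_0 \text{ to } q_n}\mathrm{weight}(r)\,\kappa(q_n)$. $S$ is regular if $S=\|\mathcal A\|$ for some WNWA. A nested word $(a_1\dots a_n,\nu)$ is viewed as the structure with domain $[n]$, unary relations $\mathrm{Lab}_a=\{i:a_i=a\}$ ($a\in\Delta$), the natural order $\le$, and the binary relation $\nu$. Weighted MSO: classical MSO formulas are built from atomic formulas $x=y$, $\mathrm{Lab}_a(x)$, $x\le y$, $\nu(x,y)$, $x\in X$ with $\vee,\neg,\exists x,\exists X$ (with the usual abbreviations $\wedge,\to,\leftrightarrow,\forall$, and $x<y$ for $\neg(y\le x)$). Weighted formulas $\mathrm{MSO}(\mathbb{K})$: $\varphi::= k\mid \alpha\mid\neg\alpha\mid\varphi\vee\varphi\mid\varphi\wedge\varphi\mid\exists x.\varphi\mid\exists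 X.\varphi\mid\forall x.\varphi\mid\forall X.\varphi$ with $k\in\mathbb{K}$ and $\alpha$ atomic. Semantics on a nested word and an assignment $\gamma$ of a finite set of variables containing the free ones (first-order variables to positions, set variables to sets of positions): $[\![k]\!]=k$; $[\![\alpha]\!],[\![\neg\alpha]\!]$ are $1$ if satisfied and $0$ otherwise; $\vee\mapsto +$, $\wedge\mapsto\cdot$; $\exists x$ (resp. $\exists X$) is the sum over all positions (resp. all sets of positions) of the value with the variable so assigned; $\forall x$ (resp. $\forall X$) is the corresponding product. For a sentence $\varphi$, $[\![\varphi]\!]$ is a nested word series; $S$ is $Z$-definable if $S=[\![\varphi]\!]$ for a sentence $\varphi\in Z$. For a classical MSO formula $\varphi$ define weighted formulas $\varphi^+,\varphi^-$: for atomic $\varphi$, $\varphi^+=\varphi$, $\varphi^-=\neg\varphi$; $(\neg\psi)^+=\psi^-$, $(\neg\psi)^-=\psi^+$; $(\psi\vee\psi')^+=\psi^+\vee(\psi^-\wedge\psi'^+)$, $(\psi\vee\psi')^-=\psi^-\wedge\psi'^-$; $(\exists x.\psi(x))^+=\exists x.\psi(x)^+\wedge\forall y.(y<x\wedge\psi(y))^-$, $(\exists x.\psi)^-=\forall x.\psi^-$; $(\exists X.\psi(X))^+=\exists X.\psi(X)^+\wedge\forall Y.(Y<X\wedge\psi(Y))^-$, $(\exists X.\psi)^-=\forall X.\psi^-$, where $Y<X$ is the classical formula expressing lexicographic order: $\exists y.(y\in X\wedge\neg y\in Y\wedge\forall z.(z<y\to(z\in Y\leftrightarrow z\in X)))$.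 Formulas $\varphi^+$ or $\varphi^-$ are called syntactically unambiguous. $\mathrm{aUMSO}(\mathbb{K})$ is the smallest set of weighted formulas containing all constants $k\in\mathbb K$ and all syntactically unambiguous formulas and closed under $\wedge,\vee$; $\mathrm{wUMSO}(\mathbb{K})$ is the smallest such set closed additionally under $\exists x$ and $\exists X$. $\varphi\in\mathrm{sRMSO}(\mathbb{K})$ if for every subformula $\forall X.\psi$ of $\varphi$, $\psi$ is syntactically unambiguous, and for every subformula $\forall x.\psi$, $\psi\in\mathrm{aUMSO}(\mathbb{K})$. $\mathrm{swRMSO}(\mathbb{K})$ is defined the same way with $\mathrm{wUMSO}(\mathbb{K})$ instead of $\mathrm{aUMSO}(\mathbb{K})$. $\mathrm{sRFO}(\mathbb{K})$ consists of the $\mathrm{sRMSO}(\mathbb{K})$ formulas without set quantification, and $\mathrm{sREMSO}(\mathbb{K})$ of formulas $\exists X_1\dots\exists X_m.\psi$ with $\psi\in\mathrm{sRFO}(\mathbb{K})$. -}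

module Defs where

open import Level using (Level; _⊔_)
open import Algebra.Bundles using (CommutativeSemiring)
open import Data.Nat using (ℕ; zero; suc; _≤_)
open import Data.Fin using (Fin; zero; suc; inject₁; fromℕ)
import Data.Fin as F
import Data.Fin.Properties as FP
open import Data.Bool using (Bool; true; false)
import Data.Bool.Properties as BP
open import Data.Product using (Σ; ∃; _×_; _,_; proj₁; proj₂)
open import Data.Sum using (_⊎_)
open import Data.Unit.Polymorphic using (⊤)
open import Data.List using (List; []; _∷_; foldr; map)
open import Data.List.Relation.Unary.All using (All)
open import Data.List.Relation.Unary.Any using (Any)
open import Data.List.Membership.Propositional using (_∈_)
open import Data.Vec.Functional using () renaming (_∷_ to _∷ᶠ_)
open import Relation.Binary.PropositionalEquality using (_≡_)
open import Relation.Nullary using (Dec; yes; no; ¬_)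
open import Relation.Nullary.Decidable using (⌊_⌋)

-- Nested words over the finite alphabet Δ = Fin d.
-- Positions are 0-based: position p : Fin len is the paper's position p+1.

record NestedWord (d : ℕ) : Set where
  field
    len      : ℕ
    nonempty : 1 ≤ len
    lab      : Fin len → Fin d
    nest     : Fin len → Fin len → Bool
    nest-lt  : ∀ i j → nest i j ≡ true → i F.< j
    nest-fun : ∀ i j j' → nest i j ≡ true → nest i j' ≡ true → j ≡ j'
    nest-inj : ∀ i i' j → nest i j ≡ true → nest i' j ≡ true → i ≡ i'
    nest-wn  : ∀ i j i' j' → nest i j ≡ true → nest i' j' ≡ true →
               i F.< i' → (j F.< i') ⊎ (j' F.< j)

-- Syntax.  Formulas are in de Bruijn form, indexed by the number i of
-- first-order and j of second-order variables in scope.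

data Atom (d i j : ℕ) : Set where
  eqA  : Fin i → Fin i → Atom d i j
  labA : Fin d → Fin i → Atom d i j
  leqA : Fin i → Fin i → Atom d i j
  nuA  : Fin i → Fin i → Atom d i j
  memA : Fin i → Fin j → Atom d i j

data MSO (d : ℕ) : ℕ → ℕ → Set where
  atom : ∀ {i j} → Atom d i j → MSO d i j
  or   : ∀ {i j} → MSO d i j → MSO d i j → MSO d i j
  neg  : ∀ {i j} → MSO d i j → MSO d i j
  ex1  : ∀ {i j} → MSO d (suc i) j → MSO d i j
  ex2  : ∀ {i j} → MSO d i (suc j) → MSO d i j

data WMSO {c} (C : Set c) (d : ℕ) : ℕ → ℕ → Set c where
  const : ∀ {i j} → C → WMSO C d i j
  atom  : ∀ {i j} → Atom d i j → WMSO C d i j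
  natom : ∀ {i j} → Atom d i j → WMSO C d i j
  or    : ∀ {i j} → WMSO C d i j → WMSO C d i j → WMSO C d i j
  and   : ∀ {i j} → WMSO C d i j → WMSO C d i j → WMSO C d i j
  ex1   : ∀ {i j} → WMSO C d (suc i) j → WMSO C d i j
  ex2   : ∀ {i j} → WMSO C d i (suc j) → WMSO C d i j
  all1  : ∀ {i j} → WMSO C d (suc i) j → WMSO C d i j
  all2  : ∀ {i j} → WMSO C d i (suc j) → WMSO C d i j

lift : ∀ {i i'} → (Fin i → Fin i') → Fin (suc i) → Fin (suc i')
lift ρ zero    = zero
lift ρ (suc k) = suc (ρ k)

-- renaming used for ψ(y): the bound variable goes to the new innermost
-- variable, skipping the (outer) variable x
lift2 : ∀ {i i'} → (Fin i → Fin i') → Fin (suc i) → Fin (suc (suc i'))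
lift2 ρ zero    = zero
lift2 ρ (suc k) = suc (suc (ρ k))

renA : ∀ {d i j i' j'} → (Fin i → Fin i') → (Fin j → Fin j') → Atom d i j → Atom d i' j'
renA ρ σ (eqA x y)  = eqA (ρ x) (ρ y)
renA ρ σ (labA a x) = labA a (ρ x)
renA ρ σ (leqA x y) = leqA (ρ x) (ρ y)
renA ρ σ (nuA x y)  = nuA (ρ x) (ρ y)
renA ρ σ (memA x X) = memA (ρ x) (σ X)

andC : ∀ {d i j} → MSO d i j → MSO d i j → MSO d i j
andC φ ψ = neg (or (neg φ) (neg ψ))

impC : ∀ {d i j} → MSO d i j → MSO d i j → MSO d i j
impC φ ψ = or (neg φ) ψ

iffC : ∀ {d i j} → MSO d i j → MSO d i j → MSO d i j
iffC φ ψ = andC (impC φ ψ) (impC ψ φ)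

all1C : ∀ {d i j} → MSO d (suc i) j → MSO d i j
all1C φ = neg (ex1 (neg φ))

ltC : ∀ {d i j} → Fin i → Fin i → MSO d i j
ltC x y = neg (atom (leqA y x))

lexLt : ∀ {d i j} → Fin j → Fin j → MSO d i j
lexLt Y X =
  ex1 (andC (atom (memA zero X))
       (andC (neg (atom (memA zero Y)))
             (all1C (impC (ltC zero (suc zero))
                          (iffC (atom (memA zero Y)) (atom (memA zero X)))))))

-- The translation φ ↦ (φ⁺ , φ⁻).
-- pmR φ ρ σ computes ((φ renamed by ρ,σ)⁺ , (φ renamed by ρ,σ)⁻); the
-- renaming parameter makes the recursion structural (ψ(y) is a renaming).

module PlusMinus {c} (C : Set c) {d : ℕ} where

  P : ℕ → ℕ → Set c
  P i j = WMSO C d i j × WMSO C d i j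

  atomP : ∀ {i j} → Atom d i j → P i j
  atomP a = atom a , natom a

  negP : ∀ {i j} → P i j → P i j
  negP (p , m) = m , p

  orP : ∀ {i j} → P i j → P i j → P i j
  orP (p , m) (p' , m') = or p (and m p') , and m m'

  andP : ∀ {i j} → P i j → P i j → P i j
  andP a b = negP (orP (negP a) (negP b))

  ltP : ∀ {i j} → Fin i → Fin i → P i j
  ltP x y = negP (atomP (leqA y x))

  -- ψp = (ψ⁺, ψ⁻) (x = variable zero); χ = (ψ(y)⁺, ψ(y)⁻) in the context
  -- with y = zero, x = suc zero
  ex1P : ∀ {i j} → P (suc i) j → P (suc (suc i)) j → P i j
  ex1P (p , m) χ = ex1 (and p (all1 (proj₂ (andP (ltP zero (suc zero)) χ)))) , all1 m

  module _ (lexP : ∀ {i j} → Fin j → Fin j → P i j) where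

    ex2P : ∀ {i j} → P i (suc j) → P i (suc (suc j)) → P i j
    ex2P (p , m) χ = ex2 (and p (all2 (proj₂ (andP (lexP zero (suc zero)) χ)))) , all2 m

    pmR : ∀ {i j i' j'} → MSO d i j → (Fin i → Fin i') → (Fin j → Fin j') → P i' j'
    pmR (atom a)  ρ σ = atomP (renA ρ σ a)
    pmR (neg φ)   ρ σ = negP (pmR φ ρ σ)
    pmR (or φ ψ)  ρ σ = orP (pmR φ ρ σ) (pmR ψ ρ σ)
    pmR (ex1 ψ)   ρ σ = ex1P (pmR ψ (lift ρ) σ) (pmR ψ (lift2 ρ) σ)
    pmR (ex2 ψ)   ρ σ = ex2P (pmR ψ ρ (lift σ)) (pmR ψ ρ (lift2 σ))

  -- lexLt contains no set quantifier, so the lexP argument is never used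
  -- when translating it; we pass an arbitrary placeholder.
  private
    dummy : ∀ {i j} → Fin j → Fin j → P i j
    dummy _ _ = all1 (atom (eqA zero zero)) , all1 (atom (eqA zero zero))

  lexPair : ∀ {i j} → Fin j → Fin j → P i j
  lexPair Y X = pmR dummy (lexLt Y X) (λ k → k) (λ k → k)

  _⁺ : ∀ {i j} → MSO d i j → WMSO C d i j
  φ ⁺ = proj₁ (pmR lexPair φ (λ k → k) (λ k → k))

  _⁻ : ∀ {i j} → MSO d i j → WMSO C d i j
  φ ⁻ = proj₂ (pmR lexPair φ (λ k → k) (λ k → k))

module Weighted {c ℓ} (K : CommutativeSemiring c ℓ) (d : ℕ) where
  open CommutativeSemiring K using (Carrier; _≈_; _+_; _*_; 0#; 1#)
  open PlusMinus Carrier {d} public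

  ∑ : (k : ℕ) → (Fin k → Carrier) → Carrier
  ∑ zero    f = 0#
  ∑ (suc k) f = f zero + ∑ k (λ i → f (suc i))

  ∏ : (k : ℕ) → (Fin k → Carrier) → Carrier
  ∏ zero    f = 1#
  ∏ (suc k) f = f zero * ∏ k (λ i → f (suc i))

  ∑B : (Bool → Carrier) → Carrier
  ∑B f = f false + f true

  ∏B : (Bool → Carrier) → Carrier
  ∏B f = f false * f true

  bigFun : {B : Set} → ((B → Carrier) → Carrier) → (m : ℕ) → ((Fin m → B) → Carrier) → Carrier
  bigFun op zero    f = f (λ ())
  bigFun op (suc m) f = op (λ b → bigFun op m (λ g → f (b ∷ᶠ g)))

  Series : Set c
  Series = NestedWord d → Carrier

  module _ (nw : NestedWord d) where
    open NestedWord nw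

    evalA : ∀ {i j} → Atom d i j → (Fin i → Fin len) → (Fin j → Fin len → Bool) → Bool
    evalA (eqA x y)  ρ σ = ⌊ ρ x FP.≟ ρ y ⌋
    evalA (labA a x) ρ σ = ⌊ lab (ρ x) FP.≟ a ⌋
    evalA (leqA x y) ρ σ = ⌊ ρ x FP.≤? ρ y ⌋
    evalA (nuA x y)  ρ σ = nest (ρ x) (ρ y)
    evalA (memA x X) ρ σ = σ X (ρ x)

    ⟦_⟧ : ∀ {i j} → WMSO Carrier d i j → (Fin i → Fin len) → (Fin j → Fin len → Bool) → Carrier
    ⟦ const k ⟧ ρ σ = k
    ⟦ atom a ⟧  ρ σ with evalA a ρ σ
    ... | true  = 1#
    ... | false = 0#
    ⟦ natom a ⟧ ρ σ with evalA a ρ σ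
    ... | true  = 0#
    ... | false = 1#
    ⟦ or φ ψ ⟧  ρ σ = ⟦ φ ⟧ ρ σ + ⟦ ψ ⟧ ρ σ
    ⟦ and φ ψ ⟧ ρ σ = ⟦ φ ⟧ ρ σ * ⟦ ψ ⟧ ρ σ
    ⟦ ex1 φ ⟧   ρ σ = ∑ len (λ p → ⟦ φ ⟧ (p ∷ᶠ ρ) σ)
    ⟦ ex2 φ ⟧   ρ σ = bigFun ∑B len (λ X → ⟦ φ ⟧ ρ (X ∷ᶠ σ))
    ⟦ all1 φ ⟧  ρ σ = ∏ len (λ p → ⟦ φ ⟧ (p ∷ᶠ ρ) σ)
    ⟦ all2 φ ⟧  ρ σ = bigFun ∏B len (λ X → ⟦ φ ⟧ ρ (X ∷ᶠ σ))

  ⟦_⟧ₛ : WMSO Carrier d 0 0 → Series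
  ⟦ φ ⟧ₛ nw = ⟦ nw ⟧ φ (λ ()) (λ ())

  SynUnamb : ∀ {i j} → WMSO Carrier d i j → Set c
  SynUnamb {i} {j} φ = Σ (MSO d i j) (λ χ → (φ ≡ χ ⁺) ⊎ (φ ≡ χ ⁻))

  data aUMSO : ∀ {i j} → WMSO Carrier d i j → Set c where
    const : ∀ {i j} (k : Carrier) → aUMSO {i} {j} (const k)
    su    : ∀ {i j} {φ : WMSO Carrier d i j} → SynUnamb φ → aUMSO φ
    and   : ∀ {i j} {φ ψ : WMSO Carrier d i j} → aUMSO φ → aUMSO ψ → aUMSO (and φ ψ)
    or    : ∀ {i j} {φ ψ : WMSO Carrier d i j} → aUMSO φ → aUMSO ψ → aUMSO (or φ ψ)

  data wUMSO : ∀ {i j} → WMSO Carrier d i j → Set c where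
    const : ∀ {i j} (k : Carrier) → wUMSO {i} {j} (const k)
    su    : ∀ {i j} {φ : WMSO Carrier d i j} → SynUnamb φ → wUMSO φ
    and   : ∀ {i j} {φ ψ : WMSO Carrier d i j} → wUMSO φ → wUMSO ψ → wUMSO (and φ ψ)
    or    : ∀ {i j} {φ ψ : WMSO Carrier d i j} → wUMSO φ → wUMSO ψ → wUMSO (or φ ψ)
    ex1   : ∀ {i j} {φ : WMSO Carrier d (suc i) j} → wUMSO φ → wUMSO (ex1 φ)
    ex2   : ∀ {i j} {φ : WMSO Carrier d i (suc j)} → wUMSO φ → wUMSO (ex2 φ)

  data Restricted (U : ∀ {i j} → WMSO Carrier d i j → Set c) :
                  ∀ {i j} → WMSO Carrier d i j → Set c where
    const : ∀ {i j} (k : Carrier) → Restricted U {i} {j} (const k)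
    atom  : ∀ {i j} (a : Atom d i j) → Restricted U (atom a)
    natom : ∀ {i j} (a : Atom d i j) → Restricted U (natom a)
    or    : ∀ {i j} {φ ψ : WMSO Carrier d i j} → Restricted U φ → Restricted U ψ → Restricted U (or φ ψ)
    and   : ∀ {i j} {φ ψ : WMSO Carrier d i j} → Restricted U φ → Restricted U ψ → Restricted U (and φ ψ)
    ex1   : ∀ {i j} {φ : WMSO Carrier d (suc i) j} → Restricted U φ → Restricted U (ex1 φ)
    ex2   : ∀ {i j} {φ : WMSO Carrier d i (suc j)} → Restricted U φ → Restricted U (ex2 φ)
    all1  : ∀ {i j} {φ : WMSO Carrier d (suc i) j} → U φ → Restricted U φ → Restricted U (all1 φ)
    all2  : ∀ {i j} {φ : WMSO Carrier d i (suc j)} → SynUnamb φ → Restricted U φ → Restricted U (all2 φ)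

  sRMSO : ∀ {i j} → WMSO Carrier d i j → Set c
  sRMSO = Restricted aUMSO

  swRMSO : ∀ {i j} → WMSO Carrier d i j → Set c
  swRMSO = Restricted wUMSO

  data NoSetQ : ∀ {i j} → WMSO Carrier d i j → Set c where
    const : ∀ {i j} (k : Carrier) → NoSetQ {i} {j} (const k)
    atom  : ∀ {i j} (a : Atom d i j) → NoSetQ (atom a)
    natom : ∀ {i j} (a : Atom d i j) → NoSetQ (natom a)
    or    : ∀ {i j} {φ ψ : WMSO Carrier d i j} → NoSetQ φ → NoSetQ ψ → NoSetQ (or φ ψ)
    and   : ∀ {i j} {φ ψ : WMSO Carrier d i j} → NoSetQ φ → NoSetQ ψ → NoSetQ (and φ ψ)
    ex1   : ∀ {i j} {φ : WMSO Carrier d (suc i) j} → NoSetQ φ → NoSetQ (ex1 φ)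
    all1  : ∀ {i j} {φ : WMSO Carrier d (suc i) j} → NoSetQ φ → NoSetQ (all1 φ)

  sRFO : ∀ {i j} → WMSO Carrier d i j → Set c
  sRFO φ = sRMSO φ × NoSetQ φ

  data sREMSO : ∀ {i j} → WMSO Carrier d i j → Set c where
    base : ∀ {i j} {φ : WMSO Carrier d i j} → sRFO φ → sREMSO φ
    ex2  : ∀ {i j} {φ : WMSO Carrier d i (suc j)} → sREMSO φ → sREMSO (ex2 φ)

  anyMSO : ∀ {i j} → WMSO Carrier d i j → Set c
  anyMSO _ = ⊤

  Definable : (WMSO Carrier d 0 0 → Set c) → Series → Set (c ⊔ ℓ)
  Definable Z S = Σ (WMSO Carrier d 0 0) (λ φ → Z φ × (∀ nw → S nw ≈ ⟦ φ ⟧ₛ nw))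

  record WNWA : Set c where
    field
      nQ    : ℕ
      ι κ   : Fin nQ → Carrier
      δcall : Fin nQ → Fin d → Fin nQ → Carrier
      δint  : Fin nQ → Fin d → Fin nQ → Carrier
      δret  : Fin nQ → Fin nQ → Fin d → Fin nQ → Carrier

  module _ (A : WNWA) (nw : NestedWord d) where
    open WNWA A
    open NestedWord nw

    posWeight : (Fin (suc len) → Fin nQ) → Fin len → Carrier
    posWeight r p with FP.any? (λ i → nest i p BP.≟ true)
    ... | yes (i , _) = δret (r (inject₁ p)) (r (inject₁ i)) (lab p) (r (suc p))
    ... | no _ with FP.any? (λ j → nest p j BP.≟ true)
    ...   | yes _ = δcall (r (inject₁ p)) (lab p) (r (suc p))
    ...   | no _  = δint  (r (inject₁ p)) (lab p) (r (suc p))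

    runWeight : (Fin (suc len) → Fin nQ) → Carrier
    runWeight r = ∏ len (posWeight r)

    behaviour : Carrier
    behaviour = bigFun (∑ nQ) (suc len)
                  (λ r → (ι (r zero) * runWeight r) * κ (r (fromℕ len)))

  Regular : Series → Set (c ⊔ ℓ)
  Regular S = Σ WNWA (λ A → ∀ nw → S nw ≈ behaviour A nw)

  sumL : List Carrier → Carrier
  sumL = foldr _+_ 0#

  prodL : List Carrier → Carrier
  prodL = foldr _*_ 1#

  FiniteSubset : (Carrier → Set (c ⊔ ℓ)) → Set (c ⊔ ℓ)
  FiniteSubset M = Σ (List Carrier) (λ L → ∀ x → M x → Any (x ≈_) L)

  InSubmonoid : List Carrier → Carrier → Set (c ⊔ ℓ)
  InSubmonoid gs x = Σ (List Carrier) (λ l → All (_∈ gs) l × x ≈ sumL l)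

  InSubsemiring : List Carrier → Carrier → Set (c ⊔ ℓ)
  InSubsemiring gs x =
    Σ (List (List Carrier)) (λ ls → All (All (_∈ gs)) ls × x ≈ sumL (map prodL ls))

  AddLocallyFinite : Set (c ⊔ ℓ)
  AddLocallyFinite = ∀ gs → FiniteSubset (InSubmonoid gs)

  LocallyFinite : Set (c ⊔ ℓ)
  LocallyFinite = ∀ gs → FiniteSubset (InSubsemiring gs)

{-# OPTIONS --safe #-}
module Submission where

-- A nested word is a sequence of internal positions and blocks call - factor - return, so it is a binary
-- tree, and a weighted nested word automaton amounts to a finite family of series that is stable, up to
-- finite linear combinations, under removing the leading position or block.  In this form closure under
-- sums, products and summation over annotations of the positions is a direct computation, and a product
-- over positions of a function with finitely many regular levels is obtained by guessing, along with the
-- state of each factor, the map from its state to the state of the whole word.  Syntactically unambiguous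
-- formulas are indicators because exactly one position (set) is the first witness; their truth values are
-- computed by finite algebras.  In the locally finite cases sums and products over annotations depend only
-- on how often each state is reached, up to a common period, so every formula takes finitely many values.
-- Conversely the runs of an automaton are encoded by one set variable per state, and the weight of a
-- position is a finite sum of constants guarded by mutually exclusive first-order conditions.

open import Defs
open import Level using (Level; _⊔_; 0ℓ)
open import Algebra.Bundles using (CommutativeMonoid; CommutativeSemiring)
import Algebra.Properties.Monoid.Mult as Mult
import Algebra.Solver.Ring.NaturalCoefficients.Default as SemiringSolver
open import Data.Bool using (Bool; true; false; not; _∧_; _∨_; _xor_; if_then_else_)
import Data.Bool.Properties as BP
open import Data.Empty using (⊥; ⊥-elim)
open import Data.Fin using (Fin; zero; suc; _↑ˡ_; _↑ʳ_; toℕ)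
import Data.Fin as F
import Data.Fin.Properties as FP
open import Data.List using (List; []; _∷_; _++_; map; concatMap; replicate; lookup; length)
open import Data.List.Membership.Propositional using (_∈_)
open import Data.List.Relation.Unary.All as All using (All)
open import Data.List.Relation.Unary.Any as Any using (Any; here)
import Data.List.Relation.Unary.Any.Properties as AnyP
open import Data.Nat as ℕ using (ℕ; zero; suc)
open import Data.Nat.Induction using (<-wellFounded)
import Data.Nat.Properties as ℕP
open import Data.Product using (Σ; ∃; _×_; _,_; proj₁; proj₂)
open import Data.Sum using (_⊎_; inj₁; inj₂; [_,_]′)
open import Data.Unit.Polymorphic using (⊤; tt)
open import Data.Vec as Vec using (Vec; []; _∷_)
import Data.Vec.Functional as VF
open import Data.Vec.Functional using () renaming (_∷_ to _∷ᶠ_; _++_ to _++ᶠ_)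
import Data.Vec.Properties as VP
open import Function using (_∘_; id)
open import Function.Bundles using (_⇔_; mk⇔)
open import Induction.WellFounded using (Acc; acc)
open import Relation.Binary.Bundles using (Setoid)
import Relation.Binary.PropositionalEquality as ≡
open ≡ using (_≡_; _≗_)
import Relation.Binary.Reasoning.Setoid
open import Relation.Nullary using (yes; no; ¬_)
open import Relation.Nullary.Decidable using (⌊_⌋)

-- Equality in `K` is not decidable, so a finite set of values cannot be handled by listing and
-- comparing its elements. A step function is therefore given by an algebra on a finite set with an
-- arbitrary output map; states are compared, values never. The closure constructions for families
-- are made over an arbitrary commutative semiring because they are used twice: over `K` they give
-- the summations of the logic, over the natural numbers they count how many annotations reach a
-- given state. Reducing these counts by an eventually periodic congruence, compatible with sums and
-- products, turns a counting family into a finite algebra. The passage from families to automata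
-- has to linearise a branching rule: the rule of a block depends on both the call and the return
-- letter, so it can be applied only at the return. The state before the call, which the automaton
-- sees again there, supplies the index to be expanded, and a guess carried through the enclosed
-- factor is checked against the rule. In the other direction one formula in `sREMSO`, the smallest
-- class, serves all the logics.

private variable
  A B X Y : Set
  ℓ₁ ℓ₂ : Level
  Idx : Set ℓ₁
  Idx′ : Set ℓ₂

-- Boolean equality of positions.

-- Defined by recursion so that it computes under `zero` and `suc`; `eqF-≟` relates it to the
-- decision procedure of the semantics.
eqF : ∀ {n} → Fin n → Fin n → Bool
eqF zero    zero    = true
eqF zero    (suc j) = false
eqF (suc i) zero    = false
eqF (suc i) (suc j) = eqF i j

eqF-refl : ∀ {n} (i : Fin n) → eqF i i ≡ true
eqF-refl zero    = ≡.refl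
eqF-refl (suc i) = eqF-refl i

eqF-sound : ∀ {n} (i j : Fin n) → eqF i j ≡ true → i ≡ j
eqF-sound zero    zero    _ = ≡.refl
eqF-sound (suc i) (suc j) p = ≡.cong suc (eqF-sound i j p)

eqF-sym : ∀ {n} (i j : Fin n) → eqF i j ≡ eqF j i
eqF-sym zero    zero    = ≡.refl
eqF-sym zero    (suc j) = ≡.refl
eqF-sym (suc i) zero    = ≡.refl
eqF-sym (suc i) (suc j) = eqF-sym i j

eqF-≟ : ∀ {n} (i j : Fin n) → ⌊ i FP.≟ j ⌋ ≡ eqF i j
eqF-≟ i j with i FP.≟ j
... | yes ≡.refl = ≡.sym (eqF-refl i)
... | no  i≢j with eqF i j in eq
...   | false = ≡.refl
...   | true  = ⊥-elim (i≢j (eqF-sound i j eq))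

eqF-↑ˡ : ∀ {m} n (i j : Fin m) → eqF (i ↑ˡ n) (j ↑ˡ n) ≡ eqF i j
eqF-↑ˡ n zero    zero    = ≡.refl
eqF-↑ˡ n zero    (suc j) = ≡.refl
eqF-↑ˡ n (suc i) zero    = ≡.refl
eqF-↑ˡ n (suc i) (suc j) = eqF-↑ˡ n i j

eqF-↑ʳ : ∀ m {n} (i j : Fin n) → eqF (m ↑ʳ i) (m ↑ʳ j) ≡ eqF i j
eqF-↑ʳ zero    i j = ≡.refl
eqF-↑ʳ (suc m) i j = eqF-↑ʳ m i j

eqF-↑ˡ↑ʳ : ∀ {m n} (i : Fin m) (j : Fin n) → eqF (i ↑ˡ n) (m ↑ʳ j) ≡ false
eqF-↑ˡ↑ʳ zero    j = ≡.refl
eqF-↑ˡ↑ʳ (suc i) j = eqF-↑ˡ↑ʳ i j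

eqF-↑ʳ↑ˡ : ∀ {m n} (j : Fin n) (i : Fin m) → eqF (m ↑ʳ j) (i ↑ˡ n) ≡ false
eqF-↑ʳ↑ˡ {m} {n} j i = ≡.trans (eqF-sym (m ↑ʳ j) (i ↑ˡ n)) (eqF-↑ˡ↑ʳ i j)

-- Decomposition of nested words into blocks.

-- The shape of a well-matched factor: empty, internal position - factor, or call - factor - return - factor.
data Sk : ℕ → Set where
  end  : Sk 0
  int  : ∀ {n} → Sk n → Sk (suc n)
  nest : ∀ {m k} → Sk m → Sk k → Sk (suc (m ℕ.+ suc k))

inner : ∀ {m} k → Fin m → Fin (suc (m ℕ.+ suc k))
inner k p = suc (p ↑ˡ suc k)

ret : ∀ m k → Fin (suc (m ℕ.+ suc k))
ret m k = suc (m ↑ʳ zero)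

after : ∀ m {k} → Fin k → Fin (suc (m ℕ.+ suc k))
after m p = suc (m ↑ʳ suc p)

data Block (m k : ℕ) : Fin (suc (m ℕ.+ suc k)) → Set where
  is-call  : Block m k zero
  is-inner : (p : Fin m) → Block m k (inner k p)
  is-ret   : Block m k (ret m k)
  is-after : (p : Fin k) → Block m k (after m p)

block : ∀ m k (p : Fin (suc (m ℕ.+ suc k))) → Block m k p
block m k zero = is-call
block m k (suc p) with F.splitAt m p in eq
... | inj₁ q rewrite ≡.sym (FP.splitAt⁻¹-↑ˡ {i = p} eq) = is-inner q
... | inj₂ zero rewrite ≡.sym (FP.splitAt⁻¹-↑ʳ {i = p} eq) = is-ret
... | inj₂ (suc q) rewrite ≡.sym (FP.splitAt⁻¹-↑ʳ {i = p} eq) = is-after q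

↑ˡ<↑ʳ : ∀ {m n} (i : Fin m) (j : Fin n) → (i ↑ˡ n) F.< (m ↑ʳ j)
↑ˡ<↑ʳ {m} {n} i j rewrite FP.toℕ-↑ˡ i n | FP.toℕ-↑ʳ m j =
  ℕP.≤-trans (FP.toℕ<n i) (ℕP.m≤m+n m (toℕ j))

module Parsing {N : ℕ} (ν : Fin N → Fin N → Bool) where

  record IsInternal (p : Fin N) : Set where
    field
      not-ret  : ∀ i → ν i p ≡ false
      not-call : ∀ j → ν p j ≡ false

  -- `e` embeds the factor into the word. The last two clauses exclude edges between the enclosed
  -- and the following factor; edges at the call or at the return are already settled by
  -- functionality, injectivity and the disjointness of calls and returns.
  Describes : ∀ {n} → Sk n → (Fin n → Fin N) → Set
  Describes end e = ⊤
  Describes (int s) e = IsInternal (e zero) × Describes s (e ∘ suc)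
  Describes (nest {m} {k} u v) e =
    ν (e zero) (e (ret m k)) ≡ true
    × Describes u (e ∘ inner k)
    × Describes v (e ∘ after m)
    × (∀ p q → ν (e (inner k p)) (e (after m q)) ≡ false)
    × (∀ p q → ν (e (after m p)) (e (inner k q)) ≡ false)

  module _
    (lt  : ∀ i j → ν i j ≡ true → i F.< j)
    (fun : ∀ i j j' → ν i j ≡ true → ν i j' ≡ true → j ≡ j')
    (inj : ∀ i i' j → ν i j ≡ true → ν i' j ≡ true → i ≡ i')
    (wn  : ∀ i j i' j' → ν i j ≡ true → ν i' j' ≡ true → i F.< i' → (j F.< i') ⊎ (j' F.< j))
    where

    private
      Mono : ∀ {n} → (Fin n → Fin N) → Set
      Mono e = ∀ p q → p F.< q → e p F.< e q

      -- The invariant of parsing: an edge that touches the factor has both ends in it.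
      record Closed {n} (e : Fin n → Fin N) : Set where
        field
          fwd : ∀ p j → ν (e p) j ≡ true → ∃ λ q → e q ≡ j
          bwd : ∀ p i → ν i (e p) ≡ true → ∃ λ q → e q ≡ i

    -- Two edges sharing `p` as return and as call violate well-nestedness: it would give `p < p`,
    -- or `j < p` against `p < j`.
    call-not-ret : ∀ i p j → ν p j ≡ true → ν i p ≡ true → ⊥
    call-not-ret i p j pj ip with wn i p p j ip pj (lt i p ip)
    ... | inj₁ p<p = ℕP.<-irrefl ≡.refl p<p
    ... | inj₂ j<p = ℕP.<-irrefl ≡.refl (ℕP.<-trans j<p (lt p j pj))

    -- A view bringing the length into the form `m + suc k` that `nest` demands, with the return at
    -- the cut.
    data Cut : ∀ n → Fin n → Set where
      cut : ∀ m k → Cut (m ℕ.+ suc k) (m ↑ʳ zero)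

    cutAt : ∀ {n} (p : Fin n) → Cut n p
    cutAt {suc n} zero = cut 0 n
    cutAt (suc p) with cutAt p
    ... | cut m k = cut (suc m) k

    private
      -- The first position of a closed factor cannot be a return, since its call would lie further
      -- left inside the factor. If it is a call, its return lies in the factor and cuts it in two.
      -- An edge from the enclosed to the following part would cross the edge of the block, so both
      -- parts are closed again. The recursion is on the length because neither part is an immediate
      -- predecessor.
      parse-factor : ∀ n (e : Fin n → Fin N) → Mono e → Closed e → Acc ℕ._<_ n →
              Σ (Sk n) λ s → Describes s e
      parse-factor zero e mono cl _ = end , tt
      parse-factor (suc n) e mono cl (acc rs) with FP.any? (λ j → ν (e zero) j BP.≟ true)
      ... | no ¬c = int (proj₁ rec) ,
                    record { not-ret = λ i → BP.¬-not (nr i) ; not-call = λ j → BP.¬-not (λ x → ¬c (j , x)) } ,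
                    proj₂ rec
        where
        nr : ∀ i → ¬ (ν i (e zero) ≡ true)
        nr i x with Closed.bwd cl zero i x
        ... | zero  , ≡.refl = ℕP.<-irrefl ≡.refl (lt _ _ x)
        ... | suc q , ≡.refl = ℕP.<-asym (lt _ _ x) (mono zero (suc q) (ℕ.s≤s ℕ.z≤n))
        cl' : Closed (e ∘ suc)
        Closed.fwd cl' p j x with Closed.fwd cl (suc p) j x
        ... | zero  , ≡.refl = ⊥-elim (nr _ x)
        ... | suc q , eq   = q , eq
        Closed.bwd cl' p i x with Closed.bwd cl (suc p) i x
        ... | zero  , ≡.refl = ⊥-elim (¬c (_ , x))
        ... | suc q , eq   = q , eq
        rec : Σ (Sk n) λ s → Describes s (e ∘ suc)
        rec = parse-factor n (e ∘ suc) (λ p q p<q → mono (suc p) (suc q) (ℕ.s≤s p<q)) cl' (rs ℕP.≤-refl)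
      ... | yes (j , c) with Closed.fwd cl zero j c
      ...   | zero , ≡.refl = ⊥-elim (ℕP.<-irrefl ≡.refl (lt _ _ c))
      ...   | suc r , ≡.refl with cutAt r
      ...     | cut m k = nest (proj₁ recu) (proj₁ recv) ,
                          c , proj₂ recu , proj₂ recv , no-out , no-back
        where
        before : ∀ p → e zero F.< e (inner k p)
        before p = mono zero (inner k p) (ℕ.s≤s ℕ.z≤n)
        in<ret : ∀ p → e (inner k p) F.< e (ret m k)
        in<ret p = mono (inner k p) (ret m k) (ℕ.s≤s (↑ˡ<↑ʳ p zero))
        ret<af : ∀ q → e (ret m k) F.< e (after m q)
        ret<af q = mono (ret m k) (after m q) (ℕ.s≤s lemma)
          where
          lemma : (m ↑ʳ zero {k}) F.< (m ↑ʳ suc q)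
          lemma rewrite FP.toℕ-↑ʳ m (zero {k}) | FP.toℕ-↑ʳ m (suc q) = ℕP.+-monoʳ-< m (ℕ.s≤s ℕ.z≤n)
        in<af : ∀ p q → e (inner k p) F.< e (after m q)
        in<af p q = ℕP.<-trans (in<ret p) (ret<af q)
        out : ∀ p q → ν (e (inner k p)) (e (after m q)) ≡ true → ⊥
        out p q x with wn _ _ _ _ c x (before p)
        ... | inj₁ y = ℕP.<-asym y (in<ret p)
        ... | inj₂ y = ℕP.<-asym y (ret<af q)
        back : ∀ p q → ν (e (after m p)) (e (inner k q)) ≡ true → ⊥
        back p q x = ℕP.<-asym (lt _ _ x) (in<af q p)
        no-out : ∀ p q → ν (e (inner k p)) (e (after m q)) ≡ false
        no-out p q = BP.¬-not (out p q)
        no-back : ∀ p q → ν (e (after m p)) (e (inner k q)) ≡ false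
        no-back p q = BP.¬-not (back p q)
        clu : Closed (e ∘ inner k)
        Closed.fwd clu p j x with Closed.fwd cl (inner k p) j x
        ... | q , ≡.refl with block m k q
        ...   | is-call    = ⊥-elim (call-not-ret _ _ _ c x)
        ...   | is-inner q = q , ≡.refl
        ...   | is-ret     = ⊥-elim (ℕP.<-irrefl (≡.cong toℕ (inj _ _ _ c x)) (before p))
        ...   | is-after q = ⊥-elim (out p q x)
        Closed.bwd clu p i x with Closed.bwd cl (inner k p) i x
        ... | q , ≡.refl with block m k q
        ...   | is-call    = ⊥-elim (ℕP.<-irrefl (≡.cong toℕ (fun _ _ _ x c)) (in<ret p))
        ...   | is-inner q = q , ≡.refl
        ...   | is-ret     = ⊥-elim (call-not-ret _ _ _ x c)
        ...   | is-after q = ⊥-elim (back q p x)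
        clv : Closed (e ∘ after m)
        Closed.fwd clv p j x with Closed.fwd cl (after m p) j x
        ... | q , ≡.refl with block m k q
        ...   | is-call    = ⊥-elim (call-not-ret _ _ _ c x)
        ...   | is-inner q = ⊥-elim (back p q x)
        ...   | is-ret     = ⊥-elim (ℕP.<-irrefl (≡.cong toℕ (inj _ _ _ c x))
                               (mono zero (after m p) (ℕ.s≤s ℕ.z≤n)))
        ...   | is-after q = q , ≡.refl
        Closed.bwd clv p i x with Closed.bwd cl (after m p) i x
        ... | q , ≡.refl with block m k q
        ...   | is-call    = ⊥-elim (ℕP.<-irrefl (≡.cong toℕ (fun _ _ _ c x)) (ret<af p))
        ...   | is-inner q = ⊥-elim (out q p x)
        ...   | is-ret     = ⊥-elim (call-not-ret _ _ _ x c)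
        ...   | is-after q = q , ≡.refl
        recu : Σ (Sk m) λ s → Describes s (e ∘ inner k)
        recu = parse-factor m (e ∘ inner k)
                 (λ p q p<q → mono _ _ (ℕ.s≤s (≡.subst₂ ℕ._<_ (≡.sym (FP.toℕ-↑ˡ p (suc k))) (≡.sym (FP.toℕ-↑ˡ q (suc k))) p<q)))
                 clu (rs (ℕ.s≤s (ℕP.m≤m+n m (suc k))))
        recv : Σ (Sk k) λ s → Describes s (e ∘ after m)
        recv = parse-factor k (e ∘ after m)
                 (λ p q p<q → mono _ _ (ℕ.s≤s (≡.subst₂ ℕ._<_ (≡.sym (FP.toℕ-↑ʳ m (suc p))) (≡.sym (FP.toℕ-↑ʳ m (suc q)))
                                 (ℕP.+-monoʳ-< m (ℕ.s≤s p<q)))))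
                 clv (rs (ℕ.s≤s (ℕP.≤-trans (ℕP.n≤1+n k) (ℕP.m≤n+m (suc k) m))))

    parse : Σ (Sk N) λ s → Describes s id
    parse = parse-factor N id (λ _ _ p<q → p<q)
              (record { fwd = λ _ j _ → j , ≡.refl ; bwd = λ _ i _ → i , ≡.refl }) (<-wellFounded N)

module _ {d : ℕ} (nw : NestedWord d) where
  open NestedWord nw renaming (nest to ν)

  Shape : Sk len → Set
  Shape s = Parsing.Describes ν s id

  shape : Σ (Sk len) Shape
  shape = Parsing.parse ν nest-lt nest-fun nest-inj nest-wn

  call-not-return : ∀ i p j → ν p j ≡ true → ν i p ≡ true → ⊥
  call-not-return = Parsing.call-not-ret ν nest-lt nest-fun nest-inj nest-wn

-- Sums over positions and over annotations.

pos : ∀ n → List (Fin n)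
pos zero    = []
pos (suc n) = zero ∷ map suc (pos n)

funs : List Idx → ∀ n → List (Fin n → Idx)
funs L zero    = (λ ()) ∷ []
funs L (suc n) = concatMap (λ x → map (x ∷ᶠ_) (funs L n)) L

bools : List Bool
bools = false ∷ true ∷ []

glue : ∀ {m k} → Idx → (Fin m → Idx) → Idx → (Fin k → Idx) → Fin (suc (m ℕ.+ suc k)) → Idx
glue x g y h = x ∷ᶠ (g ++ᶠ (y ∷ᶠ h))

glue-inner : ∀ {m k} (x : Idx) (g : Fin m → Idx) y (h : Fin k → Idx) p →
             glue x g y h (inner k p) ≡ g p
glue-inner {m = m} {k} x g y h p rewrite FP.splitAt-↑ˡ m p (suc k) = ≡.refl

glue-ret : ∀ {m k} (x : Idx) (g : Fin m → Idx) y (h : Fin k → Idx) → glue x g y h (ret m k) ≡ y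
glue-ret {m = m} {k} x g y h rewrite FP.splitAt-↑ʳ m (suc k) zero = ≡.refl

glue-after : ∀ {m k} (x : Idx) (g : Fin m → Idx) y (h : Fin k → Idx) p →
             glue x g y h (after m p) ≡ h p
glue-after {m = m} {k} x g y h p rewrite FP.splitAt-↑ʳ m (suc k) (suc p) = ≡.refl

∷ᶠ-cong : ∀ {n} (x : Idx) {g h : Fin n → Idx} → g ≗ h → (x ∷ᶠ g) ≗ (x ∷ᶠ h)
∷ᶠ-cong x e zero    = ≡.refl
∷ᶠ-cong x e (suc p) = e p

∷ᶠ-++ᶠ : ∀ {m n} (x : Idx) (g : Fin m → Idx) (h : Fin n → Idx) → ((x ∷ᶠ g) ++ᶠ h) ≗ (x ∷ᶠ (g ++ᶠ h))
∷ᶠ-++ᶠ x g h zero = ≡.refl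
∷ᶠ-++ᶠ {m = m} x g h (suc p) with F.splitAt m p
... | inj₁ q = ≡.refl
... | inj₂ q = ≡.refl

-- An arbitrary commutative monoid, so that sums, products and Boolean disjunctions share one
-- development.
module MonoidSum {c ℓ} (M : CommutativeMonoid c ℓ) where
  open CommutativeMonoid M renaming (Carrier to C)
  open Relation.Binary.Reasoning.Setoid setoid

  ⨁ : List Idx → (Idx → C) → C
  ⨁ []      f = ε
  ⨁ (x ∷ L) f = f x ∙ ⨁ L f

  ⨁-cong : ∀ (L : List Idx) {f g : Idx → C} → (∀ x → f x ≈ g x) → ⨁ L f ≈ ⨁ L g
  ⨁-cong []      e = refl
  ⨁-cong (x ∷ L) e = ∙-cong (e x) (⨁-cong L e)

  ⨁-map : ∀ (h : Idx → Idx′) (L : List Idx) (f : Idx′ → C) → ⨁ (map h L) f ≡ ⨁ L (f ∘ h)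
  ⨁-map h []      f = ≡.refl
  ⨁-map h (x ∷ L) f = ≡.cong (f (h x) ∙_) (⨁-map h L f)

  ⨁-++ : ∀ (L L' : List Idx) (f : Idx → C) → ⨁ (L ++ L') f ≈ ⨁ L f ∙ ⨁ L' f
  ⨁-++ []      L' f = sym (identityˡ _)
  ⨁-++ (x ∷ L) L' f = trans (∙-congˡ (⨁-++ L L' f)) (sym (assoc _ _ _))

  ⨁-concatMap : ∀ (h : Idx → List Idx′) (L : List Idx) (f : Idx′ → C) →
                ⨁ (concatMap h L) f ≈ ⨁ L (λ x → ⨁ (h x) f)
  ⨁-concatMap h []      f = refl
  ⨁-concatMap h (x ∷ L) f = trans (⨁-++ (h x) _ f) (∙-congˡ (⨁-concatMap h L f))

  ⨁-ε : ∀ (L : List Idx) {f : Idx → C} → (∀ x → f x ≈ ε) → ⨁ L f ≈ ε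
  ⨁-ε []      e = refl
  ⨁-ε (x ∷ L) e = trans (∙-cong (e x) (⨁-ε L e)) (identityˡ ε)

  interchange : ∀ w x y z → (w ∙ x) ∙ (y ∙ z) ≈ (w ∙ y) ∙ (x ∙ z)
  interchange w x y z = begin
    (w ∙ x) ∙ (y ∙ z) ≈⟨ assoc w x _ ⟩
    w ∙ (x ∙ (y ∙ z)) ≈⟨ ∙-congˡ (assoc x y z) ⟨
    w ∙ ((x ∙ y) ∙ z) ≈⟨ ∙-congˡ (∙-congʳ (comm x y)) ⟩
    w ∙ ((y ∙ x) ∙ z) ≈⟨ ∙-congˡ (assoc y x z) ⟩
    w ∙ (y ∙ (x ∙ z)) ≈⟨ assoc w y _ ⟨
    (w ∙ y) ∙ (x ∙ z) ∎

  ⨁-∙ : ∀ (L : List Idx) (f g : Idx → C) → ⨁ L (λ x → f x ∙ g x) ≈ ⨁ L f ∙ ⨁ L g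
  ⨁-∙ []      f g = sym (identityˡ ε)
  ⨁-∙ (x ∷ L) f g = trans (∙-congˡ (⨁-∙ L f g)) (interchange _ _ _ _)

  ⨁-swap : ∀ (L : List Idx) (L' : List Idx′) (f : Idx → Idx′ → C) →
           ⨁ L (λ x → ⨁ L' (f x)) ≈ ⨁ L' (λ y → ⨁ L (λ x → f x y))
  ⨁-swap []      L' f = sym (⨁-ε L' (λ _ → refl))
  ⨁-swap (x ∷ L) L' f = trans (∙-congˡ (⨁-swap L L' f)) (sym (⨁-∙ L' _ _))

  ⨁-pos-suc : ∀ n (f : Fin (suc n) → C) → ⨁ (pos (suc n)) f ≡ f zero ∙ ⨁ (pos n) (f ∘ suc)
  ⨁-pos-suc n f = ≡.cong (f zero ∙_) (⨁-map suc (pos n) f)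

  ⨁-pos-+ : ∀ m n (f : Fin (m ℕ.+ n) → C) →
            ⨁ (pos (m ℕ.+ n)) f ≈ ⨁ (pos m) (λ p → f (p ↑ˡ n)) ∙ ⨁ (pos n) (λ p → f (m ↑ʳ p))
  ⨁-pos-+ zero    n f = sym (identityˡ _)
  ⨁-pos-+ (suc m) n f = begin
    f zero ∙ ⨁ (map suc (pos (m ℕ.+ n))) f
      ≈⟨ ∙-congˡ (reflexive (⨁-map suc (pos (m ℕ.+ n)) f)) ⟩
    f zero ∙ ⨁ (pos (m ℕ.+ n)) (f ∘ suc)
      ≈⟨ ∙-congˡ (⨁-pos-+ m n (f ∘ suc)) ⟩
    f zero ∙ (⨁ (pos m) (λ p → f (suc (p ↑ˡ n))) ∙ ⨁ (pos n) (λ p → f (suc (m ↑ʳ p))))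
      ≈⟨ assoc _ _ _ ⟨
    (f zero ∙ ⨁ (pos m) (λ p → f (suc (p ↑ˡ n)))) ∙ ⨁ (pos n) (λ p → f (suc (m ↑ʳ p)))
      ≈⟨ ∙-congʳ (reflexive (⨁-pos-suc m (λ p → f (p ↑ˡ n)))) ⟨
    ⨁ (pos (suc m)) (λ p → f (p ↑ˡ n)) ∙ ⨁ (pos n) (λ p → f (suc (m ↑ʳ p))) ∎

  ⨁-pos-nest : ∀ m k (f : Fin (suc (m ℕ.+ suc k)) → C) →
    ⨁ (pos (suc (m ℕ.+ suc k))) f ≈
      f zero ∙ (⨁ (pos m) (f ∘ inner k) ∙ (f (ret m k) ∙ ⨁ (pos k) (f ∘ after m)))
  ⨁-pos-nest m k f = begin
    ⨁ (pos (suc (m ℕ.+ suc k))) f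
      ≈⟨ reflexive (⨁-pos-suc (m ℕ.+ suc k) f) ⟩
    f zero ∙ ⨁ (pos (m ℕ.+ suc k)) (f ∘ suc)
      ≈⟨ ∙-congˡ (⨁-pos-+ m (suc k) (f ∘ suc)) ⟩
    f zero ∙ (⨁ (pos m) (f ∘ inner k) ∙ ⨁ (pos (suc k)) (λ p → f (suc (m ↑ʳ p))))
      ≈⟨ ∙-congˡ (∙-congˡ (reflexive (⨁-pos-suc k (λ p → f (suc (m ↑ʳ p)))))) ⟩
    f zero ∙ (⨁ (pos m) (f ∘ inner k) ∙ (f (ret m k) ∙ ⨁ (pos k) (f ∘ after m))) ∎

  -- Regrouped annotations such as `(x ∷ᶠ g) ++ᶠ h` and `x ∷ᶠ (g ++ᶠ h)` agree only pointwise, so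
  -- reindexing needs a summand that respects pointwise equality.
  Ext : ∀ {n} → ((Fin n → Idx) → C) → Set _
  Ext G = ∀ {g h} → g ≗ h → G g ≈ G h

  ⨁-funs-suc : ∀ (L : List Idx) n (G : (Fin (suc n) → Idx) → C) →
               ⨁ (funs L (suc n)) G ≈ ⨁ L (λ x → ⨁ (funs L n) (λ g → G (x ∷ᶠ g)))
  ⨁-funs-suc L n G = trans (⨁-concatMap _ L G)
    (⨁-cong L (λ x → reflexive (⨁-map (x ∷ᶠ_) (funs L n) G)))

  ⨁-funs-+ : ∀ (L : List Idx) m n (G : (Fin (m ℕ.+ n) → Idx) → C) → Ext G →
             ⨁ (funs L (m ℕ.+ n)) G ≈ ⨁ (funs L m) (λ g → ⨁ (funs L n) (λ h → G (g ++ᶠ h)))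
  ⨁-funs-+ L zero    n G ext = sym (identityʳ _)
  ⨁-funs-+ L (suc m) n G ext = begin
    ⨁ (funs L (suc (m ℕ.+ n))) G
      ≈⟨ ⨁-funs-suc L (m ℕ.+ n) G ⟩
    ⨁ L (λ x → ⨁ (funs L (m ℕ.+ n)) (λ g → G (x ∷ᶠ g)))
      ≈⟨ ⨁-cong L (λ x → ⨁-funs-+ L m n (λ g → G (x ∷ᶠ g)) (λ e → ext (∷ᶠ-cong x e))) ⟩
    ⨁ L (λ x → ⨁ (funs L m) (λ g → ⨁ (funs L n) (λ h → G (x ∷ᶠ (g ++ᶠ h)))))
      ≈⟨ ⨁-cong L (λ x → ⨁-cong (funs L m) (λ g → ⨁-cong (funs L n) (λ h → ext (∷ᶠ-++ᶠ x g h)))) ⟨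
    ⨁ L (λ x → ⨁ (funs L m) (λ g → ⨁ (funs L n) (λ h → G ((x ∷ᶠ g) ++ᶠ h))))
      ≈⟨ ⨁-funs-suc L m _ ⟨
    ⨁ (funs L (suc m)) (λ g → ⨁ (funs L n) (λ h → G (g ++ᶠ h))) ∎

  ⨁-funs-nest : ∀ (L : List Idx) m k (G : (Fin (suc (m ℕ.+ suc k)) → Idx) → C) → Ext G →
    ⨁ (funs L (suc (m ℕ.+ suc k))) G ≈
      ⨁ L (λ x → ⨁ (funs L m) (λ g → ⨁ L (λ y → ⨁ (funs L k) (λ h → G (glue x g y h)))))
  ⨁-funs-nest L m k G ext = trans (⨁-funs-suc L _ G) (⨁-cong L (λ x →
    trans (⨁-funs-+ L m (suc k) _ (λ e → ext (∷ᶠ-cong x e))) (⨁-cong (funs L m) (λ g →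
      ⨁-funs-suc L k _))))

  ⨁-bools : ∀ (f : Bool → C) → ⨁ bools f ≈ f false ∙ f true
  ⨁-bools f = ∙-congˡ (identityʳ _)

  -- The Boolean is an argument of `f`, so that multiplication by an indicator, conjunction and
  -- repetition of a monoid element are all instances.
  ⨁-δ : ∀ {n} (f : Fin n → Bool → C) (p : Fin n) → (∀ q → f q false ≈ ε) →
        ⨁ (pos n) (λ q → f q (eqF p q)) ≈ f p true
  ⨁-δ {suc n} f zero e = begin
    f zero true ∙ ⨁ (map suc (pos n)) (λ q → f q (eqF zero q))
      ≈⟨ ∙-congˡ (reflexive (⨁-map suc (pos n) _)) ⟩
    f zero true ∙ ⨁ (pos n) (λ q → f (suc q) false)
      ≈⟨ ∙-congˡ (⨁-ε (pos n) (λ q → e (suc q))) ⟩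
    f zero true ∙ ε ≈⟨ identityʳ _ ⟩
    f zero true ∎
  ⨁-δ {suc n} f (suc p) e = begin
    f zero false ∙ ⨁ (map suc (pos n)) (λ q → f q (eqF (suc p) q))
      ≈⟨ ∙-cong (e zero) (reflexive (⨁-map suc (pos n) _)) ⟩
    ε ∙ ⨁ (pos n) (λ q → f (suc q) (eqF p q)) ≈⟨ identityˡ _ ⟩
    ⨁ (pos n) (λ q → f (suc q) (eqF p q)) ≈⟨ ⨁-δ (f ∘ suc) p (e ∘ suc) ⟩
    f (suc p) true ∎

module SemiringSum {c ℓ} (K : CommutativeSemiring c ℓ) where
  open CommutativeSemiring K renaming (Carrier to C) hiding (zero)
  open MonoidSum +-commutativeMonoid public
  open MonoidSum *-commutativeMonoid public using ()
    renaming (⨁ to ⨂; ⨁-cong to ⨂-cong; ⨁-map to ⨂-map; ⨁-pos-suc to ⨂-pos-suc;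
              ⨁-pos-nest to ⨂-pos-nest; ⨁-funs-suc to ⨂-funs-suc; ⨁-bools to ⨂-bools;
              interchange to *-interchange; ⨁-ε to ⨂-ε)
  open Relation.Binary.Reasoning.Setoid setoid

  [_] : Bool → C
  [ true ]  = 1#
  [ false ] = 0#

  [∧] : ∀ x y → [ x ∧ y ] ≈ [ x ] * [ y ]
  [∧] true  y = sym (*-identityˡ _)
  [∧] false y = sym (zeroˡ _)

  ⨁-*ˡ : ∀ (L : List Idx) w (f : Idx → C) → w * ⨁ L f ≈ ⨁ L (λ x → w * f x)
  ⨁-*ˡ []      w f = zeroʳ w
  ⨁-*ˡ (x ∷ L) w f = trans (distribˡ w _ _) (+-congˡ (⨁-*ˡ L w f))

  ⨁-*ʳ : ∀ (L : List Idx) w (f : Idx → C) → ⨁ L f * w ≈ ⨁ L (λ x → f x * w)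
  ⨁-*ʳ []      w f = zeroˡ w
  ⨁-*ʳ (x ∷ L) w f = trans (distribʳ w _ _) (+-congˡ (⨁-*ʳ L w f))

  ⨁-* : ∀ (L : List Idx) (L' : List Idx′) f g →
        ⨁ L f * ⨁ L' g ≈ ⨁ L (λ x → ⨁ L' (λ y → f x * g y))
  ⨁-* L L' f g = trans (⨁-*ʳ L _ f) (⨁-cong L (λ x → ⨁-*ˡ L' (f x) g))

  ⨁-pick : ∀ {n} (f : Fin n → C) p → ⨁ (pos n) (λ q → [ eqF p q ] * f q) ≈ f p
  ⨁-pick f p = trans (⨁-δ (λ q b → [ b ] * f q) p (λ q → zeroˡ _)) (*-identityˡ _)

  module BigOperators (d : ℕ) where
    open Weighted K d using (∑; ∏; ∑B; ∏B; bigFun)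

    ∑-⨁ : ∀ n f → ∑ n f ≈ ⨁ (pos n) f
    ∑-⨁ zero    f = refl
    ∑-⨁ (suc n) f = +-congˡ (trans (∑-⨁ n (f ∘ suc)) (sym (reflexive (⨁-map suc (pos n) f))))

    ∏-⨂ : ∀ n f → ∏ n f ≈ ⨂ (pos n) f
    ∏-⨂ zero    f = refl
    ∏-⨂ (suc n) f = *-congˡ (trans (∏-⨂ n (f ∘ suc)) (sym (reflexive (⨂-map suc (pos n) f))))

    bigFun-⨁ : ∀ {Idx′ : Set} (op : (Idx′ → C) → C) L → (∀ f → op f ≈ ⨁ L f) →
               ∀ n G → bigFun op n G ≈ ⨁ (funs L n) G
    bigFun-⨁ op L e zero    G = sym (+-identityʳ _)
    bigFun-⨁ op L e (suc n) G = trans (e _) (trans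
      (⨁-cong L (λ x → bigFun-⨁ op L e n _)) (sym (⨁-funs-suc L n G)))

    bigFun-⨂ : ∀ n G → bigFun ∏B n G ≈ ⨂ (funs bools n) G
    bigFun-⨂ zero    G = sym (*-identityʳ _)
    bigFun-⨂ (suc n) G = trans (*-cong (bigFun-⨂ n _) (bigFun-⨂ n _))
      (trans (sym (⨂-bools (λ b → ⨂ (funs bools n) (λ g → G (b ∷ᶠ g))))) (sym (⨂-funs-suc bools n G)))

    ∑-sets : ∀ n G → bigFun ∑B n G ≈ ⨁ (funs bools n) G
    ∑-sets = bigFun-⨁ ∑B bools (λ f → sym (⨁-bools f))

    ∑-runs : ∀ q n G → bigFun (∑ q) n G ≈ ⨁ (funs (pos q) n) G
    ∑-runs q = bigFun-⨁ (∑ q) (pos q) (∑-⨁ q)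

-- Finite sets of states and finite algebras.

-- A retract of some `Fin size`: `enc` need not be onto, and runs of an encoded algebra only reach
-- codes in its image.
record Finite (X : Set) : Set where
  field
    size    : ℕ
    enc     : X → Fin size
    dec     : Fin size → X
    dec-enc : ∀ x → dec (enc x) ≡ x

Fin-finite : ∀ n → Finite (Fin n)
Fin-finite n = record { size = n ; enc = id ; dec = id ; dec-enc = λ _ → ≡.refl }

×-finite : Finite X → Finite Y → Finite (X × Y)
Finite.size (×-finite S T) = Finite.size S ℕ.* Finite.size T
Finite.enc (×-finite S T) (x , y) = F.combine (Finite.enc S x) (Finite.enc T y)
Finite.dec (×-finite S T) k = Finite.dec S (proj₁ (F.remQuot (Finite.size T) k)) ,
  Finite.dec T (proj₂ (F.remQuot {Finite.size S} (Finite.size T) k))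
Finite.dec-enc (×-finite S T) (x , y) = ≡.trans
  (≡.cong (λ z → Finite.dec S (proj₁ z) , Finite.dec T (proj₂ z)) (FP.remQuot-combine (Finite.enc S x) (Finite.enc T y)))
  (≡.cong₂ _,_ (Finite.dec-enc S x) (Finite.dec-enc T y))

⊎-finite : Finite X → Finite Y → Finite (X ⊎ Y)
Finite.size (⊎-finite S T) = Finite.size S ℕ.+ Finite.size T
Finite.enc (⊎-finite S T) (inj₁ x) = Finite.enc S x ↑ˡ Finite.size T
Finite.enc (⊎-finite S T) (inj₂ y) = Finite.size S ↑ʳ Finite.enc T y
Finite.dec (⊎-finite S T) k = [ inj₁ ∘ Finite.dec S , inj₂ ∘ Finite.dec T ]′ (F.splitAt (Finite.size S) k)
Finite.dec-enc (⊎-finite S T) (inj₁ x) rewrite FP.splitAt-↑ˡ (Finite.size S) (Finite.enc S x) (Finite.size T) =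
  ≡.cong inj₁ (Finite.dec-enc S x)
Finite.dec-enc (⊎-finite S T) (inj₂ y) rewrite FP.splitAt-↑ʳ (Finite.size S) (Finite.size T) (Finite.enc T y) =
  ≡.cong inj₂ (Finite.dec-enc T y)

Vec-finite : Finite X → ∀ n → Finite (Vec X n)
Vec-finite S zero = record { size = 1 ; enc = λ _ → zero ; dec = λ _ → [] ; dec-enc = λ { [] → ≡.refl } }
Vec-finite {X} S (suc n) = record
  { size = Finite.size P ; enc = λ { (x ∷ v) → Finite.enc P (x , v) }
  ; dec = λ k → proj₁ (Finite.dec P k) ∷ proj₂ (Finite.dec P k)
  ; dec-enc = λ { (x ∷ v) → ≡.cong (λ p → proj₁ p ∷ proj₂ p) (Finite.dec-enc P (x , v)) } }
  where
  P : Finite (X × Vec X n)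
  P = ×-finite S (Vec-finite S n)

Bool-finite : Finite Bool
Bool-finite = record
  { size = 2 ; enc = λ { false → zero ; true → suc zero } ; dec = λ { zero → false ; (suc _) → true }
  ; dec-enc = λ { false → ≡.refl ; true → ≡.refl } }

-- In N a x b y, the states x and y are those of the factors enclosed by and following the call a and return b.
record Alg (A X : Set) : Set where
  field
    e : X
    I : A → X → X
    N : A → X → A → X → X

run : Alg A X → ∀ {n} → Sk n → (Fin n → A) → X
run D end                f = Alg.e D
run D (int s)            f = Alg.I D (f zero) (run D s (f ∘ suc))
run D (nest {m} {k} u v) f =
  Alg.N D (f zero) (run D u (f ∘ inner k)) (f (ret m k)) (run D v (f ∘ after m))

run-ext : ∀ (D : Alg A X) {n} (s : Sk n) {f g : Fin n → A} → f ≗ g → run D s f ≡ run D s g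
run-ext D end     e = ≡.refl
run-ext D (int s) e rewrite e zero = ≡.cong (Alg.I D _) (run-ext D s (e ∘ suc))
run-ext D (nest {m} {k} u v) e rewrite e zero | e (ret m k) =
  ≡.cong₂ (λ x y → Alg.N D _ x _ y) (run-ext D u (e ∘ inner k)) (run-ext D v (e ∘ after m))

run-nest : ∀ (D : Alg A X) {m k} (u : Sk m) (v : Sk k) {f : Fin (suc (m ℕ.+ suc k)) → A} {a b g h} →
  f zero ≡ a → f (ret m k) ≡ b → f ∘ inner k ≗ g → f ∘ after m ≗ h →
  run D (nest u v) f ≡ Alg.N D a (run D u g) b (run D v h)
run-nest D u v ≡.refl ≡.refl eu ev =
  ≡.cong₂ (λ x y → Alg.N D _ x _ y) (run-ext D u eu) (run-ext D v ev)

encode : (S : Finite X) → Alg A X → Alg A (Fin (Finite.size S))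
encode S D = record
  { e = Finite.enc S (Alg.e D)
  ; I = λ a x → Finite.enc S (Alg.I D a (Finite.dec S x))
  ; N = λ a x b y → Finite.enc S (Alg.N D a (Finite.dec S x) b (Finite.dec S y)) }

run-encode : ∀ (S : Finite X) (D : Alg A X) {n} (s : Sk n) f → run (encode S D) s f ≡ Finite.enc S (run D s f)
run-encode S D end f = ≡.refl
run-encode S D (int s) f rewrite run-encode S D s (f ∘ suc) | Finite.dec-enc S (run D s (f ∘ suc)) = ≡.refl
run-encode S D (nest {m} {k} u v) f
  rewrite run-encode S D u (f ∘ inner k) | Finite.dec-enc S (run D u (f ∘ inner k))
        | run-encode S D v (f ∘ after m) | Finite.dec-enc S (run D v (f ∘ after m)) = ≡.refl

pairAlg : Alg A X → Alg A Y → Alg A (X × Y)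
pairAlg D E = record
  { e = Alg.e D , Alg.e E
  ; I = λ { a (x , y) → Alg.I D a x , Alg.I E a y }
  ; N = λ { a (x , y) b (x' , y') → Alg.N D a x b x' , Alg.N E a y b y' } }

run-pair : ∀ (D : Alg A X) (E : Alg A Y) {n} (s : Sk n) f →
           run (pairAlg D E) s f ≡ (run D s f , run E s f)
run-pair D E end f = ≡.refl
run-pair D E (int s) f rewrite run-pair D E s (f ∘ suc) = ≡.refl
run-pair D E (nest {m} {k} u v) f
  rewrite run-pair D E u (f ∘ inner k) | run-pair D E v (f ∘ after m) = ≡.refl

eqF-inner-ret : ∀ {m} k (p : Fin m) → eqF (inner k p) (ret m k) ≡ false
eqF-inner-ret k p = eqF-↑ˡ↑ʳ p zero

mark-inner-inner : ∀ {m} k (p q : Fin m) → eqF (inner k p) (inner k q) ≡ eqF p q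
mark-inner-inner k = eqF-↑ˡ (suc k)

mark-inner-after : ∀ {m k} (p : Fin m) (q : Fin k) → eqF (inner k p) (after m q) ≡ false
mark-inner-after p q = eqF-↑ˡ↑ʳ p (suc q)

mark-ret-inner : ∀ {m} k (q : Fin m) → eqF (ret m k) (inner k q) ≡ false
mark-ret-inner {m} k q = eqF-↑ʳ↑ˡ (zero {k}) q

mark-ret-ret : ∀ m k → eqF (ret m k) (ret m k) ≡ true
mark-ret-ret m k = eqF-refl (ret m k)

mark-ret-after : ∀ m {k} (q : Fin k) → eqF (ret m k) (after m q) ≡ false
mark-ret-after m q = eqF-↑ʳ m zero (suc q)

mark-after-inner : ∀ {m k} (p : Fin k) (q : Fin m) → eqF (after m p) (inner k q) ≡ false
mark-after-inner p q = eqF-↑ʳ↑ˡ (suc p) q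

mark-after-ret : ∀ m {k} (p : Fin k) → eqF (after m p) (ret m k) ≡ false
mark-after-ret m p = eqF-↑ʳ m (suc p) zero

mark-after-after : ∀ m {k} (p q : Fin k) → eqF (after m p) (after m q) ≡ eqF p q
mark-after-after m p q = eqF-↑ʳ m (suc p) (suc q)

-- Recognisable series and their closure properties.

module Linear {c ℓ} (K : CommutativeSemiring c ℓ) where
  open CommutativeSemiring K renaming (Carrier to C) hiding (zero)
  open SemiringSum K
  open Relation.Binary.Reasoning.Setoid setoid
  open SemiringSolver K using (solve; _:=_; _:*_)

  -- A finite family of series closed under the shifts that remove the leading
  -- internal position or the leading call - factor - return, up to finite
  -- linear combinations: the semantic form of a weighted tree automaton.
  record Family (A : Set) : Set (Level.suc 0ℓ ⊔ c ⊔ ℓ) where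
    field
      Ix     : Set
      finite : Finite Ix
      F      : Ix → ∀ {n} → Sk n → (Fin n → A) → C
      e      : Ix → C
      rI     : Ix → A → List (C × Ix)
      rN     : Ix → A → A → List (C × Ix × Ix)
      F-end  : ∀ i f → F i end f ≈ e i
      F-int  : ∀ i {n} (s : Sk n) f →
               F i (int s) f ≈ ⨁ (rI i (f zero)) (λ (w , j) → w * F j s (f ∘ suc))
      F-nest : ∀ i {m k} (u : Sk m) (v : Sk k) f →
               F i (nest u v) f ≈ ⨁ (rN i (f zero) (f (ret m k)))
                 (λ (w , j , l) → w * (F j u (f ∘ inner k) * F l v (f ∘ after m)))

    -- `F` is an arbitrary function on labellings; its invariance under pointwise equality is forced
    -- by the three laws, which read labels one at a time.
    F-ext : ∀ i {n} (s : Sk n) {f g : Fin n → A} → f ≗ g → F i s f ≈ F i s g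
    F-ext i end eq = trans (F-end i _) (sym (F-end i _))
    F-ext i (int s) {f} {g} eq = begin
      F i (int s) f ≈⟨ F-int i s f ⟩
      ⨁ (rI i (f zero)) (λ (w , j) → w * F j s (f ∘ suc))
        ≈⟨ ⨁-cong (rI i (f zero)) (λ (w , j) → *-congˡ (F-ext j s (eq ∘ suc))) ⟩
      ⨁ (rI i (f zero)) (λ (w , j) → w * F j s (g ∘ suc))
        ≡⟨ ≡.cong (λ a → ⨁ (rI i a) (λ (w , j) → w * F j s (g ∘ suc))) (eq zero) ⟩
      ⨁ (rI i (g zero)) (λ (w , j) → w * F j s (g ∘ suc)) ≈⟨ F-int i s g ⟨
      F i (int s) g ∎
    F-ext i (nest {m} {k} u v) {f} {g} eq = begin
      F i (nest u v) f ≈⟨ F-nest i u v f ⟩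
      ⨁ (rN i (f zero) (f (ret m k))) (λ (w , j , l) → w * (F j u (f ∘ inner k) * F l v (f ∘ after m)))
        ≈⟨ ⨁-cong (rN i (f zero) (f (ret m k))) (λ (w , j , l) →
             *-congˡ (*-cong (F-ext j u (eq ∘ inner k)) (F-ext l v (eq ∘ after m)))) ⟩
      ⨁ (rN i (f zero) (f (ret m k))) (λ (w , j , l) → w * (F j u (g ∘ inner k) * F l v (g ∘ after m)))
        ≡⟨ ≡.cong₂ (λ a b → ⨁ (rN i a b) (λ (w , j , l) → w * (F j u (g ∘ inner k) * F l v (g ∘ after m))))
             (eq zero) (eq (ret m k)) ⟩
      ⨁ (rN i (g zero) (g (ret m k))) (λ (w , j , l) → w * (F j u (g ∘ inner k) * F l v (g ∘ after m)))
        ≈⟨ F-nest i u v g ⟨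
      F i (nest u v) g ∎

    F-nest′ : ∀ i {m k} (u : Sk m) (v : Sk k) {f} {a b g h} →
      f zero ≡ a → f (ret m k) ≡ b → f ∘ inner k ≗ g → f ∘ after m ≗ h →
      F i (nest u v) f ≈ ⨁ (rN i a b) (λ (w , j , l) → w * (F j u g * F l v h))
    F-nest′ i u v {f} ≡.refl ≡.refl eu ev = trans (F-nest i u v f)
      (⨁-cong (rN i _ _) (λ (w , j , l) → *-congˡ (*-cong (F-ext j u eu) (F-ext l v ev))))

  Series : Set → Set c
  Series A = ∀ {n} → Sk n → (Fin n → A) → C

  record Recognisable {A : Set} (S : Series A) : Set (Level.suc 0ℓ ⊔ c ⊔ ℓ) where
    field
      family : Family A
    open Family family public
    field
      init : List (C × Ix)
      law  : ∀ {n} (s : Sk n) f → S s f ≈ ⨁ init (λ (w , i) → w * F i s f)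

  pick : ∀ {n} (f : Fin n → C) p → ⨁ (pos n) (λ q → f q * [ eqF p q ]) ≈ f p
  pick {n} f p = trans (⨁-cong (pos n) (λ q → *-comm _ _)) (⨁-pick f p)

  module _ {a b} {X : Set a} {Y : Set b} where
    ⨁-pairsWith : ∀ {z} {Z : Set z} (h : X → Y → Z) (L : List X) (L' : List Y) (f : Z → C) →
      ⨁ (concatMap (λ x → map (h x) L') L) f ≈ ⨁ L (λ x → ⨁ L' (λ y → f (h x y)))
    ⨁-pairsWith h L L' f = trans (⨁-concatMap _ L f) (⨁-cong L (λ x → reflexive (⨁-map (h x) L' f)))

  addFamily : Family A → Family A → Family A
  addFamily P Q = record
    { Ix = Family.Ix P ⊎ Family.Ix Q ; finite = ⊎-finite (Family.finite P) (Family.finite Q)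
    ; F = λ { (inj₁ i) → Family.F P i ; (inj₂ i) → Family.F Q i }
    ; e = λ { (inj₁ i) → Family.e P i ; (inj₂ i) → Family.e Q i }
    ; rI = λ { (inj₁ i) a → map (λ (w , j) → w , inj₁ j) (Family.rI P i a)
             ; (inj₂ i) a → map (λ (w , j) → w , inj₂ j) (Family.rI Q i a) }
    ; rN = λ { (inj₁ i) a b → map (λ (w , j , l) → w , inj₁ j , inj₁ l) (Family.rN P i a b)
             ; (inj₂ i) a b → map (λ (w , j , l) → w , inj₂ j , inj₂ l) (Family.rN Q i a b) }
    ; F-end = λ { (inj₁ i) f → Family.F-end P i f ; (inj₂ i) f → Family.F-end Q i f }
    ; F-int = λ { (inj₁ i) s f → trans (Family.F-int P i s f) (sym (reflexive (⨁-map _ (Family.rI P i _) _)))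
                ; (inj₂ i) s f → trans (Family.F-int Q i s f) (sym (reflexive (⨁-map _ (Family.rI Q i _) _))) }
    ; F-nest = λ { (inj₁ i) u v f → trans (Family.F-nest P i u v f) (sym (reflexive (⨁-map _ (Family.rN P i _ _) _)))
                 ; (inj₂ i) u v f → trans (Family.F-nest Q i u v f) (sym (reflexive (⨁-map _ (Family.rN Q i _ _) _))) } }

  -- The pointwise product: commutativity of multiplication collects the coefficients of two rules
  -- and pairs the series that both rules use on the same factor.
  mulFamily : Family A → Family A → Family A
  mulFamily P Q = record
    { Ix = P.Ix × Q.Ix ; finite = ×-finite P.finite Q.finite
    ; F = λ (i , i') s f → P.F i s f * Q.F i' s f
    ; e = λ (i , i') → P.e i * Q.e i'
    ; rI = λ (i , i') a → concatMap (λ x → map (hI x) (Q.rI i' a)) (P.rI i a)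
    ; rN = λ (i , i') a b → concatMap (λ x → map (hN x) (Q.rN i' a b)) (P.rN i a b)
    ; F-end = λ (i , i') f → *-cong (P.F-end i f) (Q.F-end i' f)
    ; F-int = λ (i , i') s f → trans (*-cong (P.F-int i s f) (Q.F-int i' s f)) (trans
        (⨁-* (P.rI i _) (Q.rI i' _) _ _) (trans
        (⨁-cong (P.rI i _) (λ x → ⨁-cong (Q.rI i' _) (λ y → *-interchange _ _ _ _)))
        (sym (⨁-pairsWith hI (P.rI i _) (Q.rI i' _) _))))
    ; F-nest = λ (i , i') u v f → trans (*-cong (P.F-nest i u v f) (Q.F-nest i' u v f)) (trans
        (⨁-* (P.rN i _ _) (Q.rN i' _ _) _ _) (trans
        (⨁-cong (P.rN i _ _) (λ x → ⨁-cong (Q.rN i' _ _) (λ y →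
           trans (*-interchange _ _ _ _) (*-congˡ (*-interchange _ _ _ _)))))
        (sym (⨁-pairsWith hN (P.rN i _ _) (Q.rN i' _ _) _)))) }
    where
    module P = Family P
    module Q = Family Q
    hI : C × P.Ix → C × Q.Ix → C × (P.Ix × Q.Ix)
    hI (w , j) (w' , j') = w * w' , (j , j')
    hN : C × P.Ix × P.Ix → C × Q.Ix × Q.Ix → C × (P.Ix × Q.Ix) × (P.Ix × Q.Ix)
    hN (w , j , l) (w' , j' , l') = w * w' , (j , j') , (l , l')

  module _ {S T : Series A} (RS : Recognisable S) (RT : Recognisable T) where
    private
      module P = Recognisable RS
      module Q = Recognisable RT

    add-recognisable : Recognisable {A} (λ s f → S s f + T s f)
    add-recognisable = record
      { family = addFamily P.family Q.family
      ; init = map (λ (w , i) → w , inj₁ i) P.init ++ map (λ (w , i) → w , inj₂ i) Q.init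
      ; law = λ s f → trans (+-cong (P.law s f) (Q.law s f)) (sym (trans
          (⨁-++ (map _ P.init) (map _ Q.init) _)
          (+-cong (reflexive (⨁-map _ P.init _)) (reflexive (⨁-map _ Q.init _))))) }

    mul-recognisable : Recognisable {A} (λ s f → S s f * T s f)
    mul-recognisable = record
      { family = mulFamily P.family Q.family
      ; init = concatMap (λ x → map (h x) Q.init) P.init
      ; law = λ s f → trans (*-cong (P.law s f) (Q.law s f)) (trans
          (⨁-* P.init Q.init _ _) (trans
          (⨁-cong P.init (λ x → ⨁-cong Q.init (λ y → *-interchange _ _ _ _)))
          (sym (⨁-pairsWith h P.init Q.init _)))) }
      where
      h : C × P.Ix → C × Q.Ix → C × (P.Ix × Q.Ix)
      h (w , i) (w' , i') = w * w' , (i , i')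

  -- Runs of an algebra are deterministic, so in the sum over candidate states of the factors only
  -- the states actually reached contribute.
  stateFamily : ∀ {N} → Alg A (Fin N) → Family A
  stateFamily {A} {N} D = record
    { Ix = Fin N ; finite = Fin-finite N
    ; F = λ x s f → [ eqF (run D s f) x ]
    ; e = λ x → [ eqF (Alg.e D) x ]
    ; rI = λ x a → map (λ y → [ eqF (Alg.I D a y) x ] , y) (pos N)
    ; rN = λ x a b → concatMap (λ y → map (hN x a b y) (pos N)) (pos N)
    ; F-end = λ x f → refl
    ; F-int = λ x s f → sym (trans (reflexive (⨁-map _ (pos N) _)) (pick _ (run D s (f ∘ suc))))
    ; F-nest = λ {x {m} {k} u v f → sym (trans (⨁-pairsWith (hN x _ _) (pos N) (pos N) _) (trans
        (⨁-cong (pos N) (λ y → trans (⨁-cong (pos N) (λ z → sym (*-assoc _ _ _)))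
          (pick (λ z → [ eqF (Alg.N D _ y _ z) x ] * [ eqF (run D u (f ∘ inner k)) y ]) (run D v (f ∘ after m)))))
        (pick (λ y → [ eqF (Alg.N D _ y _ (run D v (f ∘ after m))) x ]) (run D u (f ∘ inner k))))) } }
    where
    hN : Fin N → A → A → Fin N → Fin N → C × Fin N × Fin N
    hN x a b y z = [ eqF (Alg.N D a y b z) x ] , y , z

  state-recognisable : ∀ {N} (D : Alg A (Fin N)) (out : Fin N → C) →
                       Recognisable {A} (λ s f → out (run D s f))
  state-recognisable {N = N} D out = record
    { family = stateFamily D
    ; init = map (λ x → out x , x) (pos N)
    ; law = λ s f → sym (trans (reflexive (⨁-map _ (pos N) _)) (pick out (run D s f))) }

  module _ (r : A → B → X) (Bs : List B) where

    -- The annotation of a block is an independent choice for its call, its return and its two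
    -- factors. Distributivity turns the sum over the factors into a product of sums, and the
    -- choices at call and return are absorbed into longer rule lists, so the indices stay the same.
    relabelFamily : Family X → Family A
    relabelFamily P = record
      { Ix = P.Ix ; finite = P.finite
      ; F = λ i {n} s f → ⨁ (funs Bs n) (λ g → P.F i s (λ p → r (f p) (g p)))
      ; e = P.e
      ; rI = λ i a → concatMap (λ b → P.rI i (r a b)) Bs
      ; rN = λ i a a' → concatMap (λ b → concatMap (λ b' → P.rN i (r a b) (r a' b')) Bs) Bs
      ; F-end = λ i f → trans (+-identityʳ _) (P.F-end i _)
      ; F-int = λ i {n} s f → begin
          ⨁ (funs Bs (suc n)) (λ g → P.F i (int s) (λ p → r (f p) (g p)))
            ≈⟨ ⨁-funs-suc Bs n _ ⟩
          ⨁ Bs (λ b → ⨁ (funs Bs n) (λ g → P.F i (int s) (λ p → r (f p) ((b VF.∷ g) p))))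
            ≈⟨ ⨁-cong Bs (λ b → ⨁-cong (funs Bs n) (λ g → P.F-int i s _)) ⟩
          ⨁ Bs (λ b → ⨁ (funs Bs n) (λ g → ⨁ (P.rI i (r (f zero) b)) (λ (w , j) →
            w * P.F j s (λ p → r (f (suc p)) (g p)))))
            ≈⟨ ⨁-cong Bs (λ b → trans (⨁-swap (funs Bs n) (P.rI i _) _)
                 (⨁-cong (P.rI i _) (λ (w , j) → sym (⨁-*ˡ (funs Bs n) w _)))) ⟩
          ⨁ Bs (λ b → ⨁ (P.rI i (r (f zero) b)) (λ (w , j) →
            w * ⨁ (funs Bs n) (λ g → P.F j s (λ p → r (f (suc p)) (g p)))))
            ≈⟨ ⨁-concatMap (λ b → P.rI i (r (f zero) b)) Bs _ ⟨
          _ ∎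
      ; F-nest = λ { i {m} {k} u v f → begin
          ⨁ (funs Bs (suc (m ℕ.+ suc k))) (λ g → P.F i (nest u v) (λ p → r (f p) (g p)))
            ≈⟨ ⨁-funs-nest Bs m k _ (λ eq → P.F-ext i (nest u v) (λ p → ≡.cong (r (f p)) (eq p))) ⟩
          ⨁ Bs (λ b → ⨁ (funs Bs m) (λ g → ⨁ Bs (λ b' → ⨁ (funs Bs k) (λ h →
            P.F i (nest u v) (λ p → r (f p) (glue b g b' h p))))))
            ≈⟨ ⨁-cong Bs (λ b → ⨁-cong (funs Bs m) (λ g → ⨁-cong Bs (λ b' → ⨁-cong (funs Bs k) (λ h →
                 P.F-nest′ i u v ≡.refl (≡.cong (r _) (glue-ret b g b' h))
                   (λ p → ≡.cong (r _) (glue-inner b g b' h p))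
                   (λ p → ≡.cong (r _) (glue-after b g b' h p)))))) ⟩
          ⨁ Bs (λ b → ⨁ (funs Bs m) (λ g → ⨁ Bs (λ b' → ⨁ (funs Bs k) (λ h →
            ⨁ (P.rN i (r (f zero) b) (r (f (ret m k)) b')) (λ (w , j , l) →
              w * (P.F j u (λ p → r (f (inner k p)) (g p)) * P.F l v (λ p → r (f (after m p)) (h p))))))))
            -- The rule list depends on the annotations of call and return only; once these two are
            -- chosen first, it can be moved out of the sums over the factors.
            ≈⟨ ⨁-cong Bs (λ b → ⨁-swap (funs Bs m) Bs _) ⟩
          ⨁ Bs (λ b → ⨁ Bs (λ b' → ⨁ (funs Bs m) (λ g → ⨁ (funs Bs k) (λ h →
            ⨁ (P.rN i (r (f zero) b) (r (f (ret m k)) b')) (λ (w , j , l) →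
              w * (P.F j u (λ p → r (f (inner k p)) (g p)) * P.F l v (λ p → r (f (after m p)) (h p))))))))
            ≈⟨ ⨁-cong Bs (λ b → ⨁-cong Bs (λ b' → trans
                 (⨁-cong (funs Bs m) (λ g → ⨁-swap (funs Bs k) (P.rN i _ _) _)) (trans
                 (⨁-swap (funs Bs m) (P.rN i _ _) _)
                 (⨁-cong (P.rN i _ _) (λ (w , j , l) → trans
                    (⨁-cong (funs Bs m) (λ g → sym (⨁-*ˡ (funs Bs k) w _))) (trans
                    (sym (⨁-*ˡ (funs Bs m) w _))
                    (*-congˡ (sym (⨁-* (funs Bs m) (funs Bs k) _ _))))))))) ⟩
          ⨁ Bs (λ b → ⨁ Bs (λ b' → ⨁ (P.rN i (r (f zero) b) (r (f (ret m k)) b')) (λ (w , j , l) →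
              w * (⨁ (funs Bs m) (λ g → P.F j u (λ p → r (f (inner k p)) (g p)))
                   * ⨁ (funs Bs k) (λ h → P.F l v (λ p → r (f (after m p)) (h p)))))))
            ≈⟨ ⨁-cong Bs (λ b → ⨁-concatMap (λ b' → P.rN i (r (f zero) b) (r (f (ret m k)) b')) Bs _) ⟨
          ⨁ Bs (λ b → ⨁ (concatMap (λ b' → P.rN i (r (f zero) b) (r (f (ret m k)) b')) Bs) _)
            ≈⟨ ⨁-concatMap (λ b → concatMap (λ b' → P.rN i (r (f zero) b) (r (f (ret m k)) b')) Bs) Bs _ ⟨
          _ ∎ } }
      where module P = Family P

    relabel-recognisable : {S : Series X} → Recognisable S →
      Recognisable {A} (λ {n} s f → ⨁ (funs Bs n) (λ g → S s (λ p → r (f p) (g p))))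
    relabel-recognisable RS = record
      { family = relabelFamily P.family
      ; init = P.init
      ; law = λ {n} s f → trans (⨁-cong (funs Bs n) (λ g → P.law s _)) (trans
          (⨁-swap (funs Bs n) P.init _)
          (⨁-cong P.init (λ (w , i) → sym (⨁-*ˡ (funs Bs n) w _)))) }
      where module P = Recognisable RS

  module _ (r : A → Bool → X) where

    mark : ∀ {n} → (Fin n → A) → Fin n → Fin n → X
    mark f p q = r (f q) (eqF p q)

    unmarked : ∀ {n} → (Fin n → A) → Fin n → X
    unmarked f q = r (f q) false

    -- inj₁ i is the i-th series on the unmarked labelling, inj₂ i sums it over one marked position.
    markFamily : Family X → Family A
    markFamily P = record
      { Ix = P.Ix ⊎ P.Ix ; finite = ⊎-finite P.finite P.finite
      ; F = λ { (inj₁ i) s f → P.F i s (unmarked f)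
              ; (inj₂ i) {n} s f → ⨁ (pos n) (λ p → P.F i s (mark f p)) }
      -- The empty factor has no position to mark.
      ; e = λ { (inj₁ i) → P.e i ; (inj₂ i) → 0# }
      ; rI = λ { (inj₁ i) a → map g (P.rI i (r a false))
               ; (inj₂ i) a → map g (P.rI i (r a true)) ++ map h (P.rI i (r a false)) }
      ; rN = λ { (inj₁ i) a b → map gg (P.rN i (r a false) (r b false))
               -- The mark is on the call, in the enclosed factor, on the return or in the following
               -- factor, in the order of `⨁-pos-nest`.
               ; (inj₂ i) a b → map gg (P.rN i (r a true) (r b false))
                              ++ (map hg (P.rN i (r a false) (r b false))
                              ++ (map gg (P.rN i (r a false) (r b true))
                              ++ map gh (P.rN i (r a false) (r b false)))) }
      ; F-end = λ { (inj₁ i) f → P.F-end i _ ; (inj₂ i) f → refl }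
      ; F-int = λ { (inj₁ i) s f → trans (P.F-int i s _) (sym (reflexive (⨁-map g (P.rI i _) _)))
                  ; (inj₂ i) {n} s f → trans (reflexive (⨁-pos-suc n _)) (trans (+-cong
                      (trans (P.F-int i s _) (sym (reflexive (⨁-map g (P.rI i _) _))))
                      (trans (⨁-cong (pos n) (λ p → P.F-int i s _)) (trans
                        (⨁-swap (pos n) (P.rI i _) _) (trans
                        (⨁-cong (P.rI i _) (λ (w , j) → sym (⨁-*ˡ (pos n) w _)))
                        (sym (reflexive (⨁-map h (P.rI i _) _)))))))
                      (sym (⨁-++ (map g (P.rI i _)) _ _))) }
      ; F-nest = λ { (inj₁ i) u v f → trans (P.F-nest i u v _) (sym (reflexive (⨁-map gg (P.rN i _ _) _)))
                   ; (inj₂ i) {m} {k} u v f → trans (⨁-pos-nest m k _) (trans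
                       (+-cong (trans (P.F-nest i u v _) (sym (reflexive (⨁-map gg (P.rN i _ _) _))))
                       (+-cong (trans (⨁-cong (pos m) (λ p → P.F-nest′ i u v ≡.refl
                                        (≡.cong (r _) (eqF-inner-ret k p))
                                        (λ q → ≡.cong (r _) (mark-inner-inner k p q))
                                        (λ q → ≡.cong (r _) (mark-inner-after p q)))) (trans
                                 (⨁-swap (pos m) (P.rN i _ _) _) (trans
                                 (⨁-cong (P.rN i _ _) (λ (w , j , l) → trans (sym (⨁-*ˡ (pos m) w _))
                                    (*-congˡ (sym (⨁-*ʳ (pos m) _ _)))))
                                 (sym (reflexive (⨁-map hg (P.rN i _ _) _))))))
                       (+-cong (trans (P.F-nest′ i u v ≡.refl (≡.cong (r _) (mark-ret-ret m k))
                                        (λ q → ≡.cong (r _) (mark-ret-inner k q))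
                                        (λ q → ≡.cong (r _) (mark-ret-after m q)))
                                 (sym (reflexive (⨁-map gg (P.rN i _ _) _))))
                               (trans (⨁-cong (pos k) (λ p → P.F-nest′ i u v ≡.refl
                                        (≡.cong (r _) (mark-after-ret m p))
                                        (λ q → ≡.cong (r _) (mark-after-inner p q))
                                        (λ q → ≡.cong (r _) (mark-after-after m p q)))) (trans
                                 (⨁-swap (pos k) (P.rN i _ _) _) (trans
                                 (⨁-cong (P.rN i _ _) (λ (w , j , l) → trans (sym (⨁-*ˡ (pos k) w _))
                                    (*-congˡ (sym (⨁-*ˡ (pos k) _ _)))))
                                 (sym (reflexive (⨁-map gh (P.rN i _ _) _)))))))))
                       (sym (trans (⨁-++ (map gg (P.rN i _ _)) _ _) (+-congˡ (trans
                         (⨁-++ (map hg (P.rN i _ _)) _ _) (+-congˡ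
                         (⨁-++ (map gg (P.rN i _ _)) (map gh (P.rN i _ _)) _))))))) } }
      where
      module P = Family P
      g h : C × P.Ix → C × (P.Ix ⊎ P.Ix)
      g (w , j) = w , inj₁ j
      h (w , j) = w , inj₂ j
      gg hg gh : C × P.Ix × P.Ix → C × (P.Ix ⊎ P.Ix) × (P.Ix ⊎ P.Ix)
      gg (w , j , l) = w , inj₁ j , inj₁ l
      hg (w , j , l) = w , inj₂ j , inj₁ l
      gh (w , j , l) = w , inj₁ j , inj₂ l

    mark-recognisable : {S : Series X} → Recognisable S →
      Recognisable {A} (λ {n} s f → ⨁ (pos n) (λ p → S s (mark f p)))
    mark-recognisable RS = record
      { family = markFamily P.family
      ; init = map (λ (w , i) → w , inj₂ i) P.init
      ; law = λ {n} s f → trans (⨁-cong (pos n) (λ p → P.law s _)) (trans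
          (⨁-swap (pos n) P.init _) (trans
          (⨁-cong P.init (λ (w , i) → sym (⨁-*ˡ (pos n) w _)))
          (sym (reflexive (⨁-map _ P.init _))))) }
      where module P = Recognisable RS

    -- The index (x , t) guesses the state x of the unmarked factor and the map t
    -- sending the state of the factor to that of the whole word.
    module _ {N} (D : Alg X (Fin N)) (out : Fin N → C) where
      open Alg D using (I) renaming (N to J)
      private
        -- Self-maps of the state set stored as tables, which form a `Finite` type.
        Context : Set
        Context = Vec (Fin N) N
        val : Context → Fin N → C
        val t x = out (Vec.lookup t x)
        comp : Context → (Fin N → Fin N) → Context
        comp t h = Vec.tabulate (λ x → Vec.lookup t (h x))
        val-comp : ∀ t h x → val t (h x) ≈ val (comp t h) x
        val-comp t h x = reflexive (≡.cong out (≡.sym (VP.lookup∘tabulate _ x)))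
        G : Fin N × Context → ∀ {n} → Sk n → (Fin n → A) → C
        G (x , t) {n} s f = [ eqF (run D s (unmarked f)) x ] * ⨂ (pos n) (λ p → val t (run D s (mark f p)))
        hI : Fin N × Context → A → Fin N → C × (Fin N × Context)
        hI (x , t) a y = [ eqF (I (r a false) y) x ] * val t (I (r a true) y) , (y , comp t (I (r a false)))
        hN : Fin N × Context → A → A → Fin N → Fin N → C × (Fin N × Context) × (Fin N × Context)
        hN (x , t) a b y z =
          [ eqF (J (r a false) y (r b false) z) x ]
            * (val t (J (r a true) y (r b false) z) * val t (J (r a false) y (r b true) z)) ,
          (y , comp t (λ y' → J (r a false) y' (r b false) z)) ,
          (z , comp t (λ z' → J (r a false) y (r b false) z'))

      -- A mark lies in at most one of the two factors, so the other one is in its unmarked state.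
      -- Since that state is part of the guess, the map taking the state of the marked factor to the
      -- state of the whole word is determined by the rule, and the product over the positions of a
      -- block becomes a product of two series of the same kind.
      productFamily : Family A
      productFamily = record
        { Ix = Fin N × Context
        ; finite = ×-finite (Fin-finite N) (Vec-finite (Fin-finite N) N)
        ; F = G
        ; e = λ (x , t) → [ eqF (Alg.e D) x ] * 1#
        ; rI = λ i a → map (hI i a) (pos N)
        ; rN = λ i a b → concatMap (λ y → map (hN i a b y) (pos N)) (pos N)
        ; F-end = λ i f → refl
        ; F-int = λ { (x , t) {n} s f →
            let R = run D s (unmarked (f ∘ suc))
                a0 = r (f zero) false
                a1 = r (f zero) true
                Π : (Fin N → C) → C
                Π = λ g → ⨂ (pos n) (λ p → g (run D s (mark (f ∘ suc) p)))
            in begin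
              G (x , t) (int s) f
                ≈⟨ *-congˡ (reflexive (⨂-pos-suc n _)) ⟩
              [ eqF (I a0 R) x ] * (val t (I a1 R) * Π (λ y → val t (I a0 y)))
                ≈⟨ *-assoc _ _ _ ⟨
              ([ eqF (I a0 R) x ] * val t (I a1 R)) * Π (λ y → val t (I a0 y))
                ≈⟨ *-congˡ (⨂-cong (pos n) (λ p → val-comp t (I a0) _)) ⟩
              ([ eqF (I a0 R) x ] * val t (I a1 R)) * Π (val (comp t (I a0)))
                ≈⟨ pick _ R ⟨
              ⨁ (pos N) (λ y → (([ eqF (I a0 y) x ] * val t (I a1 y)) * Π (val (comp t (I a0)))) * [ eqF R y ])
                ≈⟨ ⨁-cong (pos N) (λ y → solve 3 (λ u v w → (u :* v) :* w := u :* (w :* v)) refl _ _ _) ⟩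
              ⨁ (pos N) (λ y → ([ eqF (I a0 y) x ] * val t (I a1 y)) * ([ eqF R y ] * Π (val (comp t (I a0)))))
                ≡⟨ ⨁-map (hI (x , t) (f zero)) (pos N) _ ⟨
              _ ∎ }
        ; F-nest = λ { (x , t) {m} {k} u v f →
            let Ru = run D u (unmarked (f ∘ inner k))
                Rv = run D v (unmarked (f ∘ after m))
                a0 = r (f zero) false
                a1 = r (f zero) true
                b0 = r (f (ret m k)) false
                b1 = r (f (ret m k)) true
                Πu : (Fin N → C) → C
                Πu = λ g → ⨂ (pos m) (λ p → g (run D u (mark (f ∘ inner k) p)))
                Πv : (Fin N → C) → C
                Πv = λ g → ⨂ (pos k) (λ p → g (run D v (mark (f ∘ after m) p)))
            in begin
              G (x , t) (nest u v) f
                ≈⟨ *-congˡ (⨂-pos-nest m k _) ⟩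
              [ eqF (J a0 Ru b0 Rv) x ] * (val t (J a1 Ru b0 Rv) *
                (⨂ (pos m) (λ p → val t (run D (nest u v) (mark f (inner k p)))) *
                (val t (run D (nest u v) (mark f (ret m k))) *
                 ⨂ (pos k) (λ p → val t (run D (nest u v) (mark f (after m p)))))))
                ≈⟨ *-congˡ (*-congˡ (*-cong
                     (⨂-cong (pos m) (λ p → trans (reflexive (≡.cong (val t) (run-nest D u v {mark f (inner k p)} ≡.refl
                        (≡.cong (r _) (eqF-inner-ret k p))
                        (λ q → ≡.cong (r _) (mark-inner-inner k p q))
                        (λ q → ≡.cong (r _) (mark-inner-after p q))))) (val-comp t (λ y → J a0 y b0 Rv) _)))
                     (*-cong (reflexive (≡.cong (val t) (run-nest D u v {mark f (ret m k)} ≡.refl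
                        (≡.cong (r _) (mark-ret-ret m k))
                        (λ q → ≡.cong (r _) (mark-ret-inner k q))
                        (λ q → ≡.cong (r _) (mark-ret-after m q)))))
                     (⨂-cong (pos k) (λ p → trans (reflexive (≡.cong (val t) (run-nest D u v {mark f (after m p)} ≡.refl
                        (≡.cong (r _) (mark-after-ret m p))
                        (λ q → ≡.cong (r _) (mark-after-inner p q))
                        (λ q → ≡.cong (r _) (mark-after-after m p q))))) (val-comp t (λ z → J a0 Ru b0 z) _)))))) ⟩
              [ eqF (J a0 Ru b0 Rv) x ] * (val t (J a1 Ru b0 Rv) *
                (Πu (val (comp t (λ y → J a0 y b0 Rv))) *
                (val t (J a0 Ru b1 Rv) * Πv (val (comp t (λ z → J a0 Ru b0 z))))))
                -- The unmarked states of the two factors are replaced by summation variables; each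
                -- indicator then joins the product over its own factor.
                ≈⟨ pick (λ y → [ eqF (J a0 y b0 Rv) x ] * (val t (J a1 y b0 Rv) *
                     (Πu (val (comp t (λ y' → J a0 y' b0 Rv))) *
                     (val t (J a0 y b1 Rv) * Πv (val (comp t (λ z → J a0 y b0 z))))))) Ru ⟨
              ⨁ (pos N) (λ y → _ * [ eqF Ru y ])
                ≈⟨ ⨁-cong (pos N) (λ y → pick (λ z → ([ eqF (J a0 y b0 z) x ] * (val t (J a1 y b0 z) *
                     (Πu (val (comp t (λ y' → J a0 y' b0 z))) *
                     (val t (J a0 y b1 z) * Πv (val (comp t (λ z' → J a0 y b0 z'))))))) * [ eqF Ru y ]) Rv) ⟨
              ⨁ (pos N) (λ y → ⨁ (pos N) (λ z → _ * [ eqF Rv z ]))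
                ≈⟨ ⨁-cong (pos N) (λ y → ⨁-cong (pos N) (λ z →
                     solve 7 (λ d v w P Q i j → ((d :* (v :* (P :* (w :* Q)))) :* i) :* j
                              := (d :* (v :* w)) :* ((i :* P) :* (j :* Q))) refl _ _ _ _ _ _ _)) ⟩
              ⨁ (pos N) (λ y → ⨁ (pos N) (λ z →
                ([ eqF (J a0 y b0 z) x ] * (val t (J a1 y b0 z) * val t (J a0 y b1 z))) *
                (([ eqF Ru y ] * Πu (val (comp t (λ y' → J a0 y' b0 z)))) *
                 ([ eqF Rv z ] * Πv (val (comp t (λ z' → J a0 y b0 z')))))))
                ≈⟨ ⨁-pairsWith (hN (x , t) (f zero) (f (ret m k))) (pos N) (pos N) _ ⟨
              _ ∎ } }

      product-recognisable : Recognisable {A} (λ {n} s f → ⨂ (pos n) (λ p → out (run D s (mark f p))))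
      product-recognisable = record
        { family = productFamily
        -- At the top the factor is the whole word, hence the identity map; all guesses of its
        -- unmarked state are offered and one survives.
        ; init = map (λ x → 1# , (x , Vec.tabulate id)) (pos N)
        ; law = λ {n} s f → begin
            ⨂ (pos n) (λ p → out (run D s (mark f p)))
              ≈⟨ ⨂-cong (pos n) (λ p → reflexive (≡.cong out (≡.sym (VP.lookup∘tabulate id _)))) ⟩
            ⨂ (pos n) (λ p → val (Vec.tabulate id) (run D s (mark f p)))
              ≈⟨ ⨁-pick (λ _ → ⨂ (pos n) (λ p → val (Vec.tabulate id) (run D s (mark f p)))) (run D s (unmarked f)) ⟨
            ⨁ (pos N) (λ x → G (x , Vec.tabulate id) s f)
              ≈⟨ ⨁-cong (pos N) (λ x → sym (*-identityˡ _)) ⟩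
            ⨁ (pos N) (λ x → 1# * G (x , Vec.tabulate id) s f)
              ≡⟨ ⨁-map _ (pos N) _ ⟨
            _ ∎ }

-- Counting up to an eventual period.

module ℕSum = SemiringSum ℕP.+-*-commutativeSemiring
module ℕLinear = Linear ℕP.+-*-commutativeSemiring

-- ℕ with J + 1 identified with i ≤ J.
module Lasso {J : ℕ} (i : Fin (suc J)) where

  next : Fin (suc J) → Fin (suc J)
  next k with suc (toℕ k) ℕ.<? suc J
  ... | yes lt = F.fromℕ< lt
  ... | no  _  = i

  red : ℕ → Fin (suc J)
  red zero    = zero
  red (suc n) = next (red n)

  next-spec : ∀ k → toℕ (next k) ≡ suc (toℕ k) ⊎ (suc (toℕ k) ≡ suc J × next k ≡ i)
  next-spec k with suc (toℕ k) ℕ.<? suc J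
  ... | yes lt = inj₁ (FP.toℕ-fromℕ< lt)
  ... | no ¬lt = inj₂ (ℕP.≤-antisym (FP.toℕ<n k) (ℕP.≮⇒≥ ¬lt) , ≡.refl)

  toℕ-red : ∀ n → n ℕ.< suc J → toℕ (red n) ≡ n
  toℕ-red zero    _  = ≡.refl
  toℕ-red (suc n) lt with toℕ-red n (ℕP.<-trans ℕP.≤-refl lt) | next-spec (red n)
  ... | eq | inj₁ eq' = ≡.trans eq' (≡.cong suc eq)
  ... | eq | inj₂ (full , _) = ⊥-elim (ℕP.<-irrefl (≡.trans (≡.cong suc (≡.sym eq)) full) lt)

  red-toℕ : ∀ k → red (toℕ k) ≡ k
  red-toℕ k = FP.toℕ-injective (toℕ-red (toℕ k) (FP.toℕ<n k))

  -- Adding `c` on the left iterates `next`, which respects equality of `red`; commutativity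
  -- transfers this to the other summand.
  red-+ : ∀ a a' b b' → red a ≡ red a' → red b ≡ red b' → red (a ℕ.+ b) ≡ red (a' ℕ.+ b')
  red-+ a a' b b' ea eb = ≡.trans (right a eb) (≡.trans (≡.cong red (ℕP.+-comm a b'))
      (≡.trans (right b' ea) (≡.cong red (ℕP.+-comm b' a'))))
    where
    right : ∀ c {x y} → red x ≡ red y → red (c ℕ.+ x) ≡ red (c ℕ.+ y)
    right zero    e = e
    right (suc c) e = ≡.cong next (right c e)

  red-* : ∀ a a' b b' → red a ≡ red a' → red b ≡ red b' → red (a ℕ.* b) ≡ red (a' ℕ.* b')
  red-* a a' b b' ea eb = ≡.trans (right a eb) (≡.trans (≡.cong red (ℕP.*-comm a b'))
      (≡.trans (right b' ea) (≡.cong red (ℕP.*-comm b' a'))))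
    where
    right : ∀ c {x y} → red x ≡ red y → red (c ℕ.* x) ≡ red (c ℕ.* y)
    right zero    e = ≡.refl
    right (suc c) {x} {y} e = red-+ x y (c ℕ.* x) (c ℕ.* y) e (right c e)

  red-⨁ : ∀ {a} {Y : Set a} (L : List Y) {f g : Y → ℕ} → (∀ x → red (f x) ≡ red (g x)) →
          red (ℕSum.⨁ L f) ≡ red (ℕSum.⨁ L g)
  red-⨁ []      e = ≡.refl
  red-⨁ (x ∷ L) {f} {g} e = red-+ (f x) (g x) (ℕSum.⨁ L f) (ℕSum.⨁ L g) (e x) (red-⨁ L e)

  module _ (P : ℕLinear.Family A) where
    open ℕLinear.Family P
    open Finite finite

    private
      Counts : Set
      Counts = Vec (Fin (suc J)) size

      _!_ : Counts → Ix → ℕ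
      v ! j = toℕ (Vec.lookup v (enc j))

    -- The laws of a family express the values on a word as polynomials in the values on its
    -- factors. As `red` is a congruence for sums and products, the vector of reduced values is a
    -- state that can be computed bottom-up.
    countAlg : Alg A Counts
    countAlg = record
      { e = Vec.tabulate (λ x → red (e (dec x)))
      ; I = λ a v → Vec.tabulate (λ x → red (ℕSum.⨁ (rI (dec x) a) (λ (w , j) → w ℕ.* (v ! j))))
      ; N = λ a v b v' → Vec.tabulate (λ x → red (ℕSum.⨁ (rN (dec x) a b)
              (λ (w , j , l) → w ℕ.* ((v ! j) ℕ.* (v' ! l))))) }

    run-count : ∀ {n} (s : Sk n) f x → Vec.lookup (run countAlg s f) x ≡ red (F (dec x) s f)
    run-count-! : ∀ {n} (s : Sk n) f j → red (run countAlg s f ! j) ≡ red (F j s f)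
    run-count end f x = ≡.trans (VP.lookup∘tabulate _ x) (≡.cong red (≡.sym (F-end (dec x) f)))
    run-count (int s) f x = ≡.trans (VP.lookup∘tabulate _ x) (≡.trans
      (red-⨁ (rI (dec x) _) (λ (w , j) → red-* w w (run countAlg s _ ! j) (F j s _) ≡.refl (run-count-! s _ j)))
      (≡.cong red (≡.sym (F-int (dec x) s f))))
    run-count (nest u v) f x = ≡.trans (VP.lookup∘tabulate _ x) (≡.trans
      (red-⨁ (rN (dec x) _ _) (λ (w , j , l) → red-* w w
        ((run countAlg u _ ! j) ℕ.* (run countAlg v _ ! l)) (F j u _ ℕ.* F l v _) ≡.refl
        (red-* (run countAlg u _ ! j) (F j u _) (run countAlg v _ ! l) (F l v _)
          (run-count-! u _ j) (run-count-! v _ l))))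
      (≡.cong red (≡.sym (F-nest (dec x) u v f))))
    run-count-! s f j = ≡.trans (red-toℕ _) (≡.trans (run-count s f (enc j))
      (≡.cong (λ i' → red (F i' s f)) (dec-enc j)))

-- Step functions and their sums.

module StepFunctions {c ℓ} (V : Setoid c ℓ) where
  open Setoid V renaming (Carrier to C)

  record Step {A : Set} (S : ∀ {n} → Sk n → (Fin n → A) → C) : Set (Level.suc 0ℓ ⊔ c ⊔ ℓ) where
    field
      {size} : ℕ
      alg    : Alg A (Fin size)
      out    : Fin size → C
      law    : ∀ {n} (s : Sk n) f → S s f ≈ out (run alg s f)

  finite-step : ∀ (T : Finite X) (D : Alg A X) (out : X → C) → Step (λ s f → out (run D s f))
  finite-step T D out = record
    { alg = encode T D ; out = out ∘ Finite.dec T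
    ; law = λ s f → reflexive (≡.cong out (≡.sym (≡.trans
        (≡.cong (Finite.dec T) (run-encode T D s f)) (Finite.dec-enc T _)))) }

  step-resp : {S T : ∀ {n} → Sk n → (Fin n → A) → C} → (∀ {n} (s : Sk n) f → S s f ≈ T s f) → Step {A} T → Step {A} S
  step-resp e ST = record
    { alg = Step.alg ST ; out = Step.out ST ; law = λ s f → trans (e s f) (Step.law ST s f) }

  step-const : ∀ x → Step {A} (λ s f → x)
  step-const x = record
    { alg = record { e = zero {0} ; I = λ _ _ → zero ; N = λ _ _ _ _ → zero }
    ; out = λ _ → x ; law = λ _ _ → refl }

module _ {a b a′ b′ a″ b″} (U : Setoid a b) (V : Setoid a′ b′) (W : Setoid a″ b″) where
  private
    module U = Setoid U
    module V = Setoid V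
    module W = Setoid W
    module SU = StepFunctions U
    module SV = StepFunctions V
    module SW = StepFunctions W

  step-map₂ : ∀ (op : U.Carrier → V.Carrier → W.Carrier) →
    (∀ {x x' y y'} → x U.≈ x' → y V.≈ y' → op x y W.≈ op x' y') →
    {S : ∀ {n} → Sk n → (Fin n → A) → U.Carrier} {T : ∀ {n} → Sk n → (Fin n → A) → V.Carrier} →
    SU.Step {A} S → SV.Step {A} T → SW.Step {A} (λ s f → op (S s f) (T s f))
  step-map₂ {A = A} op op-cong ST TT = SW.step-resp
    (λ s f → W.trans (op-cong (SU.Step.law ST s f) (SV.Step.law TT s f))
      (W.reflexive (≡.cong (λ (x , y) → op (SU.Step.out ST x) (SV.Step.out TT y))
        (≡.sym (run-pair (SU.Step.alg ST) (SV.Step.alg TT) s f)))))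
    (SW.finite-step (×-finite (Fin-finite _) (Fin-finite _)) (pairAlg (SU.Step.alg ST) (SV.Step.alg TT))
      (λ (x , y) → op (SU.Step.out ST x) (SV.Step.out TT y)))

module _ {a b a′ b′} (U : Setoid a b) (V : Setoid a′ b′) where
  private
    module U = Setoid U
    module V = Setoid V
    module SU = StepFunctions U
    module SV = StepFunctions V

  step-map : ∀ (op : U.Carrier → V.Carrier) → (∀ {x x'} → x U.≈ x' → op x V.≈ op x') →
    {S : ∀ {n} → Sk n → (Fin n → A) → U.Carrier} → SU.Step {A} S → SV.Step {A} (λ s f → op (S s f))
  step-map op op-cong ST = record
    { alg = SU.Step.alg ST ; out = λ x → op (SU.Step.out ST x) ; law = λ s f → op-cong (SU.Step.law ST s f) }

-- Sums of step functions whose values have finite order: it suffices to count,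
-- for each state, how often it is reached, up to a common period.
module MonoidStep {c ℓ} (M : CommutativeMonoid c ℓ) where
  open CommutativeMonoid M renaming (Carrier to C)
  open MonoidSum M
  open Mult monoid using (×-homo-+) renaming (_×_ to _·_)
  open StepFunctions setoid
  open Relation.Binary.Reasoning.Setoid setoid

  HasPeriod : ∀ {J} → Fin (suc J) → C → Set ℓ
  HasPeriod {J} i x = suc J · x ≈ toℕ i · x

  -- One preperiod and one period for the whole tuple, because a single quotient of the natural
  -- numbers has to serve all states of an algebra.
  Periodic : Set (c ⊔ ℓ)
  Periodic = ∀ {N} (xs : Fin N → C) → Σ ℕ λ J → Σ (Fin (suc J)) λ i → ∀ k → HasPeriod i (xs k)

  ·-red : ∀ {J} (i : Fin (suc J)) x → HasPeriod i x → ∀ n → n · x ≈ toℕ (Lasso.red i n) · x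
  ·-red i x h zero    = refl
  ·-red i x h (suc n) with Lasso.next-spec i (Lasso.red i n)
  ... | inj₁ eq = trans (∙-congˡ (·-red i x h n)) (reflexive (≡.cong (_· x) (≡.sym eq)))
  ... | inj₂ (full , eq) = begin
    x ∙ n · x                            ≈⟨ ∙-congˡ (·-red i x h n) ⟩
    suc (toℕ (Lasso.red i n)) · x        ≡⟨ ≡.cong (_· x) full ⟩
    _                                    ≈⟨ h ⟩
    toℕ i · x                            ≡⟨ ≡.cong (λ k → toℕ k · x) eq ⟨
    toℕ (Lasso.next i (Lasso.red i n)) · x ∎

  count : ∀ {a} {Y : Set a} {N} → List Y → (Y → Fin N) → Fin N → ℕ
  count L g x = ℕSum.⨁ L (λ y → ℕSum.[ eqF (g y) x ])

  -- Grouping the summands by the state they reach leaves multiples of finitely many elements.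
  ⨁-count : ∀ {a} {Y : Set a} {N} (L : List Y) (g : Y → Fin N) (h : Fin N → C) →
            ⨁ L (h ∘ g) ≈ ⨁ (pos N) (λ x → count L g x · h x)
  ⨁-count {N = N} [] g h = sym (⨁-ε (pos N) (λ _ → refl))
  ⨁-count {N = N} (y ∷ L) g h = begin
    h (g y) ∙ ⨁ L (h ∘ g)
      ≈⟨ ∙-cong (trans (⨁-δ (λ x b → ℕSum.[ b ] · h x) (g y) (λ _ → refl)) (identityʳ _)) (sym (⨁-count L g h)) ⟨
    ⨁ (pos N) (λ x → ℕSum.[ eqF (g y) x ] · h x) ∙ ⨁ (pos N) (λ x → count L g x · h x)
      ≈⟨ ⨁-∙ (pos N) _ _ ⟨
    ⨁ (pos N) (λ x → ℕSum.[ eqF (g y) x ] · h x ∙ count L g x · h x)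
      ≈⟨ ⨁-cong (pos N) (λ x → ×-homo-+ (h x) ℕSum.[ eqF (g y) x ] (count L g x)) ⟨
    ⨁ (pos N) (λ x → count (y ∷ L) g x · h x) ∎

  count-step : Periodic → ∀ {N} (P : ℕLinear.Family A) (ix : Fin N → ℕLinear.Family.Ix P) (h : Fin N → C) →
    Step {A} (λ s f → ⨁ (pos N) (λ x → ℕLinear.Family.F P (ix x) s f · h x))
  count-step periodic {N} P ix h with periodic h
  ... | J , i , hp = step-resp
    (λ s f → ⨁-cong (pos N) (λ x → trans (·-red i (h x) (hp x) (F (ix x) s f))
      (reflexive (≡.cong (λ k → toℕ k · h x) (≡.sym (≡.trans
        (run-count P s f (Finite.enc finite (ix x)))
        (≡.cong (λ j → red (F j s f)) (Finite.dec-enc finite (ix x)))))))))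
    (finite-step (Vec-finite (Fin-finite (suc J)) (Finite.size finite)) (countAlg P)
      (λ v → ⨁ (pos N) (λ x → toℕ (Vec.lookup v (Finite.enc finite (ix x))) · h x)))
    where
    open Lasso i
    open ℕLinear.Family P

  -- The number of annotations leading to a given state is a recognisable series of natural numbers:
  -- the relabelling of the indicator of that state.
  relabel-step : Periodic → (r : A → B → X) (Bs : List B) →
    {S : ∀ {n} → Sk n → (Fin n → X) → C} → Step {X} S →
    Step {A} (λ {n} s f → ⨁ (funs Bs n) (λ g → S s (λ p → r (f p) (g p))))
  relabel-step periodic r Bs ST = step-resp
    (λ {n} s f → trans (⨁-cong (funs Bs n) (λ g → law s _))
      (⨁-count (funs Bs n) (λ g → run alg s (λ p → r (f p) (g p))) out))
    (count-step periodic (ℕLinear.relabelFamily r Bs (ℕLinear.stateFamily alg)) id out)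
    where open Step ST

  mark-step : Periodic → (r : A → Bool → X) →
    {S : ∀ {n} → Sk n → (Fin n → X) → C} → Step {X} S →
    Step {A} (λ {n} s f → ⨁ (pos n) (λ p → S s (λ q → r (f q) (eqF p q))))
  mark-step periodic r ST = step-resp
    (λ {n} s f → trans (⨁-cong (pos n) (λ p → law s _))
      (⨁-count (pos n) (λ p → run alg s (λ q → r (f q) (eqF p q))) out))
    (count-step periodic (ℕLinear.markFamily r (ℕLinear.stateFamily alg)) inj₂ out)
    where open Step ST

-- Boolean quantifiers and the lexicographic order.

module Or = MonoidSum BP.∨-commutativeMonoid

any : List A → (A → Bool) → Bool
any = Or.⨁

leF : ∀ {n} → Fin n → Fin n → Bool
leF zero    j       = true
leF (suc i) zero    = false
leF (suc i) (suc j) = leF i j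

leF-true : ∀ {n} (i j : Fin n) → leF i j ≡ true → i F.≤ j
leF-true zero    j       _ = ℕ.z≤n
leF-true (suc i) (suc j) e = ℕ.s≤s (leF-true i j e)

true-leF : ∀ {n} (i j : Fin n) → i F.≤ j → leF i j ≡ true
true-leF zero    j       _         = ≡.refl
true-leF (suc i) (suc j) (ℕ.s≤s p) = true-leF i j p

leF-≤? : ∀ {n} (i j : Fin n) → ⌊ i FP.≤? j ⌋ ≡ leF i j
leF-≤? i j with i FP.≤? j
... | yes p = ≡.sym (true-leF i j p)
... | no ¬p with leF i j in eq
...   | false = ≡.refl
...   | true  = ⊥-elim (¬p (leF-true i j eq))

-- lex Y X states that Y precedes X lexicographically (position 0 being the most significant).
lexCase : Bool → Bool → Bool → Bool
lexCase false false r = r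
lexCase false true  r = true
lexCase true  false r = false
lexCase true  true  r = r

lex : ∀ n → (Fin n → Bool) → (Fin n → Bool) → Bool
lex zero    Y X = false
lex (suc n) Y X = lexCase (Y zero) (X zero) (lex n (Y ∘ suc) (X ∘ suc))

FirstDifference : ∀ n → (Fin n → Bool) → (Fin n → Bool) → Fin n → Bool
FirstDifference n Y X y =
  (X y ∧ not (Y y)) ∧ not (any (pos n) (λ z → not (leF y z) ∧ (Y z xor X z)))

-- If the leading bits differ, no later position can be the first difference; if they agree, they do
-- not affect the later ones.
lex-first : ∀ n Y X → any (pos n) (FirstDifference n Y X) ≡ lex n Y X
lex-first zero    Y X = ≡.refl
lex-first (suc n) Y X = ≡.trans (Or.⨁-pos-suc n (FirstDifference (suc n) Y X))
  (≡.trans (≡.cong₂ _∨_ at-zero (Or.⨁-cong (pos n) at-suc)) (cases (Y zero) (X zero)))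
  where
  at-zero : FirstDifference (suc n) Y X zero ≡ X zero ∧ not (Y zero)
  at-zero rewrite Or.⨁-ε (pos (suc n)) {λ z → not (leF (zero {n}) z) ∧ (Y z xor X z)} (λ _ → ≡.refl) =
    BP.∧-identityʳ _
  restrict : Bool → Bool → Fin n → Bool
  restrict b b' y = (X (suc y) ∧ not (Y (suc y))) ∧
    not ((b xor b') ∨ any (pos n) (λ z → not (leF y z) ∧ (Y (suc z) xor X (suc z))))
  at-suc : ∀ y → FirstDifference (suc n) Y X (suc y) ≡ restrict (Y zero) (X zero) y
  at-suc y = ≡.cong (λ b → (X (suc y) ∧ not (Y (suc y))) ∧ not b)
    (Or.⨁-pos-suc n (λ z → not (leF (suc y) z) ∧ (Y z xor X z)))
  never : ∀ {g : Fin n → Bool} → any (pos n) (λ y → g y ∧ false) ≡ false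
  never {g} = Or.⨁-ε (pos n) (λ y → BP.∧-zeroʳ (g y))
  cases : ∀ b b' → (b' ∧ not b) ∨ any (pos n) (restrict b b') ≡ lexCase b b' (lex n (Y ∘ suc) (X ∘ suc))
  cases false false = lex-first n (Y ∘ suc) (X ∘ suc)
  cases false true  = ≡.refl
  cases true  false = never
  cases true  true  = lex-first n (Y ∘ suc) (X ∘ suc)

-- Syntactically unambiguous formulas are indicators.

module Unambiguous {c ℓ} (K : CommutativeSemiring c ℓ) (d : ℕ) where
  open CommutativeSemiring K renaming (Carrier to C) hiding (zero)
  open SemiringSum K
  open BigOperators d
  open Weighted K d
  open Relation.Binary.Reasoning.Setoid setoid

  -- Guarding the second summand by the failure of the first prevents the value `1# + 1#`.
  [∨] : ∀ x y → [ x ] + [ not x ] * [ y ] ≈ [ x ∨ y ]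
  [∨] true  y = trans (+-congˡ (zeroˡ _)) (+-identityʳ _)
  [∨] false y = trans (+-identityˡ _) (*-identityˡ _)

  ⨂-[] : ∀ {a} {A : Set a} (L : List A) (P : A → Bool) → ⨂ L (λ x → [ P x ]) ≈ [ not (Or.⨁ L (not ∘ P)) ]
  ⨂-[] []      P = refl
  ⨂-[] (x ∷ L) P = trans (*-congˡ (⨂-[] L P)) (trans (sym ([∧] (P x) _)) (reflexive (≡.cong [_] (deMorgan (P x) _))))
    where
    deMorgan : ∀ a b → a ∧ not b ≡ not (not a ∨ b)
    deMorgan true  b = ≡.refl
    deMorgan false b = ≡.refl

  -- Exactly one position, resp. set, is the first one satisfying P, if there is any.
  ⨁-first : ∀ n (P : Fin n → Bool) →
    ⨁ (pos n) (λ x → [ P x ] * ⨂ (pos n) (λ y → [ leF x y ∨ not (P y) ])) ≈ [ any (pos n) P ]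
  ⨁-first zero    P = refl
  ⨁-first (suc n) P = begin
    ⨁ (pos (suc n)) (λ x → [ P x ] * ⨂ (pos (suc n)) (λ y → [ leF x y ∨ not (P y) ]))
      ≡⟨ ⨁-pos-suc n _ ⟩
    [ P zero ] * ⨂ (pos (suc n)) (λ y → 1#)
      + ⨁ (pos n) (λ x → [ P (suc x) ] * ⨂ (pos (suc n)) (λ y → [ leF (suc x) y ∨ not (P y) ]))
      ≈⟨ +-cong (trans (*-congˡ (⨂-ε (pos (suc n)) (λ _ → refl))) (*-identityʳ _))
           (⨁-cong (pos n) (λ x → trans (*-congˡ (reflexive (⨂-pos-suc n _)))
             (trans (sym (*-assoc _ _ _)) (trans (*-congʳ (*-comm _ _)) (*-assoc _ _ _))))) ⟩
    [ P zero ] + ⨁ (pos n) (λ x → [ not (P zero) ] *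
      ([ P (suc x) ] * ⨂ (pos n) (λ y → [ leF x y ∨ not (P (suc y)) ])))
      ≈⟨ +-congˡ (trans (sym (⨁-*ˡ (pos n) _ _)) (*-congˡ (⨁-first n (P ∘ suc)))) ⟩
    [ P zero ] + [ not (P zero) ] * [ any (pos n) (P ∘ suc) ]
      ≈⟨ [∨] (P zero) _ ⟩
    [ P zero ∨ any (pos n) (P ∘ suc) ]
      ≡⟨ ≡.cong [_] (Or.⨁-pos-suc n P) ⟨
    [ any (pos (suc n)) P ] ∎

  ⨁-least : ∀ n (P : (Fin n → Bool) → Bool) →
    ⨁ (funs bools n) (λ X → [ P X ] * ⨂ (funs bools n) (λ Y → [ not (lex n Y X) ∨ not (P Y) ]))
      ≈ [ any (funs bools n) P ]
  ⨁-least zero P = trans (+-identityʳ _) (trans (*-congˡ (*-identityˡ _)) (trans (*-identityʳ _)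
    (reflexive (≡.cong [_] (≡.sym (BP.∨-identityʳ (P (λ ()))))))))
  ⨁-least (suc n) P = begin
    ⨁ (funs bools (suc n)) (λ X → [ P X ] * ⨂ (funs bools (suc n)) (test X))
      ≈⟨ trans (⨁-funs-suc bools n _) (⨁-bools (λ b → ⨁ (funs bools n) (λ X →
           [ P (b ∷ᶠ X) ] * ⨂ (funs bools (suc n)) (test (b ∷ᶠ X))))) ⟩
    ⨁ (funs bools n) (λ X → [ P (false ∷ᶠ X) ] * ⨂ (funs bools (suc n)) (test (false ∷ᶠ X)))
      + ⨁ (funs bools n) (λ X → [ P (true ∷ᶠ X) ] * ⨂ (funs bools (suc n)) (test (true ∷ᶠ X)))
      ≈⟨ +-cong (⨁-cong (funs bools n) (λ X → *-congˡ (split (false ∷ᶠ X))))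
                (⨁-cong (funs bools n) (λ X → *-congˡ (split (true ∷ᶠ X)))) ⟩
    -- Sets without the leading position precede those with it. So the former are tested only among
    -- themselves, while the latter additionally require that no set of the first kind satisfies
    -- `P`.
    ⨁ (funs bools n) (λ X → [ P (false ∷ᶠ X) ] *
        (⨂ (funs bools n) (λ Y → [ not (lex n Y X) ∨ not (P (false ∷ᶠ Y)) ]) * ⨂ (funs bools n) (λ Y → 1#)))
      + ⨁ (funs bools n) (λ X → [ P (true ∷ᶠ X) ] *
        (⨂ (funs bools n) (λ Y → [ not (P (false ∷ᶠ Y)) ]) *
         ⨂ (funs bools n) (λ Y → [ not (lex n Y X) ∨ not (P (true ∷ᶠ Y)) ])))
      ≈⟨ +-cong
           (⨁-cong (funs bools n) (λ X → *-congˡ (trans (*-congˡ (⨂-ε (funs bools n) (λ _ → refl))) (*-identityʳ _))))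
           (⨁-cong (funs bools n) (λ X → trans (sym (*-assoc _ _ _)) (trans (*-congʳ (*-comm _ _)) (*-assoc _ _ _)))) ⟩
    ⨁ (funs bools n) (λ X → [ P (false ∷ᶠ X) ] *
        ⨂ (funs bools n) (λ Y → [ not (lex n Y X) ∨ not (P (false ∷ᶠ Y)) ]))
      + ⨁ (funs bools n) (λ X → ⨂ (funs bools n) (λ Y → [ not (P (false ∷ᶠ Y)) ]) *
        ([ P (true ∷ᶠ X) ] * ⨂ (funs bools n) (λ Y → [ not (lex n Y X) ∨ not (P (true ∷ᶠ Y)) ])))
      ≈⟨ +-cong (⨁-least n (P ∘ (false ∷ᶠ_)))
           (trans (sym (⨁-*ˡ (funs bools n) _ _)) (*-cong
             (trans (⨂-[] (funs bools n) _) (reflexive (≡.cong (λ b → [ not b ])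
               (Or.⨁-cong (funs bools n) (λ Y → BP.not-involutive _)))))
             (⨁-least n (P ∘ (true ∷ᶠ_))))) ⟩
    [ any (funs bools n) (P ∘ (false ∷ᶠ_)) ]
      + [ not (any (funs bools n) (P ∘ (false ∷ᶠ_))) ] * [ any (funs bools n) (P ∘ (true ∷ᶠ_)) ]
      ≈⟨ [∨] (any (funs bools n) (P ∘ (false ∷ᶠ_))) (any (funs bools n) (P ∘ (true ∷ᶠ_))) ⟩
    [ any (funs bools n) (P ∘ (false ∷ᶠ_)) ∨ any (funs bools n) (P ∘ (true ∷ᶠ_)) ]
      ≡⟨ ≡.cong [_] (≡.trans (Or.⨁-funs-suc bools n P) (Or.⨁-bools (λ b → any (funs bools n) (P ∘ (b ∷ᶠ_))))) ⟨
    [ any (funs bools (suc n)) P ] ∎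
    where
    test : (Fin (suc n) → Bool) → (Fin (suc n) → Bool) → C
    test X Y = [ not (lex (suc n) Y X) ∨ not (P Y) ]
    split : ∀ X → ⨂ (funs bools (suc n)) (test X) ≈
      ⨂ (funs bools n) (λ Y → test X (false ∷ᶠ Y)) * ⨂ (funs bools n) (λ Y → test X (true ∷ᶠ Y))
    split X = trans (⨂-funs-suc bools n _) (⨂-bools (λ b → ⨂ (funs bools n) (λ Y → test X (b ∷ᶠ Y))))

  renM : ∀ {i j i' j'} → MSO d i j → (Fin i → Fin i') → (Fin j → Fin j') → MSO d i' j'
  renM (atom a) ρ σ = atom (renA ρ σ a)
  renM (or φ ψ) ρ σ = or (renM φ ρ σ) (renM ψ ρ σ)
  renM (neg φ)  ρ σ = neg (renM φ ρ σ)
  renM (ex1 φ)  ρ σ = ex1 (renM φ (lift ρ) σ)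
  renM (ex2 φ)  ρ σ = ex2 (renM φ ρ (lift σ))

  pm : ∀ {i j} → MSO d i j → P i j
  pm φ = pmR lexPair φ id id

  private
    variable
      i j i₁ j₁ i₂ j₂ : ℕ

    lift-∘ : {ρ : Fin i → Fin i₁} {ρ' : Fin i₁ → Fin i₂} {ρ″ : Fin i → Fin i₂} →
             ρ' ∘ ρ ≗ ρ″ → lift ρ' ∘ lift ρ ≗ lift ρ″
    lift-∘ e zero    = ≡.refl
    lift-∘ e (suc x) = ≡.cong suc (e x)

    lift2-∘ : {ρ : Fin i → Fin i₁} {ρ' : Fin i₁ → Fin i₂} {ρ″ : Fin i → Fin i₂} →
              ρ' ∘ ρ ≗ ρ″ → lift2 ρ' ∘ lift ρ ≗ lift2 ρ″
    lift2-∘ e zero    = ≡.refl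
    lift2-∘ e (suc x) = ≡.cong (λ k → suc (suc k)) (e x)

    renA-∘ : (a : Atom d i j) {ρ : Fin i → Fin i₁} {σ : Fin j → Fin j₁} {ρ' : Fin i₁ → Fin i₂} {σ' : Fin j₁ → Fin j₂}
      {ρ″ : Fin i → Fin i₂} {σ″ : Fin j → Fin j₂} → ρ' ∘ ρ ≗ ρ″ → σ' ∘ σ ≗ σ″ → renA ρ' σ' (renA ρ σ a) ≡ renA ρ″ σ″ a
    renA-∘ (eqA x y)  e e' = ≡.cong₂ eqA (e x) (e y)
    renA-∘ (labA a x) e e' = ≡.cong (labA a) (e x)
    renA-∘ (leqA x y) e e' = ≡.cong₂ leqA (e x) (e y)
    renA-∘ (nuA x y)  e e' = ≡.cong₂ nuA (e x) (e y)
    renA-∘ (memA x X) e e' = ≡.cong₂ memA (e x) (e' X)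

  -- Shows that translating under a renaming is translating a renamed formula, which makes the
  -- guards inside a translation recognisable as translations. The statement composes two renamings
  -- because the quantifier cases apply both `lift` and `lift2` to the body.
  pmR-renM : (φ : MSO d i j) {ρ : Fin i → Fin i₁} {σ : Fin j → Fin j₁} {ρ' : Fin i₁ → Fin i₂} {σ' : Fin j₁ → Fin j₂}
    {ρ″ : Fin i → Fin i₂} {σ″ : Fin j → Fin j₂} → ρ' ∘ ρ ≗ ρ″ → σ' ∘ σ ≗ σ″ →
    pmR lexPair (renM φ ρ σ) ρ' σ' ≡ pmR lexPair φ ρ″ σ″
  pmR-renM (atom a) e e' = ≡.cong atomP (renA-∘ a e e')
  pmR-renM (or φ ψ) e e' = ≡.cong₂ orP (pmR-renM φ e e') (pmR-renM ψ e e')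
  pmR-renM (neg φ)  e e' = ≡.cong negP (pmR-renM φ e e')
  pmR-renM (ex1 φ)  e e' = ≡.cong₂ ex1P (pmR-renM φ (lift-∘ e) e') (pmR-renM φ (lift2-∘ e) e')
  pmR-renM (ex2 φ)  e e' = ≡.cong₂ (ex2P lexPair) (pmR-renM φ e (lift-∘ e')) (pmR-renM φ e (lift2-∘ e'))

  pm-renM : (φ : MSO d i j) {ρ : Fin i → Fin i₁} {σ : Fin j → Fin j₁} → pm (renM φ ρ σ) ≡ pmR lexPair φ ρ σ
  pm-renM φ = pmR-renM φ (λ _ → ≡.refl) (λ _ → ≡.refl)

  -- Classical formulas without set quantifiers. Since the translation of a set quantifier contains
  -- `lexPair`, facts about `lexPair` are first proved on this fragment; this is the purpose of the
  -- alternatives of the form `_ ⊎ FO φ` below.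
  data FO : ∀ {i j} → MSO d i j → Set where
    atom : (a : Atom d i j) → FO (atom a)
    or   : {φ ψ : MSO d i j} → FO φ → FO ψ → FO (or φ ψ)
    neg  : {φ : MSO d i j} → FO φ → FO (neg φ)
    ex1  : {φ : MSO d (suc i) j} → FO φ → FO (ex1 φ)

  lexLt-FO : (Y X : Fin j) → FO {i} (lexLt Y X)
  lexLt-FO Y X = ex1 (neg (or (neg (atom _)) (neg (neg (or (neg (neg (atom _))) (neg (neg (ex1 (neg
    (or (neg (neg (atom _))) (neg (or (neg (or (neg (atom _)) (atom _))) (neg (or (neg (atom _)) (atom _)))))))))))))))

  module _ {U : ∀ {i j} → WMSO C d i j → Set c} (su : ∀ {i j} {φ : WMSO C d i j} → SynUnamb φ → U φ) where
    private
      Res : P i j → Set _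
      Res (p , m) = Restricted U p × Restricted U m

      minus : (χ : MSO d i j) {x : P i j} → pm χ ≡ x → SynUnamb (proj₂ x)
      minus χ ≡.refl = χ , inj₂ ≡.refl

      LexRestricted : Set _
      LexRestricted = ∀ {i j} (Y X : Fin j) → Res (lexPair {i} Y X)

      -- Every body of a universal quantifier in χ⁺ and χ⁻ is itself of the form ψ⁻.
      pmR-restricted : ∀ {i j i' j'} (φ : MSO d i j) → LexRestricted ⊎ FO φ →
        (ρ : Fin i → Fin i') (σ : Fin j → Fin j') → Res (pmR lexPair φ ρ σ)
      pmR-restricted (atom a) h ρ σ = atom _ , natom _
      pmR-restricted (or φ ψ) h ρ σ = or (proj₁ rφ) (and (proj₂ rφ) (proj₁ rψ)) , and (proj₂ rφ) (proj₂ rψ)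
        where
        rφ = pmR-restricted φ ([ inj₁ , (λ { (or p q) → inj₂ p }) ]′ h) ρ σ
        rψ = pmR-restricted ψ ([ inj₁ , (λ { (or p q) → inj₂ q }) ]′ h) ρ σ
      pmR-restricted (neg φ) h ρ σ = proj₂ r , proj₁ r
        where
        r = pmR-restricted φ ([ inj₁ , (λ { (neg p) → inj₂ p }) ]′ h) ρ σ
      pmR-restricted (ex1 φ) h ρ σ =
        ex1 (and (proj₁ r) (all1 (su (minus (andC (ltC zero (suc zero)) (renM φ (lift2 ρ) σ))
            (≡.cong (andP (ltP zero (suc zero))) (pm-renM φ))))
          (or (atom _) (and (natom _) (proj₂ r'))))) ,
        all1 (su (minus (renM φ (lift ρ) σ) (pm-renM φ))) (proj₂ r)
        where
        h' : LexRestricted ⊎ FO φ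
        h' = [ inj₁ , (λ { (ex1 p) → inj₂ p }) ]′ h
        r = pmR-restricted φ h' (lift ρ) σ
        r' = pmR-restricted φ h' (lift2 ρ) σ
      pmR-restricted (ex2 φ) (inj₂ ()) ρ σ
      pmR-restricted (ex2 φ) (inj₁ lexR) ρ σ =
        -- `lexLt` is first-order, so its translation computes to `lexPair` and the guard is
        -- definitionally the negative translation of a conjunction.
        ex2 (and (proj₁ r) (all2 (minus (andC (lexLt zero (suc zero)) (renM φ ρ (lift2 σ)))
            (≡.cong (andP (lexPair zero (suc zero))) (pm-renM φ)))
          (or (proj₂ l) (and (proj₁ l) (proj₂ r'))))) ,
        all2 (minus (renM φ ρ (lift σ)) (pm-renM φ)) (proj₂ r)
        where
        r = pmR-restricted φ (inj₁ lexR) ρ (lift σ)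
        r' = pmR-restricted φ (inj₁ lexR) ρ (lift2 σ)
        l = lexR zero (suc zero)

    pm-restricted : (φ : MSO d i j) → Restricted U (proj₁ (pm φ)) × Restricted U (proj₂ (pm φ))
    pm-restricted φ = pmR-restricted φ
      (inj₁ (λ Y X → pmR-restricted (lexLt Y X) (inj₂ (lexLt-FO Y X)) id id)) id id

  pmR-noSetQ : ∀ {i j i' j'} {φ : MSO d i j} → FO φ → (ρ : Fin i → Fin i') (σ : Fin j → Fin j') →
    NoSetQ (proj₁ (pmR lexPair φ ρ σ)) × NoSetQ (proj₂ (pmR lexPair φ ρ σ))
  pmR-noSetQ (atom a) ρ σ = atom _ , natom _
  pmR-noSetQ (or p q) ρ σ = or (proj₁ x) (and (proj₂ x) (proj₁ y)) , and (proj₂ x) (proj₂ y)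
    where
    x = pmR-noSetQ p ρ σ
    y = pmR-noSetQ q ρ σ
  pmR-noSetQ (neg p)  ρ σ = proj₂ (pmR-noSetQ p ρ σ) , proj₁ (pmR-noSetQ p ρ σ)
  pmR-noSetQ (ex1 p)  ρ σ =
    ex1 (and (proj₁ x) (all1 (or (atom _) (and (natom _) (proj₂ y))))) , all1 (proj₂ x)
    where
    x = pmR-noSetQ p (lift ρ) σ
    y = pmR-noSetQ p (lift2 ρ) σ

  module _ (nw : NestedWord d) where
    open NestedWord nw renaming (nest to ν)

    sat : MSO d i j → (Fin i → Fin len) → (Fin j → Fin len → Bool) → Bool
    sat (atom a) ρ σ = evalA nw a ρ σ
    sat (or φ ψ) ρ σ = sat φ ρ σ ∨ sat ψ ρ σ
    sat (neg φ)  ρ σ = not (sat φ ρ σ)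
    sat (ex1 φ)  ρ σ = any (pos len) (λ p → sat φ (p ∷ᶠ ρ) σ)
    sat (ex2 φ)  ρ σ = any (funs bools len) (λ X → sat φ ρ (X ∷ᶠ σ))

    Means : P i j → (Fin i → Fin len) → (Fin j → Fin len → Bool) → Bool → Set ℓ
    Means (p , m) ρ σ b = ⟦ nw ⟧ p ρ σ ≈ [ b ] × ⟦ nw ⟧ m ρ σ ≈ [ not b ]

    ⟦atom⟧ : (a : Atom d i j) → ∀ ρ σ → ⟦ nw ⟧ (atom a) ρ σ ≈ [ evalA nw a ρ σ ]
    ⟦atom⟧ a ρ σ with evalA nw a ρ σ
    ... | true  = refl
    ... | false = refl

    ⟦natom⟧ : (a : Atom d i j) → ∀ ρ σ → ⟦ nw ⟧ (natom a) ρ σ ≈ [ not (evalA nw a ρ σ) ]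
    ⟦natom⟧ a ρ σ with evalA nw a ρ σ
    ... | true  = refl
    ... | false = refl

    private
      neg-means : ∀ (x : P i j) {ρ σ} b → Means x ρ σ b → Means (negP x) ρ σ (not b)
      neg-means x b (p , m) = m , trans p (reflexive (≡.cong [_] (≡.sym (BP.not-involutive b))))

      or-means : ∀ (x y : P i j) {ρ σ} b b' → Means x ρ σ b → Means y ρ σ b' → Means (orP x y) ρ σ (b ∨ b')
      or-means x y b b' (p , m) (p' , m') =
        trans (+-cong p (*-cong m p')) ([∨] b b') ,
        trans (*-cong m m') (trans (sym ([∧] (not b) (not b'))) (reflexive (≡.cong [_] (≡.sym (deMorgan b b')))))
        where
        deMorgan : ∀ a b → not (a ∨ b) ≡ not a ∧ not b
        deMorgan true  b = ≡.refl
        deMorgan false b = ≡.refl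

      evalA-ren : ∀ {i j i' j'} (a : Atom d i j) {ρ : Fin i → Fin i'} {σ : Fin j → Fin j'} {η τ ρ' σ'} →
        η ∘ ρ ≗ ρ' → τ ∘ σ ≗ σ' → evalA nw (renA ρ σ a) η τ ≡ evalA nw a ρ' σ'
      evalA-ren (eqA x y)  e e' = ≡.cong₂ (λ p q → ⌊ p FP.≟ q ⌋) (e x) (e y)
      evalA-ren (labA a x) e e' = ≡.cong (λ p → ⌊ lab p FP.≟ a ⌋) (e x)
      evalA-ren (leqA x y) e e' = ≡.cong₂ (λ p q → ⌊ p FP.≤? q ⌋) (e x) (e y)
      evalA-ren (nuA x y)  e e' = ≡.cong₂ ν (e x) (e y)
      evalA-ren (memA x X) e e' = ≡.cong₂ (λ p Y → Y p) (e x) (e' X)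

      cons-lift : ∀ {B : Set} {i i'} {ρ : Fin i → Fin i'} {η : Fin i' → B} {ρ'} x →
        η ∘ ρ ≗ ρ' → (x ∷ᶠ η) ∘ lift ρ ≗ (x ∷ᶠ ρ')
      cons-lift x e zero    = ≡.refl
      cons-lift x e (suc k) = e k

      cons-lift2 : ∀ {B : Set} {i i'} {ρ : Fin i → Fin i'} {η : Fin i' → B} {ρ'} x y →
        η ∘ ρ ≗ ρ' → (y ∷ᶠ (x ∷ᶠ η)) ∘ lift2 ρ ≗ (y ∷ᶠ ρ')
      cons-lift2 x y e zero    = ≡.refl
      cons-lift2 x y e (suc k) = e k

    LexMeans : (∀ {i j} → Fin j → Fin j → P i j) → Set ℓ
    LexMeans lexP = ∀ {i j} (Y X : Fin j) (ρ : Fin i → Fin len) σ → Means (lexP Y X) ρ σ (lex len (σ Y) (σ X))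

    -- The renaming carried along by the translation is matched by composing assignments, so that
    -- truth always refers to the original formula. The existential cases then rest on uniqueness of
    -- the first witness, the universal ones on De Morgan.
    pmR-means : ∀ {lexP : ∀ {i j} → Fin j → Fin j → P i j} {i j i' j'} (φ : MSO d i j) → LexMeans lexP ⊎ FO φ →
      ∀ {ρ : Fin i → Fin i'} {σ : Fin j → Fin j'} {η τ ρ' σ'} →
      η ∘ ρ ≗ ρ' → τ ∘ σ ≗ σ' → Means (pmR lexP φ ρ σ) η τ (sat φ ρ' σ')
    pmR-means (atom a) h e e' = trans (⟦atom⟧ (renA _ _ a) _ _) (reflexive (≡.cong [_] (evalA-ren a e e'))) ,
      trans (⟦natom⟧ (renA _ _ a) _ _) (reflexive (≡.cong (λ b → [ not b ]) (evalA-ren a e e')))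
    pmR-means {lexP} (or φ ψ) h {ρ} {σ} e e' = or-means (pmR lexP φ ρ σ) (pmR lexP ψ ρ σ) (sat φ _ _) (sat ψ _ _)
      (pmR-means φ (hφ h) e e') (pmR-means ψ (hψ h) e e')
      where
      hφ : LexMeans lexP ⊎ FO (or φ ψ) → LexMeans lexP ⊎ FO φ
      hφ (inj₁ l)        = inj₁ l
      hφ (inj₂ (or p q)) = inj₂ p
      hψ : LexMeans lexP ⊎ FO (or φ ψ) → LexMeans lexP ⊎ FO ψ
      hψ (inj₁ l)        = inj₁ l
      hψ (inj₂ (or p q)) = inj₂ q
    pmR-means {lexP} (neg φ) h {ρ} {σ} e e' = neg-means (pmR lexP φ ρ σ) (sat φ _ _) (pmR-means φ (hφ h) e e')
      where
      hφ : LexMeans lexP ⊎ FO (neg φ) → LexMeans lexP ⊎ FO φ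
      hφ (inj₁ l)       = inj₁ l
      hφ (inj₂ (neg p)) = inj₂ p
    pmR-means {lexP} (ex1 φ) h {ρ} {σ} {η} {τ} {ρ'} {σ'} e e' =
      (begin
        ∑ len (λ x → ⟦ nw ⟧ (proj₁ (pmR lexP φ (lift ρ) σ)) (x ∷ᶠ η) τ * ∏ len (λ y → guard x y))
          ≈⟨ trans (∑-⨁ len _) (⨁-cong (pos len) (λ x → *-cong (proj₁ (body x))
               (trans (∏-⨂ len _) (⨂-cong (pos len) (guard-means x))))) ⟩
        ⨁ (pos len) (λ x → [ Q x ] * ⨂ (pos len) (λ y → [ leF x y ∨ not (Q y) ]))
          ≈⟨ ⨁-first len Q ⟩
        [ any (pos len) Q ] ∎) ,
      trans (∏-⨂ len _) (trans (⨂-cong (pos len) (λ x → proj₂ (body x)))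
        (trans (⨂-[] (pos len) (not ∘ Q)) (reflexive (≡.cong (λ b → [ not b ])
          (Or.⨁-cong (pos len) (λ x → BP.not-involutive (Q x)))))))
      where
      hφ : LexMeans lexP ⊎ FO (ex1 φ) → LexMeans lexP ⊎ FO φ
      hφ (inj₁ l)       = inj₁ l
      hφ (inj₂ (ex1 p)) = inj₂ p
      Q : Fin len → Bool
      Q x = sat φ (x ∷ᶠ ρ') σ'
      body : ∀ x → Means (pmR lexP φ (lift ρ) σ) (x ∷ᶠ η) τ (Q x)
      body x = pmR-means φ (hφ h) (cons-lift x e) e'
      guard : Fin len → Fin len → C
      guard x y = ⟦ nw ⟧ (proj₂ (andP (ltP zero (suc zero)) (pmR lexP φ (lift2 ρ) σ))) (y ∷ᶠ (x ∷ᶠ η)) τ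
      guard-means : ∀ x y → guard x y ≈ [ leF x y ∨ not (Q y) ]
      guard-means x y = trans
        (proj₁ (or-means (atomP (leqA (suc zero) zero)) (negP (pmR lexP φ (lift2 ρ) σ)) 
          {y ∷ᶠ (x ∷ᶠ η)} {τ} ⌊ x FP.≤? y ⌋ (not (Q y))
          (⟦atom⟧ (leqA (suc zero) zero) (y ∷ᶠ (x ∷ᶠ η)) τ , ⟦natom⟧ (leqA (suc zero) zero) (y ∷ᶠ (x ∷ᶠ η)) τ)
          (neg-means (pmR lexP φ (lift2 ρ) σ) (Q y) (pmR-means φ (hφ h) (cons-lift2 x y e) e'))))
        (reflexive (≡.cong (λ b → [ b ∨ not (Q y) ]) (leF-≤? x y)))
    pmR-means (ex2 φ) (inj₂ ())
    pmR-means {lexP} (ex2 φ) (inj₁ l) {ρ} {σ} {η} {τ} {ρ'} {σ'} e e' =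
      (begin
        _ ≈⟨ trans (∑-sets len _) (⨁-cong (funs bools len) (λ X → *-cong (proj₁ (body X))
               (trans (bigFun-⨂ len _) (⨂-cong (funs bools len) (guard-means X))))) ⟩
        ⨁ (funs bools len) (λ X → [ Q X ] * ⨂ (funs bools len) (λ Y → [ not (lex len Y X) ∨ not (Q Y) ]))
          ≈⟨ ⨁-least len Q ⟩
        [ any (funs bools len) Q ] ∎) ,
      trans (bigFun-⨂ len _) (trans (⨂-cong (funs bools len) (λ X → proj₂ (body X)))
        (trans (⨂-[] (funs bools len) (not ∘ Q)) (reflexive (≡.cong (λ b → [ not b ])
          (Or.⨁-cong (funs bools len) (λ X → BP.not-involutive (Q X)))))))
      where
      Q : (Fin len → Bool) → Bool
      Q X = sat φ ρ' (X ∷ᶠ σ')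
      body : ∀ X → Means (pmR lexP φ ρ (lift σ)) η (X ∷ᶠ τ) (Q X)
      body X = pmR-means φ (inj₁ l) e (cons-lift X e')
      guard-means : ∀ X Y →
        ⟦ nw ⟧ (proj₂ (andP (lexP zero (suc zero)) (pmR lexP φ ρ (lift2 σ)))) η (Y ∷ᶠ (X ∷ᶠ τ))
          ≈ [ not (lex len Y X) ∨ not (Q Y) ]
      guard-means X Y = proj₁ (or-means (negP (lexP zero (suc zero))) (negP (pmR lexP φ ρ (lift2 σ)))
        {η} {Y ∷ᶠ (X ∷ᶠ τ)} (not (lex len Y X)) (not (Q Y))
        (neg-means (lexP zero (suc zero)) (lex len Y X) (l zero (suc zero) η _))
        (neg-means (pmR lexP φ ρ (lift2 σ)) (Q Y) (pmR-means φ (inj₁ l) e (cons-lift2 X Y e'))))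

    sat-lexLt : (Y X : Fin j) (ρ : Fin i → Fin len) (σ : Fin j → Fin len → Bool) →
      sat (lexLt Y X) ρ σ ≡ lex len (σ Y) (σ X)
    sat-lexLt Y X ρ σ = ≡.trans
      (Or.⨁-cong (pos len) (λ y → ≡.trans
        (and-assoc (σ X y) (σ Y y) _)
        (≡.cong (λ b → (σ X y ∧ not (σ Y y)) ∧ not b)
          (Or.⨁-cong (pos len) (λ z → ≡.trans
            (differ ⌊ y FP.≤? z ⌋ (σ Y z) (σ X z))
            (≡.cong (λ b → not b ∧ (σ Y z xor σ X z)) (leF-≤? y z)))))))
      (lex-first len (σ Y) (σ X))
      where
      and-assoc : ∀ a b c → not (not a ∨ not (not (not (not b) ∨ not (not c)))) ≡ (a ∧ not b) ∧ not c
      and-assoc false b     c     = ≡.refl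
      and-assoc true  true  c     = ≡.refl
      and-assoc true  false true  = ≡.refl
      and-assoc true  false false = ≡.refl
      differ : ∀ a b c → not (not (not a) ∨ not (not (not b ∨ c) ∨ not (not c ∨ b))) ≡ not a ∧ (b xor c)
      differ true  b     c     = ≡.refl
      differ false true  true  = ≡.refl
      differ false true  false = ≡.refl
      differ false false true  = ≡.refl
      differ false false false = ≡.refl

    lexPair-means : LexMeans lexPair
    lexPair-means Y X ρ σ = ≡.subst (Means (lexPair Y X) ρ σ) (sat-lexLt Y X ρ σ)
      (pmR-means {lexP = lexPair} (lexLt Y X) (inj₂ (lexLt-FO Y X)) {id} {id} {ρ} {σ} (λ _ → ≡.refl) (λ _ → ≡.refl))

    pm-means : (φ : MSO d i j) → ∀ ρ σ → Means (pm φ) ρ σ (sat φ ρ σ)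
    pm-means φ ρ σ = pmR-means φ (inj₁ lexPair-means) (λ _ → ≡.refl) (λ _ → ≡.refl)

-- Finite algebras for the atomic formulas.

true-or-≡ : ∀ {x y} → (x ≡ true → y ≡ true) → (y ≡ true → x ≡ true) → x ≡ y
true-or-≡ {true}  {y}     f g = ≡.sym (f ≡.refl)
true-or-≡ {false} {true}  f g = g ≡.refl
true-or-≡ {false} {false} f g = ≡.refl

any-eqF : ∀ {n} (p : Fin n) (g : Fin n → Bool) → any (pos n) (λ q → eqF p q ∧ g q) ≡ g p
any-eqF p g = Or.⨁-δ (λ q b → b ∧ g q) p (λ q → ≡.refl)

existsAlg : (A → Bool) → Alg A Bool
existsAlg t = record { e = false ; I = λ a x → t a ∨ x ; N = λ a x b y → t a ∨ (x ∨ (t b ∨ y)) }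

run-exists : (t : A → Bool) → ∀ {n} (s : Sk n) f → run (existsAlg t) s f ≡ any (pos n) (t ∘ f)
run-exists t end f = ≡.refl
run-exists t (int {n} s) f = ≡.trans (≡.cong (t (f zero) ∨_) (run-exists t s (f ∘ suc)))
  (≡.sym (Or.⨁-pos-suc n (t ∘ f)))
run-exists t (nest {m} {k} u v) f = ≡.trans
  (≡.cong₂ (λ x y → t (f zero) ∨ (x ∨ (t (f (ret m k)) ∨ y)))
    (run-exists t u (f ∘ inner k)) (run-exists t v (f ∘ after m)))
  (≡.sym (Or.⨁-pos-nest m k (t ∘ f)))

-- Arbitrary sets of positions instead of two single positions: when a word is cut into factors, the
-- mark of a variable may be missing from a factor.
ordered : ∀ n → (Fin n → Bool) → (Fin n → Bool) → Bool
ordered zero    s t = false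
ordered (suc n) s t = (s zero ∧ (t zero ∨ any (pos n) (t ∘ suc))) ∨ ordered n (s ∘ suc) (t ∘ suc)

ordered-+ : ∀ m n (s t : Fin (m ℕ.+ n) → Bool) → ordered (m ℕ.+ n) s t ≡
  ordered m (s ∘ (_↑ˡ n)) (t ∘ (_↑ˡ n))
    ∨ ((any (pos m) (s ∘ (_↑ˡ n)) ∧ any (pos n) (t ∘ (m ↑ʳ_))) ∨ ordered n (s ∘ (m ↑ʳ_)) (t ∘ (m ↑ʳ_)))
ordered-+ zero    n s t = ≡.refl
ordered-+ (suc m) n s t
  rewrite Or.⨁-pos-suc m (s ∘ (_↑ˡ n)) | Or.⨁-pos-+ m n (t ∘ suc) | ordered-+ m n (s ∘ suc) (t ∘ suc) =
  regroup (s zero) (t zero) _ _ _ _ _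
  where
  regroup : ∀ x y ym yn xm om on → (x ∧ (y ∨ (ym ∨ yn))) ∨ (om ∨ ((xm ∧ yn) ∨ on)) ≡
    ((x ∧ (y ∨ ym)) ∨ om) ∨ (((x ∨ xm) ∧ yn) ∨ on)
  regroup false y     ym    yn    xm    om    on = ≡.refl
  regroup true  true  ym    yn    xm    om    on = ≡.refl
  regroup true  false true  yn    xm    om    on = ≡.refl
  regroup true  false false true  xm    true  on = ≡.refl
  regroup true  false false true  xm    false on = ≡.refl
  regroup true  false false false true  om    on = ≡.refl
  regroup true  false false false false om    on = ≡.refl

ordered-eqF : ∀ {n} (p q : Fin n) → ordered n (eqF p) (eqF q) ≡ leF p q
ordered-eqF {suc n} zero zero = ≡.refl
ordered-eqF {suc n} zero (suc q) = ≡.cong (_∨ ordered n (λ _ → false) (eqF q)) (Or.⨁-δ (λ _ b → b) q (λ _ → ≡.refl))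
ordered-eqF {suc n} (suc p) zero = never n (eqF p)
  where
  never : ∀ n s → ordered n s (λ _ → false) ≡ false
  never zero    s = ≡.refl
  never (suc n) s rewrite Or.⨁-ε (pos n) {λ _ → false} (λ _ → ≡.refl) | BP.∧-zeroʳ (s zero) = never n (s ∘ suc)
ordered-eqF {suc n} (suc p) (suc q) = ordered-eqF p q

module _ (s t : A → Bool) where

  -- (s occurs, t occurs, some position satisfying s is ≤ one satisfying t)
  orderAlg : Alg A (Bool × Bool × Bool)
  orderAlg = record
    { e = false , false , false
    ; I = λ { a (x , y , o) → s a ∨ x , t a ∨ y , (s a ∧ (t a ∨ y)) ∨ o }
    ; N = λ { a (x , y , o) b (x' , y' , o') →
        s a ∨ (x ∨ (s b ∨ x')) , t a ∨ (y ∨ (t b ∨ y')) ,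
        (s a ∧ (t a ∨ (y ∨ (t b ∨ y')))) ∨ (o ∨ ((x ∧ (t b ∨ y')) ∨ ((s b ∧ (t b ∨ y')) ∨ o'))) } }

  run-order : ∀ {n} (sk : Sk n) f → run orderAlg sk f ≡
    (any (pos n) (s ∘ f) , any (pos n) (t ∘ f) , ordered n (s ∘ f) (t ∘ f))
  run-order end f = ≡.refl
  run-order (int {n} sk) f
    rewrite Or.⨁-pos-suc n (s ∘ f) | Or.⨁-pos-suc n (t ∘ f) | run-order sk (f ∘ suc) = ≡.refl
  run-order (nest {m} {k} u v) f
    rewrite Or.⨁-pos-nest m k (s ∘ f) | Or.⨁-pos-nest m k (t ∘ f)
          | ordered-+ m (suc k) (s ∘ f ∘ suc) (t ∘ f ∘ suc) | Or.⨁-pos-+ m (suc k) (t ∘ f ∘ suc)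
          | Or.⨁-pos-suc k (t ∘ f ∘ suc ∘ (m ↑ʳ_))
          | run-order u (f ∘ inner k) | run-order v (f ∘ after m) = ≡.refl

  -- Every edge joins the call and the return of exactly one block, so it suffices to test the two
  -- labels of each block.
  matchAlg : Alg A Bool
  matchAlg = record { e = false ; I = λ _ x → x ; N = λ a x b y → (s a ∧ t b) ∨ (x ∨ y) }

module _ {N} {ν : Fin N → Fin N → Bool} where
  open Parsing ν

  module _
    (call-not-ret : ∀ i p j → ν p j ≡ true → ν i p ≡ true → ⊥)
    (fun : ∀ i j j' → ν i j ≡ true → ν i j' ≡ true → j ≡ j')
    (inj : ∀ i i' j → ν i j ≡ true → ν i' j ≡ true → i ≡ i')
    (s t : A → Bool) (f : Fin N → A) (a b : Fin N) (sf : ∀ p → s (f p) ≡ eqF a p) (tf : ∀ p → t (f p) ≡ eqF b p)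
    where

    match-sound : ∀ {n} (sk : Sk n) e → Describes sk e → run (matchAlg s t) sk (f ∘ e) ≡ true → ν a b ≡ true
    match-sound (int sk) e (_ , h) r = match-sound sk (e ∘ suc) h r
    match-sound (nest {m} {k} u v) e (c , hu , hv , _) r
      rewrite sf (e zero) | tf (e (ret m k))
      with eqF a (e zero) in ea | eqF b (e (ret m k)) in eb | run (matchAlg s t) u (f ∘ e ∘ inner k) in ru
    ... | true  | true  | _     rewrite eqF-sound a _ ea | eqF-sound b _ eb = c
    ... | false | _     | true  = match-sound u (e ∘ inner k) hu ru
    ... | false | _     | false = match-sound v (e ∘ after m) hv r
    ... | true  | false | true  = match-sound u (e ∘ inner k) hu ru
    ... | true  | false | false = match-sound v (e ∘ after m) hv r

    -- An edge inside a block is either the edge of its call and return or lies within one of the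
    -- two factors; all other combinations contradict `Describes`, or that a position cannot be both
    -- call and return.
    match-complete : ∀ {n} (sk : Sk n) e → Describes sk e → ∀ p q → a ≡ e p → b ≡ e q → ν a b ≡ true →
      run (matchAlg s t) sk (f ∘ e) ≡ true
    match-complete (int sk) e (i , h) zero    q       ≡.refl _ x with ≡.trans (≡.sym x) (IsInternal.not-call i b)
    ... | ()
    match-complete (int sk) e (i , h) (suc p) zero    _ ≡.refl x with ≡.trans (≡.sym x) (IsInternal.not-ret i a)
    ... | ()
    match-complete (int sk) e (i , h) (suc p) (suc q) ea eb    x = match-complete sk (e ∘ suc) h p q ea eb x
    match-complete (nest {m} {k} u v) e (c , hu , hv , uv , vu) p q ea eb x = cases (block m k p) (block m k q) ea eb
      where
      found : a ≡ e zero → b ≡ e (ret m k) → run (matchAlg s t) (nest u v) (f ∘ e) ≡ true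
      found ea eb rewrite sf (e zero) | tf (e (ret m k)) | ≡.sym ea | ≡.sym eb | eqF-refl a | eqF-refl b = ≡.refl
      from-call : a ≡ e zero → run (matchAlg s t) (nest u v) (f ∘ e) ≡ true
      from-call ea = found ea (fun (e zero) _ _ (≡.subst (λ y → ν y b ≡ true) ea x) c)
      to-ret : b ≡ e (ret m k) → run (matchAlg s t) (nest u v) (f ∘ e) ≡ true
      to-ret eb = found (inj _ _ (e (ret m k)) (≡.subst (λ y → ν a y ≡ true) eb x) c) eb
      absurd : ∀ {p q} → ν (e p) (e q) ≡ false → a ≡ e p → b ≡ e q → run (matchAlg s t) (nest u v) (f ∘ e) ≡ true
      absurd h ea eb with ≡.trans (≡.sym x) (≡.trans (≡.cong₂ ν ea eb) h)
      ... | ()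
      test : Bool
      test = s (f (e zero)) ∧ t (f (e (ret m k)))
      cases : ∀ {p q} → Block m k p → Block m k q → a ≡ e p → b ≡ e q → run (matchAlg s t) (nest u v) (f ∘ e) ≡ true
      cases is-call      _            ea eb = from-call ea
      cases _            is-ret       ea eb = to-ret eb
      cases _            is-call      ea eb = ⊥-elim (call-not-ret _ _ _ c (≡.subst (λ y → ν a y ≡ true) eb x))
      cases is-ret       _            ea eb = ⊥-elim (call-not-ret _ _ _ (≡.subst (λ y → ν y b ≡ true) ea x) c)
      cases (is-inner p) (is-after q) ea eb = absurd (uv p q) ea eb
      cases (is-after p) (is-inner q) ea eb = absurd (vu p q) ea eb
      cases (is-inner p) (is-inner q) ea eb
        rewrite match-complete u (e ∘ inner k) hu p q ea eb x = BP.∨-zeroʳ test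
      cases (is-after p) (is-after q) ea eb
        rewrite match-complete v (e ∘ after m) hv p q ea eb x =
        ≡.trans (≡.cong (test ∨_) (BP.∨-zeroʳ _)) (BP.∨-zeroʳ test)

-- Assignments as labellings.

Letter : ℕ → ℕ → ℕ → Set
Letter d i j = Fin d × Vec Bool i × Vec Bool j

module Labelling {d : ℕ} where

  -- Variables are encoded in the labels: position p carries the bits [ρ x = p] and [p ∈ σ X].
  label : ∀ {i j} (nw : NestedWord d) → (Fin i → Fin (NestedWord.len nw)) →
    (Fin j → Fin (NestedWord.len nw) → Bool) → Fin (NestedWord.len nw) → Letter d i j
  label nw ρ σ p = NestedWord.lab nw p , Vec.tabulate (λ x → eqF (ρ x) p) , Vec.tabulate (λ X → σ X p)

  extend1 : ∀ {i j} → Letter d i j → Bool → Letter d (suc i) j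
  extend1 (a , v , w) b = a , b ∷ v , w

  extend2 : ∀ {i j} → Letter d i j → Bool → Letter d i (suc j)
  extend2 (a , v , w) b = a , v , b ∷ w

  Semantics : ∀ {c} → Set c → ℕ → ℕ → Set c
  Semantics C i j = (nw : NestedWord d) → (Fin i → Fin (NestedWord.len nw)) →
    (Fin j → Fin (NestedWord.len nw) → Bool) → C

  module StepSemantics {c ℓ} (V : Setoid c ℓ) where
    open Setoid V renaming (Carrier to C)
    open StepFunctions V

    -- The series is defined on all labellings, also those in which the bits of a first-order
    -- variable do not mark exactly one position. Agreement is asked only of labellings that come
    -- from an assignment, and the quantifier constructions produce no others.
    record StepValued {i j} (val : Semantics C i j) : Set (Level.suc 0ℓ ⊔ c ⊔ ℓ) where
      field
        {series} : ∀ {n} → Sk n → (Fin n → Letter d i j) → C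
        step     : Step {Letter d i j} series
        agrees   : ∀ nw s → Shape nw s → ∀ ρ σ → val nw ρ σ ≈ series s (label nw ρ σ)

    stepValued-≈ : ∀ {i j} {val val' : Semantics C i j} → (∀ nw ρ σ → val nw ρ σ ≈ val' nw ρ σ) →
                   StepValued val' → StepValued val
    stepValued-≈ e S = record
      { step = StepValued.step S ; agrees = λ nw s h ρ σ → trans (e nw ρ σ) (StepValued.agrees S nw s h ρ σ) }

    stepValued-const : ∀ {i j} x → StepValued {i} {j} (λ _ _ _ → x)
    stepValued-const x = record { step = step-const x ; agrees = λ _ _ _ _ _ → refl }

  module _ {a b a′ b′} (U : Setoid a b) (V : Setoid a′ b′) where
    private
      module U = Setoid U
      module V = Setoid V
      module SU = StepSemantics U
      module SV = StepSemantics V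

    stepValued-map : ∀ (op : U.Carrier → V.Carrier) → (∀ {x x'} → x U.≈ x' → op x V.≈ op x') →
      ∀ {i j} {val : Semantics U.Carrier i j} → SU.StepValued val → SV.StepValued (λ nw ρ σ → op (val nw ρ σ))
    stepValued-map op op-cong S = record
      { step = step-map U V op op-cong (SU.StepValued.step S)
      ; agrees = λ nw s h ρ σ → op-cong (SU.StepValued.agrees S nw s h ρ σ) }

    stepValued-map₂ : ∀ (op : U.Carrier → U.Carrier → V.Carrier) →
      (∀ {x x' y y'} → x U.≈ x' → y U.≈ y' → op x y V.≈ op x' y') →
      ∀ {i j} {val val' : Semantics U.Carrier i j} → SU.StepValued val → SU.StepValued val' →
      SV.StepValued (λ nw ρ σ → op (val nw ρ σ) (val' nw ρ σ))
    stepValued-map₂ op op-cong S T = record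
      { step = step-map₂ U U V op op-cong (SU.StepValued.step S) (SU.StepValued.step T)
      ; agrees = λ nw s h ρ σ → op-cong (SU.StepValued.agrees S nw s h ρ σ) (SU.StepValued.agrees T nw s h ρ σ) }

  module _ {c ℓ} (M : CommutativeMonoid c ℓ) (periodic : MonoidStep.Periodic M) where
    open CommutativeMonoid M renaming (Carrier to C)
    open MonoidSum M
    open MonoidStep M
    open StepSemantics setoid

    stepValued-⨁1 : ∀ {i j} {val : Semantics C (suc i) j} → StepValued val →
      StepValued {i} {j} (λ nw ρ σ → ⨁ (pos (NestedWord.len nw)) (λ p → val nw (p ∷ᶠ ρ) σ))
    stepValued-⨁1 S = record
      { step = mark-step periodic extend1 (StepValued.step S)
      -- The newest variable is the head of the bit vector, so marking `p` gives definitionally the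
      -- labelling of `p ∷ᶠ ρ`.
      ; agrees = λ nw s h ρ σ → ⨁-cong (pos (NestedWord.len nw)) (λ p → StepValued.agrees S nw s h (p ∷ᶠ ρ) σ) }

    stepValued-⨁2 : ∀ {i j} {val : Semantics C i (suc j)} → StepValued val →
      StepValued {i} {j} (λ nw ρ σ → ⨁ (funs bools (NestedWord.len nw)) (λ X → val nw ρ (X ∷ᶠ σ)))
    stepValued-⨁2 S = record
      { step = relabel-step periodic extend2 bools (StepValued.step S)
      ; agrees = λ nw s h ρ σ → ⨁-cong (funs bools (NestedWord.len nw))
          (λ X → StepValued.agrees S nw s h ρ (X ∷ᶠ σ)) }

∨-periodic : MonoidStep.Periodic BP.∨-commutativeMonoid
-- Idempotence: two copies equal one copy.
∨-periodic xs = 1 , suc zero , λ k → idem (xs k)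
  where
  idem : ∀ x → x ∨ (x ∨ false) ≡ x ∨ false
  idem true  = ≡.refl
  idem false = ≡.refl

-- From formulas to recognisable series.

module FormulaSemantics {c ℓ} (K : CommutativeSemiring c ℓ) (d : ℕ) where
  open CommutativeSemiring K renaming (Carrier to C) hiding (zero)
  open SemiringSum K
  open BigOperators d
  open Weighted K d
  open Unambiguous K d
  open Labelling {d}
  open Linear K
  open Relation.Binary.Reasoning.Setoid setoid

  private
    Boolˢ : Setoid 0ℓ 0ℓ
    Boolˢ = ≡.setoid Bool
    module B = StepSemantics Boolˢ
    module BStep = StepFunctions Boolˢ
  open StepSemantics setoid
  open StepFunctions setoid

  at : ∀ {i j} → Fin i → Letter d i j → Bool
  at x (a , v , w) = Vec.lookup v x

  within : ∀ {i j} → Fin j → Letter d i j → Bool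
  within X (a , v , w) = Vec.lookup w X

  at-label : ∀ {i j} nw (ρ : Fin i → _) (σ : Fin j → _) x p → at x (label nw ρ σ p) ≡ eqF (ρ x) p
  at-label nw ρ σ x p = VP.lookup∘tabulate _ x

  -- Covers the atoms that can be decided from the label at the position of `x` alone: an
  -- existential search finds exactly that position.
  pointwise : ∀ {i j} (t : Letter d i j → Bool) (x : Fin i) (val : Semantics Bool i j)
    (g : ∀ nw (ρ : Fin i → _) (σ : Fin j → _) → Fin (NestedWord.len nw) → Bool) →
    (∀ nw ρ σ p → t (label nw ρ σ p) ≡ eqF (ρ x) p ∧ g nw ρ σ p) →
    (∀ nw ρ σ → val nw ρ σ ≡ g nw ρ σ (ρ x)) → B.StepValued val
  pointwise t x val g et eg = record
    { step = BStep.finite-step Bool-finite (existsAlg t) id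
    ; agrees = λ nw s h ρ σ → ≡.trans (eg nw ρ σ) (≡.sym (≡.trans (run-exists t s (label nw ρ σ))
        (≡.trans (Or.⨁-cong (pos (NestedWord.len nw)) (et nw ρ σ)) (any-eqF (ρ x) (g nw ρ σ))))) }

  atom-step : ∀ {i j} (a : Atom d i j) → B.StepValued (λ nw ρ σ → evalA nw a ρ σ)
  atom-step (eqA x y) = pointwise (λ l → at x l ∧ at y l) x _ (λ nw ρ σ p → eqF (ρ y) p)
    (λ nw ρ σ p → ≡.cong₂ _∧_ (at-label nw ρ σ x p) (at-label nw ρ σ y p))
    (λ nw ρ σ → ≡.trans (eqF-≟ (ρ x) (ρ y)) (eqF-sym (ρ x) (ρ y)))
  atom-step (labA a x) = pointwise (λ l → at x l ∧ ⌊ proj₁ l FP.≟ a ⌋) x _ (λ nw ρ σ p → ⌊ NestedWord.lab nw p FP.≟ a ⌋)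
    (λ nw ρ σ p → ≡.cong (_∧ _) (at-label nw ρ σ x p))
    (λ nw ρ σ → ≡.refl)
  atom-step (memA x X) = pointwise (λ l → at x l ∧ within X l) x _ (λ nw ρ σ p → σ X p)
    (λ nw ρ σ p → ≡.cong₂ _∧_ (at-label nw ρ σ x p) (VP.lookup∘tabulate _ X))
    (λ nw ρ σ → ≡.refl)
  atom-step (leqA x y) = record
    { step = BStep.finite-step (×-finite Bool-finite (×-finite Bool-finite Bool-finite))
               (orderAlg (at x) (at y)) (λ (_ , _ , o) → o)
    ; agrees = λ nw s h ρ σ → ≡.trans (leF-≤? (ρ x) (ρ y)) (≡.sym (≡.trans
        (≡.cong (λ z → proj₂ (proj₂ z)) (run-order (at x) (at y) s (label nw ρ σ)))
        (≡.trans (ordered-cong _ (at-label nw ρ σ x) (at-label nw ρ σ y)) (ordered-eqF (ρ x) (ρ y))))) }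
    where
    ordered-cong : ∀ n {s s' t t' : Fin n → Bool} → s ≗ s' → t ≗ t' → ordered n s t ≡ ordered n s' t'
    ordered-cong zero    es et = ≡.refl
    ordered-cong (suc n) es et
      rewrite es zero | et zero | ordered-cong n (es ∘ suc) (et ∘ suc) | Or.⨁-cong (pos n) (et ∘ suc) = ≡.refl
  atom-step (nuA x y) = record
    { step = BStep.finite-step Bool-finite (matchAlg (at x) (at y)) id
    ; agrees = λ nw s h ρ σ → true-or-≡
        (match-complete (call-not-return nw) (NestedWord.nest-fun nw) (NestedWord.nest-inj nw) (at x) (at y)
          (label nw ρ σ) (ρ x) (ρ y) (at-label nw ρ σ x) (at-label nw ρ σ y) s id h (ρ x) (ρ y) ≡.refl ≡.refl)
        (match-sound (call-not-return nw) (NestedWord.nest-fun nw) (NestedWord.nest-inj nw) (at x) (at y)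
          (label nw ρ σ) (ρ x) (ρ y) (at-label nw ρ σ x) (at-label nw ρ σ y) s id h) }

  sat-step : ∀ {i j} (φ : MSO d i j) → B.StepValued (λ nw → sat nw φ)
  sat-step (atom a) = atom-step a
  sat-step (or φ ψ) = stepValued-map₂ Boolˢ Boolˢ _∨_ (≡.cong₂ _∨_) (sat-step φ) (sat-step ψ)
  sat-step (neg φ)  = stepValued-map Boolˢ Boolˢ not (≡.cong not) (sat-step φ)
  sat-step (ex1 φ)  = stepValued-⨁1 BP.∨-commutativeMonoid ∨-periodic (sat-step φ)
  sat-step (ex2 φ)  = stepValued-⨁2 BP.∨-commutativeMonoid ∨-periodic (sat-step φ)

  indicator-step : ∀ {i j} {val : Semantics Bool i j} → B.StepValued val → StepValued (λ nw ρ σ → [ val nw ρ σ ])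
  indicator-step = stepValued-map Boolˢ setoid [_] (λ e → reflexive (≡.cong [_] e))

  Indicator : ∀ {i j} → WMSO C d i j → MSO d i j → Set ℓ
  Indicator φ χ = ∀ nw ρ σ → ⟦ nw ⟧ φ ρ σ ≈ [ sat nw χ ρ σ ]

  synUnamb-indicator : ∀ {i j} {φ : WMSO C d i j} → SynUnamb φ → ∃ (Indicator φ)
  synUnamb-indicator (χ , inj₁ ≡.refl) = χ , λ nw ρ σ → proj₁ (pm-means nw χ ρ σ)
  synUnamb-indicator (χ , inj₂ ≡.refl) = neg χ , λ nw ρ σ → proj₂ (pm-means nw χ ρ σ)

  record IsStep {i j} (φ : WMSO C d i j) : Set (Level.suc 0ℓ ⊔ c ⊔ ℓ) where
    constructor isStep
    field stepValued : StepValued (λ nw → ⟦ nw ⟧ φ)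

  indicator-isStep : ∀ {i j} {φ : WMSO C d i j} χ → Indicator φ χ → IsStep φ
  indicator-isStep χ e = isStep (stepValued-≈ e (indicator-step (sat-step χ)))

  or-step : ∀ {i j} {φ ψ : WMSO C d i j} → IsStep φ → IsStep ψ → IsStep (or φ ψ)
  or-step (isStep S) (isStep T) = isStep (stepValued-map₂ setoid setoid _+_ +-cong S T)

  and-step : ∀ {i j} {φ ψ : WMSO C d i j} → IsStep φ → IsStep ψ → IsStep (and φ ψ)
  and-step (isStep S) (isStep T) = isStep (stepValued-map₂ setoid setoid _*_ *-cong S T)

  su-step : ∀ {i j} {φ : WMSO C d i j} → SynUnamb φ → IsStep φ
  su-step u = indicator-isStep (proj₁ (synUnamb-indicator u)) (proj₂ (synUnamb-indicator u))

  aUMSO-step : ∀ {i j} {φ : WMSO C d i j} → aUMSO φ → IsStep φ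
  aUMSO-step (const k) = isStep (stepValued-const k)
  aUMSO-step (su u)    = su-step u
  aUMSO-step (and p q) = and-step (aUMSO-step p) (aUMSO-step q)
  aUMSO-step (or p q)  = or-step (aUMSO-step p) (aUMSO-step q)

  module _ (periodic : MonoidStep.Periodic +-commutativeMonoid) where

    ex1-step : ∀ {i j} {φ : WMSO C d (suc i) j} → IsStep φ → IsStep (ex1 φ)
    ex1-step (isStep S) = isStep (stepValued-≈ (λ nw ρ σ → ∑-⨁ (NestedWord.len nw) _)
      (stepValued-⨁1 +-commutativeMonoid periodic S))

    ex2-step : ∀ {i j} {φ : WMSO C d i (suc j)} → IsStep φ → IsStep (ex2 φ)
    ex2-step (isStep S) = isStep (stepValued-≈ (λ nw ρ σ → ∑-sets (NestedWord.len nw) _)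
      (stepValued-⨁2 +-commutativeMonoid periodic S))

    wUMSO-step : ∀ {i j} {φ : WMSO C d i j} → wUMSO φ → IsStep φ
    wUMSO-step (const k) = isStep (stepValued-const k)
    wUMSO-step (su u)    = su-step u
    wUMSO-step (and p q) = and-step (wUMSO-step p) (wUMSO-step q)
    wUMSO-step (or p q)  = or-step (wUMSO-step p) (wUMSO-step q)
    wUMSO-step (ex1 p)   = ex1-step (wUMSO-step p)
    wUMSO-step (ex2 p)   = ex2-step (wUMSO-step p)

    anyMSO-step : MonoidStep.Periodic *-commutativeMonoid → ∀ {i j} (φ : WMSO C d i j) → IsStep φ
    anyMSO-step p* (const k) = isStep (stepValued-const k)
    anyMSO-step p* (atom a)  = indicator-isStep (atom a) (λ nw → ⟦atom⟧ nw a)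
    anyMSO-step p* (natom a) = indicator-isStep (neg (atom a)) (λ nw → ⟦natom⟧ nw a)
    anyMSO-step p* (or φ ψ)  = or-step (anyMSO-step p* φ) (anyMSO-step p* ψ)
    anyMSO-step p* (and φ ψ) = and-step (anyMSO-step p* φ) (anyMSO-step p* ψ)
    anyMSO-step p* (ex1 φ)   = ex1-step (anyMSO-step p* φ)
    anyMSO-step p* (ex2 φ)   = ex2-step (anyMSO-step p* φ)
    anyMSO-step p* (all1 φ)  = isStep (stepValued-≈ (λ nw ρ σ → ∏-⨂ (NestedWord.len nw) _)
      (stepValued-⨁1 *-commutativeMonoid p* (IsStep.stepValued (anyMSO-step p* φ))))
    anyMSO-step p* (all2 φ)  = isStep (stepValued-≈ (λ nw ρ σ → bigFun-⨂ (NestedWord.len nw) _)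
      (stepValued-⨁2 *-commutativeMonoid p* (IsStep.stepValued (anyMSO-step p* φ))))

  record Regularᶠ {i j} (φ : WMSO C d i j) : Set (Level.suc 0ℓ ⊔ c ⊔ ℓ) where
    field
      {series}     : ∀ {n} → Sk n → (Fin n → Letter d i j) → C
      recognisable : Recognisable {Letter d i j} series
      agrees       : ∀ nw s → Shape nw s → ∀ ρ σ → ⟦ nw ⟧ φ ρ σ ≈ series s (label nw ρ σ)

  step-regular : ∀ {i j} {φ : WMSO C d i j} → IsStep φ → Regularᶠ φ
  step-regular (isStep S) = record
    { recognisable = state-recognisable alg out
    ; agrees = λ nw s h ρ σ → trans (StepValued.agrees S nw s h ρ σ) (law s _) }
    where open Step (StepValued.step S)

  -- The body of `all1` has to be a step function because `product-recognisable` works on the states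
  -- of an algebra. The body of `all2` is an indicator, so the product is the indicator of a
  -- classical formula. The remaining connectives are covered by closure of recognisable series.
  restricted-regular : {U : ∀ {i j} → WMSO C d i j → Set c} →
    (∀ {i j} {φ : WMSO C d i j} → U φ → IsStep φ) →
    ∀ {i j} {φ : WMSO C d i j} → Restricted U φ → Regularᶠ φ
  restricted-regular U-step (const k) = step-regular (isStep (stepValued-const k))
  restricted-regular U-step (atom a)  = step-regular (indicator-isStep (atom a) (λ nw → ⟦atom⟧ nw a))
  restricted-regular U-step (natom a) = step-regular (indicator-isStep (neg (atom a)) (λ nw → ⟦natom⟧ nw a))
  restricted-regular U-step (or p q)  = record
    { recognisable = add-recognisable (Regularᶠ.recognisable rp) (Regularᶠ.recognisable rq)
    ; agrees = λ nw s h ρ σ → +-cong (Regularᶠ.agrees rp nw s h ρ σ) (Regularᶠ.agrees rq nw s h ρ σ) }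
    where
    rp = restricted-regular U-step p
    rq = restricted-regular U-step q
  restricted-regular U-step (and p q) = record
    { recognisable = mul-recognisable (Regularᶠ.recognisable rp) (Regularᶠ.recognisable rq)
    ; agrees = λ nw s h ρ σ → *-cong (Regularᶠ.agrees rp nw s h ρ σ) (Regularᶠ.agrees rq nw s h ρ σ) }
    where
    rp = restricted-regular U-step p
    rq = restricted-regular U-step q
  restricted-regular U-step (ex1 p) = record
    { recognisable = mark-recognisable extend1 (Regularᶠ.recognisable rp)
    ; agrees = λ nw s h ρ σ → trans (∑-⨁ (NestedWord.len nw) _)
        (⨁-cong (pos (NestedWord.len nw)) (λ p → Regularᶠ.agrees rp nw s h (p ∷ᶠ ρ) σ)) }
    where rp = restricted-regular U-step p
  restricted-regular U-step (ex2 p) = record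
    { recognisable = relabel-recognisable extend2 bools (Regularᶠ.recognisable rp)
    ; agrees = λ nw s h ρ σ → trans (∑-sets (NestedWord.len nw) _)
        (⨁-cong (funs bools (NestedWord.len nw)) (λ X → Regularᶠ.agrees rp nw s h ρ (X ∷ᶠ σ))) }
    where rp = restricted-regular U-step p
  restricted-regular U-step (all1 u _) = record
    { recognisable = product-recognisable extend1 alg out
    ; agrees = λ nw s h ρ σ → trans (∏-⨂ (NestedWord.len nw) _) (⨂-cong (pos (NestedWord.len nw)) (λ p →
        trans (StepValued.agrees S nw s h (p ∷ᶠ ρ) σ) (law s _))) }
    where
    S = IsStep.stepValued (U-step u)
    open Step (StepValued.step S)
  restricted-regular U-step (all2 u _) = step-regular (indicator-isStep (neg (ex2 (neg χ))) (λ nw ρ σ →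
      trans (bigFun-⨂ (NestedWord.len nw) _) (trans 
        (⨂-cong (funs bools (NestedWord.len nw)) (λ X → e nw ρ (X ∷ᶠ σ)))
        (⨂-[] (funs bools (NestedWord.len nw)) (λ X → sat nw χ ρ (X ∷ᶠ σ))))))
    where
    χ = proj₁ (synUnamb-indicator u)
    e = proj₂ (synUnamb-indicator u)

-- Periodicity from local finiteness.  Equality in K is not decidable; repetitions are found by applying the
-- pigeonhole principle to the indices of representatives in the given finite list.
module _ {c ℓ} (M : CommutativeMonoid c ℓ) where
  open CommutativeMonoid M renaming (Carrier to C)
  open Mult monoid using () renaming (_×_ to _·_)

  finite-multiples-periodic : (∀ x → Σ (List C) λ L → ∀ n → Any ((n · x) ≈_) L) → MonoidStep.Periodic M
  finite-multiples-periodic covered {N} xs = found (FP.pigeonhole {size} {suc size} ℕP.≤-refl (λ k → codes (toℕ k)))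
    where
    L : Fin N → List C
    L k = proj₁ (covered (xs k))
    code : ∀ k n → Fin (length (L k))
    code k n = Any.index (proj₂ (covered (xs k)) n)
    code-≈ : ∀ k n → n · xs k ≈ lookup (L k) (code k n)
    code-≈ k n = AnyP.lookup-index (proj₂ (covered (xs k)) n)
    -- The indices for all `k` are packed into one number, so that a single application of the
    -- pigeonhole principle yields a repetition common to all elements.
    Codes : ∀ N → (Fin N → ℕ) → ℕ
    Codes zero    l = 1
    Codes (suc N) l = l zero ℕ.* Codes N (l ∘ suc)
    join : ∀ N {l : Fin N → ℕ} → (∀ k → Fin (l k)) → Fin (Codes N l)
    join zero    g = zero
    join (suc N) g = F.combine (g zero) (join N (λ k → g (suc k)))
    join-injective : ∀ N {l : Fin N → ℕ} (g h : ∀ k → Fin (l k)) → join N g ≡ join N h → ∀ k → g k ≡ h k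
    join-injective (suc N) g h e zero    = proj₁ (FP.combine-injective (g zero) (join N (λ k → g (suc k))) (h zero) _ e)
    join-injective (suc N) g h e (suc k) =
      join-injective N _ _ (proj₂ (FP.combine-injective (g zero) (join N (λ k → g (suc k))) (h zero) _ e)) k
    size : ℕ
    size = Codes N (λ k → length (L k))
    codes : ℕ → Fin size
    codes n = join N (λ k → code k n)
    found : (∃ λ i → ∃ λ j → i F.< j × codes (toℕ i) ≡ codes (toℕ j)) →
      Σ ℕ λ J → Σ (Fin (suc J)) λ i → ∀ k → MonoidStep.HasPeriod M i (xs k)
    -- The later of the two equal multiples is the `suc J` of `HasPeriod`, hence `J` is its
    -- predecessor.
    found (i , suc j , ℕ.s≤s i≤j , e) = toℕ j , F.fromℕ< (ℕ.s≤s i≤j) , λ k →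
      trans (code-≈ k (suc (toℕ j))) (trans
        (reflexive (≡.cong (lookup (L k)) (≡.sym (join-injective N _ _ e k))))
        (trans (sym (code-≈ k (toℕ i))) (reflexive (≡.cong (_· xs k) (≡.sym (FP.toℕ-fromℕ< (ℕ.s≤s i≤j)))))))

module LocalFiniteness {c ℓ} (K : CommutativeSemiring c ℓ) (d : ℕ) where
  open CommutativeSemiring K renaming (Carrier to C) hiding (zero)
  open Weighted K d
  open Mult +-monoid using () renaming (_×_ to _·_)
  open Mult *-monoid using () renaming (_×_ to _^_)

  private
    replicate-∈ : ∀ n (x : C) → All (_∈ x ∷ []) (replicate n x)
    replicate-∈ zero    x = All.[]
    replicate-∈ (suc n) x = here ≡.refl All.∷ replicate-∈ n x

    replicate-all : ∀ {a p} {A : Set a} {P : A → Set p} n {x} → P x → All P (replicate n x)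
    replicate-all zero    h = All.[]
    replicate-all (suc n) h = h All.∷ replicate-all n h

    multiple : ∀ n x → n · x ≈ sumL (replicate n x)
    multiple zero    x = refl
    multiple (suc n) x = +-congˡ (multiple n x)

    power : ∀ n x → n ^ x ≈ prodL (replicate n x)
    power zero    x = refl
    power (suc n) x = *-congˡ (power n x)

    multiple′ : ∀ n x → n · x ≈ sumL (map prodL (replicate n (x ∷ [])))
    multiple′ zero    x = refl
    multiple′ (suc n) x = +-cong (sym (*-identityʳ x)) (multiple′ n x)

  +-periodic : AddLocallyFinite → MonoidStep.Periodic +-commutativeMonoid
  +-periodic fin = finite-multiples-periodic +-commutativeMonoid (λ x →
    proj₁ (fin (x ∷ [])) , λ n → proj₂ (fin (x ∷ [])) _ (replicate n x , replicate-∈ n x , multiple n x))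

  +-periodic′ : LocallyFinite → MonoidStep.Periodic +-commutativeMonoid
  +-periodic′ fin = finite-multiples-periodic +-commutativeMonoid (λ x →
    proj₁ (fin (x ∷ [])) , λ n → proj₂ (fin (x ∷ [])) _
      (replicate n (x ∷ []) , replicate-all n (here ≡.refl All.∷ All.[]) , multiple′ n x))

  *-periodic : LocallyFinite → MonoidStep.Periodic *-commutativeMonoid
  *-periodic fin = finite-multiples-periodic *-commutativeMonoid (λ x →
    proj₁ (fin (x ∷ [])) , λ n → proj₂ (fin (x ∷ [])) _
      (replicate n x ∷ [] , replicate-∈ n x All.∷ All.[] , trans (power n x) (sym (+-identityʳ _))))

-- Runs of an automaton along the block structure.

inject₁-↑ˡ : ∀ {m} (p : Fin m) n → F.inject₁ (p ↑ˡ n) ≡ F.inject₁ p ↑ˡ n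
inject₁-↑ˡ zero    n = ≡.refl
inject₁-↑ˡ (suc p) n = ≡.cong suc (inject₁-↑ˡ p n)

inject₁-↑ʳ-suc : ∀ m {n} (p : Fin n) → F.inject₁ (m ↑ʳ suc p) ≡ suc (m ↑ʳ F.inject₁ p)
inject₁-↑ʳ-suc zero    p = ≡.refl
inject₁-↑ʳ-suc (suc m) p = ≡.cong suc (inject₁-↑ʳ-suc m p)

inject₁-↑ʳ-zero : ∀ m k → F.inject₁ (m ↑ʳ zero {k}) ≡ F.fromℕ m ↑ˡ suc k
inject₁-↑ʳ-zero zero    k = ≡.refl
inject₁-↑ʳ-zero (suc m) k = ≡.cong suc (inject₁-↑ʳ-zero m k)

fromℕ-+ : ∀ m k → F.fromℕ (m ℕ.+ suc k) ≡ suc (m ↑ʳ F.fromℕ k)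
fromℕ-+ zero    k = ≡.refl
fromℕ-+ (suc m) k = ≡.cong suc (fromℕ-+ m k)

module Runs {c ℓ} (K : CommutativeSemiring c ℓ) (d : ℕ) (A : Weighted.WNWA K d) where
  open CommutativeSemiring K renaming (Carrier to C) hiding (zero)
  open SemiringSum K
  open BigOperators d
  open Weighted K d using (posWeight; runWeight; behaviour)
  open Weighted.WNWA A
  open Relation.Binary.Reasoning.Setoid setoid
  open SemiringSolver K using (solve; _:=_; _:*_)

  Q : Set
  Q = Fin nQ

  -- States sit between positions: the run on the enclosed factor starts right after the call, the
  -- run on the following factor right after the return, and each has one state more than its factor
  -- has positions.
  innerRun : ∀ {m} k → (Fin (suc (suc (m ℕ.+ suc k))) → Q) → Fin (suc m) → Q
  innerRun k r p = r (suc (p ↑ˡ suc k))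

  afterRun : ∀ m {k} → (Fin (suc (suc (m ℕ.+ suc k))) → Q) → Fin (suc k) → Q
  afterRun m r p = r (suc (suc m ↑ʳ p))

  weight : ∀ {n} → Sk n → (Fin n → Fin d) → (Fin (suc n) → Q) → C
  weight end     f r = 1#
  weight (int s) f r = δint (r zero) (f zero) (r (suc zero)) * weight s (f ∘ suc) (r ∘ suc)
  weight (nest {m} {k} u v) f r =
    δcall (r zero) (f zero) (r (suc zero)) * (weight u (f ∘ inner k) (innerRun k r) *
      (δret (innerRun k r (F.fromℕ m)) (r zero) (f (ret m k)) (afterRun m r zero) *
       weight v (f ∘ after m) (afterRun m r)))

  weight-ext : ∀ {n} (s : Sk n) f {r r'} → r ≗ r' → weight s f r ≡ weight s f r'
  weight-ext end     f e = ≡.refl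
  weight-ext (int s) f e rewrite e zero | e (suc zero) = ≡.cong (_ *_) (weight-ext s _ (e ∘ suc))
  weight-ext (nest {m} {k} u v) f {r} {r'} e
    rewrite e zero | e (suc zero) | e (suc (F.fromℕ m ↑ˡ suc k)) | e (suc (suc m ↑ʳ zero))
          | weight-ext u (f ∘ inner k) {innerRun k r} {innerRun k r'} (λ p → e _)
          | weight-ext v (f ∘ after m) {afterRun m r} {afterRun m r'} (λ p → e _) = ≡.refl

  module _ (nw : NestedWord d) where
    open NestedWord nw renaming (nest to ν)
    open Parsing ν

    posWeight-int : ∀ r p → IsInternal p →
      posWeight A nw r p ≡ δint (r (F.inject₁ p)) (lab p) (r (suc p))
    posWeight-int r p h with FP.any? (λ i → ν i p BP.≟ true)
    ... | yes (i , x) = ⊥-elim (BP.not-¬ (IsInternal.not-ret h i) x)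
    ... | no _ with FP.any? (λ j → ν p j BP.≟ true)
    ...   | yes (j , x) = ⊥-elim (BP.not-¬ (IsInternal.not-call h j) x)
    ...   | no _ = ≡.refl

    posWeight-call : ∀ r p q → ν p q ≡ true →
      posWeight A nw r p ≡ δcall (r (F.inject₁ p)) (lab p) (r (suc p))
    posWeight-call r p q c with FP.any? (λ i → ν i p BP.≟ true)
    ... | yes (i , x) = ⊥-elim (call-not-return nw i p q c x)
    ... | no _ with FP.any? (λ j → ν p j BP.≟ true)
    ...   | yes _ = ≡.refl
    ...   | no ¬c = ⊥-elim (¬c (q , c))

    posWeight-ret : ∀ r p q → ν p q ≡ true →
      posWeight A nw r q ≡ δret (r (F.inject₁ q)) (r (F.inject₁ p)) (lab q) (r (suc q))
    posWeight-ret r p q c with FP.any? (λ i → ν i q BP.≟ true)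
    ... | yes (i , x) rewrite nest-inj i p q x c = ≡.refl
    ... | no ¬r = ⊥-elim (¬r (p , c))

    -- `posWeight` searches for the partner of a position, and `Describes` tells how the search
    -- ends. `E` places the states of the factor among those of the whole run, compatibly with the
    -- way `e` places its positions.
    posWeight-weight : ∀ {n} (s : Sk n) (e : Fin n → Fin len) (E : Fin (suc n) → Fin (suc len)) → Describes s e →
      (∀ p → F.inject₁ (e p) ≡ E (F.inject₁ p)) → (∀ p → suc (e p) ≡ E (suc p)) →
      ∀ r → ⨂ (pos n) (λ p → posWeight A nw r (e p)) ≈ weight s (lab ∘ e) (r ∘ E)
    posWeight-weight end e E h src tgt r = refl
    posWeight-weight (int {n} s) e E (h , hs) src tgt r = trans (reflexive (⨂-pos-suc n _)) (*-cong
      (reflexive (≡.trans (posWeight-int r (e zero) h)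
        (≡.cong₂ (λ x y → δint (r x) (lab (e zero)) (r y)) (src zero) (tgt zero))))
      (posWeight-weight s (e ∘ suc) (E ∘ suc) hs (src ∘ suc) (tgt ∘ suc) r))
    posWeight-weight (nest {m} {k} u v) e E (c , hu , hv , _) src tgt r = trans (⨂-pos-nest m k _) (*-cong
      (reflexive (≡.trans (posWeight-call r (e zero) _ c)
        (≡.cong₂ (λ x y → δcall (r x) (lab (e zero)) (r y)) (src zero) (tgt zero))))
      (*-cong
        (posWeight-weight u (e ∘ inner k) (λ j → E (suc (j ↑ˡ suc k))) hu
          (λ p → ≡.trans (src (inner k p)) (≡.cong (E ∘ suc) (inject₁-↑ˡ p (suc k)))) (λ p → tgt (inner k p)) r)
      (*-cong
        (reflexive (≡.trans (posWeight-ret r (e zero) (e (ret m k)) c)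
          (≡.trans
            (≡.cong (λ x → δret (r (F.inject₁ (e (ret m k)))) (r x) (lab (e (ret m k))) (r (suc (e (ret m k)))))
              (src zero))
          (≡.cong₂ (λ x y → δret (r x) (r (E zero)) (lab (e (ret m k))) (r y))
            (≡.trans (src (ret m k)) (≡.cong (E ∘ suc) (inject₁-↑ʳ-zero m k))) (tgt (ret m k))))))
        (posWeight-weight v (e ∘ after m) (λ j → E (suc (suc m ↑ʳ j))) hv
          (λ p → ≡.trans (src (after m p)) (≡.cong (E ∘ suc) (inject₁-↑ʳ-suc m p))) (λ p → tgt (after m p)) r))))

  -- Sum of the weights of the runs starting in q, each multiplied by the value of g at its last state.
  T : ∀ {n} → Sk n → (Fin n → Fin d) → Q → (Q → C) → C
  T end     f q g = g q
  T (int s) f q g = ⨁ (pos nQ) (λ q' → δint q (f zero) q' * T s (f ∘ suc) q' g)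
  -- The continuation given to the enclosed factor still refers to `q`, the state before the call,
  -- which the weight of the return reads.
  T (nest {m} {k} u v) f q g = ⨁ (pos nQ) (λ q₁ → δcall q (f zero) q₁ *
    T u (f ∘ inner k) q₁ (λ q₂ → ⨁ (pos nQ) (λ q₃ → δret q₂ q (f (ret m k)) q₃ * T v (f ∘ after m) q₃ g)))

  runs : ∀ n → List (Fin n → Q)
  runs = funs (pos nQ)

  T-runs : ∀ {n} (s : Sk n) f q g →
    ⨁ (runs n) (λ r → weight s f (q ∷ᶠ r) * g ((q ∷ᶠ r) (F.fromℕ n))) ≈ T s f q g
  T-runs end f q g = trans (+-identityʳ _) (*-identityˡ _)
  T-runs (int {n} s) f q g = trans (⨁-funs-suc (pos nQ) n _) (⨁-cong (pos nQ) (λ q' → trans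
    (⨁-cong (runs n) (λ r → *-assoc _ _ _)) (trans (sym (⨁-*ˡ (runs n) _ _))
    (*-congˡ (T-runs s (f ∘ suc) q' g)))))
  T-runs (nest {m} {k} u v) f q g = begin
    ⨁ (runs (suc (m ℕ.+ suc k))) (λ r → weight (nest u v) f (q ∷ᶠ r) * g ((q ∷ᶠ r) (F.fromℕ (suc (m ℕ.+ suc k)))))
      ≈⟨ ⨁-funs-nest (pos nQ) m k _ (λ e → *-cong (reflexive (weight-ext (nest u v) f (∷ᶠ-cong q e)))
           (reflexive (≡.cong g (e (F.fromℕ (m ℕ.+ suc k)))))) ⟩
    ⨁ (pos nQ) (λ q₁ → ⨁ (runs m) (λ x → ⨁ (pos nQ) (λ q₃ → ⨁ (runs k) (λ y →
      weight (nest u v) f (q ∷ᶠ glue q₁ x q₃ y) * g (glue q₁ x q₃ y (F.fromℕ (m ℕ.+ suc k)))))))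
      ≈⟨ ⨁-cong (pos nQ) (λ q₁ → ⨁-cong (runs m) (λ x → ⨁-cong (pos nQ) (λ q₃ → ⨁-cong (runs k) (λ y →
           glued q₁ x q₃ y)))) ⟩
    ⨁ (pos nQ) (λ q₁ → ⨁ (runs m) (λ x → ⨁ (pos nQ) (λ q₃ → ⨁ (runs k) (λ y →
      δcall q (f zero) q₁ * (weight u (f ∘ inner k) (q₁ ∷ᶠ x) *
        (δret ((q₁ ∷ᶠ x) (F.fromℕ m)) q (f (ret m k)) q₃ *
          (weight v (f ∘ after m) (q₃ ∷ᶠ y) * g ((q₃ ∷ᶠ y) (F.fromℕ k)))))))))
      ≈⟨ ⨁-cong (pos nQ) (λ q₁ → trans
           (⨁-cong (runs m) (λ x → trans
             (⨁-cong (pos nQ) (λ q₃ → trans (sym (⨁-*ˡ (runs k) _ _)) (*-congˡ (sym (⨁-*ˡ (runs k) _ _)))))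
             (trans (sym (⨁-*ˡ (pos nQ) _ _)) (*-congˡ (sym (⨁-*ˡ (pos nQ) _ _))))))
           (sym (⨁-*ˡ (runs m) _ _))) ⟩
    ⨁ (pos nQ) (λ q₁ → δcall q (f zero) q₁ * ⨁ (runs m) (λ x → weight u (f ∘ inner k) (q₁ ∷ᶠ x) *
      ⨁ (pos nQ) (λ q₃ → ⨁ (runs k) (λ y → δret ((q₁ ∷ᶠ x) (F.fromℕ m)) q (f (ret m k)) q₃ *
          (weight v (f ∘ after m) (q₃ ∷ᶠ y) * g ((q₃ ∷ᶠ y) (F.fromℕ k)))))))
      ≈⟨ ⨁-cong (pos nQ) (λ q₁ → *-congˡ (⨁-cong (runs m) (λ x → *-congˡ (⨁-cong (pos nQ) (λ q₃ →
           trans (sym (⨁-*ˡ (runs k) _ _)) (*-congˡ (T-runs v (f ∘ after m) q₃ g))))))) ⟩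
    ⨁ (pos nQ) (λ q₁ → δcall q (f zero) q₁ * ⨁ (runs m) (λ x → weight u (f ∘ inner k) (q₁ ∷ᶠ x) *
      ⨁ (pos nQ) (λ q₃ → δret ((q₁ ∷ᶠ x) (F.fromℕ m)) q (f (ret m k)) q₃ * T v (f ∘ after m) q₃ g)))
      ≈⟨ ⨁-cong (pos nQ) (λ q₁ → *-congˡ (T-runs u (f ∘ inner k) q₁ _)) ⟩
    T (nest u v) f q g ∎
    where
    left : ∀ q₁ (x : Fin m → Q) q₃ (y : Fin k → Q) → innerRun k (q ∷ᶠ glue q₁ x q₃ y) ≗ q₁ ∷ᶠ x
    left q₁ x q₃ y zero    = ≡.refl
    left q₁ x q₃ y (suc p) = glue-inner q₁ x q₃ y p
    right : ∀ q₁ (x : Fin m → Q) q₃ (y : Fin k → Q) → afterRun m (q ∷ᶠ glue q₁ x q₃ y) ≗ q₃ ∷ᶠ y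
    right q₁ x q₃ y zero    = glue-ret q₁ x q₃ y
    right q₁ x q₃ y (suc p) = glue-after q₁ x q₃ y p
    glued : ∀ q₁ x q₃ y → weight (nest u v) f (q ∷ᶠ glue q₁ x q₃ y) * g (glue q₁ x q₃ y (F.fromℕ (m ℕ.+ suc k))) ≈
      δcall q (f zero) q₁ * (weight u (f ∘ inner k) (q₁ ∷ᶠ x) *
        (δret ((q₁ ∷ᶠ x) (F.fromℕ m)) q (f (ret m k)) q₃ *
          (weight v (f ∘ after m) (q₃ ∷ᶠ y) * g ((q₃ ∷ᶠ y) (F.fromℕ k)))))
    glued q₁ x q₃ y
      rewrite weight-ext u (f ∘ inner k) (left q₁ x q₃ y) | weight-ext v (f ∘ after m) (right q₁ x q₃ y)
            | left q₁ x q₃ y (F.fromℕ m) | right q₁ x q₃ y zero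
            | fromℕ-+ m k | right q₁ x q₃ y (F.fromℕ k) =
      solve 5 (λ a b c d e → (a :* (b :* (c :* d))) :* e := a :* (b :* (c :* (d :* e)))) refl _ _ _ _ _

  behaviour-T : ∀ nw s → Shape nw s → behaviour A nw ≈ ⨁ (pos nQ) (λ q → ι q * T s (NestedWord.lab nw) q κ)
  behaviour-T nw s h = begin
    behaviour A nw ≈⟨ ∑-runs nQ (suc len) _ ⟩
    ⨁ (runs (suc len)) (λ r → (ι (r zero) * runWeight A nw r) * κ (r (F.fromℕ len)))
      ≈⟨ ⨁-funs-suc (pos nQ) len _ ⟩
    ⨁ (pos nQ) (λ q → ⨁ (runs len) (λ r → (ι q * runWeight A nw (q ∷ᶠ r)) * κ ((q ∷ᶠ r) (F.fromℕ len))))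
      ≈⟨ ⨁-cong (pos nQ) (λ q → trans (⨁-cong (runs len) (λ r → trans (*-assoc _ _ _)
           (*-congˡ (*-congʳ (trans (∏-⨂ len _)
             (posWeight-weight nw s id id h (λ _ → ≡.refl) (λ _ → ≡.refl) (q ∷ᶠ r)))))))
           (trans (sym (⨁-*ˡ (runs len) _ _)) (*-congˡ (T-runs s lab q κ)))) ⟩
    ⨁ (pos nQ) (λ q → ι q * T s lab q κ) ∎
    where open NestedWord nw

-- From recognisable series to automata.

module Construction {c ℓ} (K : CommutativeSemiring c ℓ) (d : ℕ)
  {S : ∀ {n} → Sk n → (Fin n → Letter d 0 0) → CommutativeSemiring.Carrier K}
  (RS : Linear.Recognisable K {Letter d 0 0} S) where
  open CommutativeSemiring K renaming (Carrier to C) hiding (zero)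
  open SemiringSum K
  open Weighted K d using (WNWA; behaviour)
  open Linear K
  open Recognisable RS
  open Relation.Binary.Reasoning.Setoid setoid
  open SemiringSolver K using (solve; _:=_; _:*_)

  private
    module I = Finite finite

    letter : Fin d → Letter d 0 0
    letter a = a , [] , []

  -- A state holds the series to be read off the rest of the current factor, and for the
  -- enclosing call its letter and the guess for the factor it encloses.
  Context : Set
  Context = Fin 1 ⊎ (Fin d × Fin I.size)

  State : Set
  State = Ix × Context

  state-finite : Finite State
  state-finite = ×-finite finite (⊎-finite (Fin-finite 1) (×-finite (Fin-finite d) (Fin-finite I.size)))

  open Finite state-finite

  combination : List (C × State) → Fin size → C
  combination L q = ⨁ L (λ (w , x) → w * [ eqF (enc x) q ])

  ⨁-combination : ∀ L G → ⨁ (pos size) (λ q → combination L q * G q) ≈ ⨁ L (λ (w , x) → w * G (enc x))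
  ⨁-combination L G = begin
    ⨁ (pos size) (λ q → combination L q * G q)
      ≈⟨ ⨁-cong (pos size) (λ q → ⨁-*ʳ L (G q) _) ⟩
    ⨁ (pos size) (λ q → ⨁ L (λ (w , x) → (w * [ eqF (enc x) q ]) * G q))
      ≈⟨ ⨁-swap (pos size) L _ ⟩
    ⨁ L (λ (w , x) → ⨁ (pos size) (λ q → (w * [ eqF (enc x) q ]) * G q))
      ≈⟨ ⨁-cong L (λ (w , x) → trans (⨁-cong (pos size) (λ q → *-assoc _ _ _))
           (trans (sym (⨁-*ˡ (pos size) w _)) (*-congˡ (⨁-pick G (enc x))))) ⟩
    ⨁ L (λ (w , x) → w * G (enc x)) ∎

  intRules : State → Fin d → List (C × State)
  intRules (l , γ) a = map (λ (w , j) → w , (j , γ)) (rI l (letter a))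

  -- The return letter is still unknown, so no rule can be applied yet: the call guesses, with
  -- weight one, the series of the enclosed factor.
  callRules : Fin d → List (C × State)
  callRules a = map (λ k → 1# , (I.dec k , inj₂ (a , k))) (pos I.size)

  -- Here the rule of the block is applied. The state before the call contributes the index `l` to
  -- be expanded and the outer context `γ`; the current state contributes the final value of the
  -- enclosed factor, the call letter and the guess, which must be the index named by the rule.
  retRules : State → State → Fin d → List (C × State)
  retRules (m , inj₁ _)       (l , γ) b = []
  retRules (m , inj₂ (a , k)) (l , γ) b =
    map (λ (w , j , n) → e m * (w * [ eqF (I.enc j) k ]) , (n , γ)) (rN l (letter a) (letter b))

  automaton : WNWA
  automaton = record
    { nQ = size
    ; ι = combination (map (λ (w , l) → w , (l , inj₁ zero)) init)
    ; κ = λ q → e (proj₁ (dec q))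
    ; δcall = λ q a → combination (callRules a)
    ; δint = λ q a → combination (intRules (dec q) a)
    ; δret = λ q q' b → combination (retRules (dec q) (dec q') b) }

  open Runs K d automaton using (T; behaviour-T)

  -- A factor hands its context on unchanged. The induction therefore admits every continuation that
  -- multiplies the final value of the index by something depending on the context alone; for an
  -- enclosed factor that something is the return rule with all that follows.
  T-automaton : ∀ {n} (s : Sk n) f l γ (val : Context → C) g → (∀ m γ' → g (enc (m , γ')) ≈ e m * val γ') →
    T s f (enc (l , γ)) g ≈ F l s (letter ∘ f) * val γ
  T-automaton end f l γ val g h = trans (h l γ) (*-congʳ (sym (F-end l _)))
  T-automaton (int s) f l γ val g h = begin
    ⨁ (pos size) (λ q → combination (intRules (dec (enc (l , γ))) (f zero)) q * T s (f ∘ suc) q g)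
      ≡⟨ ≡.cong (λ x → ⨁ (pos size) (λ q → combination (intRules x (f zero)) q * T s (f ∘ suc) q g)) (dec-enc (l , γ)) ⟩
    ⨁ (pos size) (λ q → combination (intRules (l , γ) (f zero)) q * T s (f ∘ suc) q g)
      ≈⟨ ⨁-combination (intRules (l , γ) (f zero)) _ ⟩
    ⨁ (intRules (l , γ) (f zero)) (λ (w , x) → w * T s (f ∘ suc) (enc x) g)
      ≡⟨ ⨁-map _ (rI l (letter (f zero))) _ ⟩
    ⨁ (rI l (letter (f zero))) (λ (w , j) → w * T s (f ∘ suc) (enc (j , γ)) g)
      ≈⟨ ⨁-cong (rI l (letter (f zero))) (λ (w , j) →
           trans (*-congˡ (T-automaton s (f ∘ suc) j γ val g h)) (sym (*-assoc _ _ _))) ⟩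
    ⨁ (rI l (letter (f zero))) (λ (w , j) → (w * F j s (letter ∘ f ∘ suc)) * val γ)
      ≈⟨ ⨁-*ʳ (rI l (letter (f zero))) _ _ ⟨
    ⨁ (rI l (letter (f zero))) (λ (w , j) → w * F j s (letter ∘ f ∘ suc)) * val γ
      ≈⟨ *-congʳ (F-int l s (letter ∘ f)) ⟨
    F l (int s) (letter ∘ f) * val γ ∎
  T-automaton (nest {m} {k} u v) f l γ val g h = begin
    ⨁ (pos size) (λ q₁ → combination (callRules a) q₁ * T u fu q₁ g')
      ≈⟨ ⨁-combination (callRules a) _ ⟩
    ⨁ (callRules a) (λ (w , x) → w * T u fu (enc x) g')
      ≡⟨ ⨁-map _ (pos I.size) _ ⟩
    ⨁ (pos I.size) (λ i → 1# * T u fu (enc (I.dec i , inj₂ (a , i))) g')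
      ≈⟨ ⨁-cong (pos I.size) (λ i → trans (*-identityˡ _)
           (T-automaton u fu (I.dec i) (inj₂ (a , i)) val' g' g'-val)) ⟩
    ⨁ (pos I.size) (λ i → F (I.dec i) u (letter ∘ fu) * val' (inj₂ (a , i)))
      ≈⟨ ⨁-cong (pos I.size) (λ i → ⨁-*ˡ L _ _) ⟩
    ⨁ (pos I.size) (λ i → ⨁ L (λ (w , j , n) →
      F (I.dec i) u (letter ∘ fu) * ((w * [ eqF (I.enc j) i ]) * (F n v (letter ∘ fv) * val γ))))
      ≈⟨ ⨁-swap (pos I.size) L _ ⟩
    ⨁ L (λ (w , j , n) → ⨁ (pos I.size) (λ i →
      F (I.dec i) u (letter ∘ fu) * ((w * [ eqF (I.enc j) i ]) * (F n v (letter ∘ fv) * val γ))))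
      ≈⟨ ⨁-cong L (λ (w , j , n) → begin
           ⨁ (pos I.size) (λ i → F (I.dec i) u (letter ∘ fu) * ((w * [ eqF (I.enc j) i ]) * (F n v (letter ∘ fv) * val γ)))
             ≈⟨ ⨁-cong (pos I.size) (λ i →
                  solve 5 (λ x y z p q → x :* ((y :* z) :* (p :* q)) := z :* ((y :* (x :* p)) :* q)) refl _ _ _ _ _) ⟩
           ⨁ (pos I.size) (λ i → [ eqF (I.enc j) i ] * ((w * (F (I.dec i) u (letter ∘ fu) * F n v (letter ∘ fv))) * val γ))
             -- Of all guesses made at the call, the check at the return keeps only the code of `j`.
             ≈⟨ ⨁-pick _ (I.enc j) ⟩
           (w * (F (I.dec (I.enc j)) u (letter ∘ fu) * F n v (letter ∘ fv))) * val γ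
             ≡⟨ ≡.cong (λ x → (w * (F x u (letter ∘ fu) * F n v (letter ∘ fv))) * val γ) (I.dec-enc j) ⟩
           (w * (F j u (letter ∘ fu) * F n v (letter ∘ fv))) * val γ ∎) ⟩
    ⨁ L (λ (w , j , n) → (w * (F j u (letter ∘ fu) * F n v (letter ∘ fv))) * val γ)
      ≈⟨ ⨁-*ʳ L _ _ ⟨
    ⨁ L (λ (w , j , n) → w * (F j u (letter ∘ fu) * F n v (letter ∘ fv))) * val γ
      ≈⟨ *-congʳ (F-nest l u v (letter ∘ f)) ⟨
    F l (nest u v) (letter ∘ f) * val γ ∎
    where
    a b : Fin d
    a = f zero
    b = f (ret m k)
    fu : Fin m → Fin d
    fu = f ∘ inner k
    fv : Fin k → Fin d
    fv = f ∘ after m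
    L : List (C × Ix × Ix)
    L = rN l (letter a) (letter b)
    g' : Fin size → C
    g' q₂ = ⨁ (pos size) (λ q₃ → combination (retRules (dec q₂) (dec (enc (l , γ))) b) q₃ * T v fv q₃ g)
    val' : Context → C
    val' (inj₁ _)        = 0#
    val' (inj₂ (a' , i)) = ⨁ (rN l (letter a') (letter b))
      (λ (w , j , n) → (w * [ eqF (I.enc j) i ]) * (F n v (letter ∘ fv) * val γ))
    g'-val : ∀ x γ' → g' (enc (x , γ')) ≈ e x * val' γ'
    g'-val x γ' = trans
      (reflexive (≡.cong₂ (λ y z → ⨁ (pos size) (λ q₃ → combination (retRules y z b) q₃ * T v fv q₃ g))
        (dec-enc (x , γ')) (dec-enc (l , γ))))
      (trans (⨁-combination (retRules (x , γ') (l , γ) b) _) (cases γ'))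
      where
      cases : ∀ γ' → ⨁ (retRules (x , γ') (l , γ) b) (λ (w , y) → w * T v fv (enc y) g) ≈ e x * val' γ'
      cases (inj₁ _)        = sym (zeroʳ _)
      cases (inj₂ (a' , i)) = trans (reflexive (⨁-map _ (rN l (letter a') (letter b)) _)) (trans
        (⨁-cong (rN l (letter a') (letter b)) (λ (w , j , n) →
          trans (*-assoc _ _ _) (*-congˡ (*-congˡ (T-automaton v fv n γ val g h)))))
        (sym (⨁-*ˡ (rN l (letter a') (letter b)) _ _)))

  automaton-correct : ∀ nw s → Shape nw s → S s (letter ∘ NestedWord.lab nw) ≈ behaviour automaton nw
  automaton-correct nw s h = sym (begin
    behaviour automaton nw
      ≈⟨ behaviour-T nw s h ⟩
    ⨁ (pos size) (λ q → combination starts q * T s (NestedWord.lab nw) q (WNWA.κ automaton))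
      ≈⟨ ⨁-combination starts _ ⟩
    ⨁ starts (λ (w , x) → w * T s (NestedWord.lab nw) (enc x) (WNWA.κ automaton))
      ≡⟨ ⨁-map _ init _ ⟩
    ⨁ init (λ (w , l) → w * T s (NestedWord.lab nw) (enc (l , inj₁ zero)) (WNWA.κ automaton))
      ≈⟨ ⨁-cong init (λ (w , l) → *-congˡ (trans
           (T-automaton s (NestedWord.lab nw) l (inj₁ zero) (λ _ → 1#) (WNWA.κ automaton) (λ m γ' →
             trans (reflexive (≡.cong (e ∘ proj₁) (dec-enc (m , γ')))) (sym (*-identityʳ _))))
           (*-identityʳ _))) ⟩
    ⨁ init (λ (w , l) → w * F l s (letter ∘ NestedWord.lab nw))
      ≈⟨ law s _ ⟨
    S s (letter ∘ NestedWord.lab nw) ∎)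
    where
    starts : List (C × State)
    starts = map (λ (w , l) → w , (l , inj₁ zero)) init

-- First-order properties of positions.

ltF : ∀ {n} → Fin n → Fin n → Bool
ltF y x = not (leF x y)

any-false : ∀ {A : Set} (L : List A) {g : A → Bool} → (∀ x → g x ≡ false) → any L g ≡ false
any-false L = Or.⨁-ε L

isFirst : ∀ {n} → Fin n → Bool
isFirst zero    = true
isFirst (suc _) = false

first-isFirst : ∀ {n} (x : Fin n) → not (any (pos n) (λ y → ltF y x)) ≡ isFirst x
first-isFirst {suc n} zero    rewrite any-false (pos (suc n)) {λ y → ltF y zero} (λ _ → ≡.refl) = ≡.refl
first-isFirst {suc n} (suc x) = ≡.refl

isNext : ∀ {n} → Fin n → Fin n → Bool
isNext y       zero          = false
isNext zero    (suc zero)    = true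
isNext zero    (suc (suc _)) = false
isNext (suc y) (suc x)       = isNext y x

next-isNext : ∀ {n} (y x : Fin n) → ltF y x ∧ not (any (pos n) (λ z → ltF y z ∧ ltF z x)) ≡ isNext y x
next-isNext         zero    zero          = ≡.refl
next-isNext         (suc y) zero          = ≡.refl
next-isNext {suc n} zero    (suc zero)    =
  ≡.cong not (any-false (pos (suc n)) {λ z → ltF zero z ∧ ltF z (suc zero)} (λ { zero → ≡.refl ; (suc z) → ≡.refl }))
next-isNext {suc (suc n)} zero (suc (suc x)) = ≡.refl
next-isNext {suc n} (suc y) (suc x)       = ≡.trans
  (≡.cong (λ b → ltF y x ∧ not b) (Or.⨁-pos-suc n (λ z → ltF (suc y) z ∧ ltF z (suc x))))
  (next-isNext y x)

isNext-inject₁ : ∀ {n} (y : Fin (suc n)) (x : Fin n) → isNext y (suc x) ≡ eqF (F.inject₁ x) y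
isNext-inject₁         zero    zero    = ≡.refl
isNext-inject₁         zero    (suc x) = ≡.refl
isNext-inject₁ {suc n} (suc y) zero    = ≡.refl
isNext-inject₁ {suc n} (suc y) (suc x) = isNext-inject₁ y x

last-fromℕ : ∀ n (y : Fin (suc n)) → not (any (pos (suc n)) (λ z → ltF y z)) ≡ eqF (F.fromℕ n) y
last-fromℕ zero    zero    = ≡.refl
last-fromℕ (suc n) zero    = ≡.refl
last-fromℕ (suc n) (suc y) = ≡.trans (≡.cong not (Or.⨁-pos-suc (suc n) (λ z → ltF (suc y) z))) (last-fromℕ n y)

any-select : ∀ {n} (p : Fin n) (s g : Fin n → Bool) → (∀ q → s q ≡ eqF p q) → any (pos n) (λ q → s q ∧ g q) ≡ g p
any-select {n} p s g e = ≡.trans (Or.⨁-cong (pos n) (λ q → ≡.cong (_∧ g q) (e q)))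
  (Or.⨁-δ (λ q b → b ∧ g q) p (λ q → ≡.refl))

any-true : ∀ {n} (g : Fin n → Bool) p → g p ≡ true → any (pos n) g ≡ true
any-true {suc n} g zero    e rewrite e = ≡.refl
any-true {suc n} g (suc p) e rewrite Or.⨁-pos-suc n g | any-true (g ∘ suc) p e = BP.∨-zeroʳ (g zero)

none : ∀ n → (Fin n → Bool) → Bool
none zero    v = true
none (suc n) v = not (v zero) ∧ none n (v ∘ suc)

exactlyOne : ∀ n → (Fin n → Bool) → Bool
exactlyOne zero    v = false
exactlyOne (suc n) v = (v zero ∧ none n (v ∘ suc)) ∨ (not (v zero) ∧ exactlyOne n (v ∘ suc))

-- Sums over families of state sets.

module MatrixSums {c ℓ} (K : CommutativeSemiring c ℓ) where
  open CommutativeSemiring K renaming (Carrier to C) hiding (zero)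
  open SemiringSum K
  open Relation.Binary.Reasoning.Setoid setoid

  ⨁-none : ∀ n (g : (Fin n → Bool) → C) → Ext g → ⨁ (funs bools n) (λ v → [ none n v ] * g v) ≈ g (λ _ → false)
  ⨁-none zero    g ext = trans (+-identityʳ _) (trans (*-identityˡ _) (ext (λ ())))
  ⨁-none (suc n) g ext = trans (⨁-funs-suc bools n _) (trans
    (⨁-bools (λ b → ⨁ (funs bools n) (λ v → [ not b ∧ none n v ] * g (b ∷ᶠ v)))) (trans
    (+-cong (⨁-none n (λ v → g (false ∷ᶠ v)) (λ e → ext (∷ᶠ-cong false e))) (⨁-ε (funs bools n) (λ v → zeroˡ _))) (trans
    (+-identityʳ _) (ext (λ { zero → ≡.refl ; (suc p) → ≡.refl })))))

  ⨁-exactlyOne : ∀ n (g : (Fin n → Bool) → C) → Ext g →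
    ⨁ (funs bools n) (λ v → [ exactlyOne n v ] * g v) ≈ ⨁ (pos n) (λ q → g (eqF q))
  ⨁-exactlyOne zero    g ext = trans (+-identityʳ _) (zeroˡ _)
  ⨁-exactlyOne (suc n) g ext = begin
    ⨁ (funs bools (suc n)) (λ v → [ exactlyOne (suc n) v ] * g v)
      ≈⟨ trans (⨁-funs-suc bools n _) (⨁-bools (λ b → ⨁ (funs bools n) (λ v → [ exactlyOne (suc n) (b ∷ᶠ v) ] * g (b ∷ᶠ v)))) ⟩
    ⨁ (funs bools n) (λ v → [ exactlyOne n v ] * g (false ∷ᶠ v)) +
    ⨁ (funs bools n) (λ v → [ none n v ∨ false ] * g (true ∷ᶠ v))
      ≈⟨ +-cong (⨁-exactlyOne n (λ v → g (false ∷ᶠ v)) (λ e → ext (∷ᶠ-cong false e)))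
           (trans (⨁-cong (funs bools n) (λ v → *-congʳ (reflexive (≡.cong [_] (BP.∨-identityʳ (none n v))))))
             (⨁-none n (λ v → g (true ∷ᶠ v)) (λ e → ext (∷ᶠ-cong true e)))) ⟩
    ⨁ (pos n) (λ q → g (false ∷ᶠ eqF q)) + g (true ∷ᶠ (λ _ → false))
      ≈⟨ +-comm _ _ ⟩
    g (true ∷ᶠ (λ _ → false)) + ⨁ (pos n) (λ q → g (false ∷ᶠ eqF q))
      ≈⟨ +-cong (ext (λ { zero → ≡.refl ; (suc p) → ≡.refl }))
           (⨁-cong (pos n) (λ q → ext (λ { zero → ≡.refl ; (suc p) → ≡.refl }))) ⟩
    g (eqF zero) + ⨁ (pos n) (λ q → g (eqF (suc q)))
      ≡⟨ ⨁-pos-suc n (λ q → g (eqF q)) ⟨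
    ⨁ (pos (suc n)) (λ q → g (eqF q)) ∎

  Ext² : ∀ {A B D : Set} → ((A → B → D) → C) → Set ℓ
  Ext² {A} {B} {D} H = ∀ {σ τ : A → B → D} → (∀ a → σ a ≗ τ a) → H σ ≈ H τ

  -- Choosing one state set per state q (rows) amounts to choosing one bit vector per position (columns).
  ⨁-rows : ∀ n len → ((Fin n → Fin len → Bool) → C) → C
  ⨁-rows zero    len G = G (λ ())
  ⨁-rows (suc n) len G = ⨁-rows n len (λ σ → ⨁ (funs bools len) (λ X → G (X ∷ᶠ σ)))

  ⨁-zip : ∀ n len (H : (Fin len → Fin (suc n) → Bool) → C) → Ext² H →
    ⨁ (funs (funs bools (suc n)) len) H ≈
    ⨁ (funs (funs bools n) len) (λ τ → ⨁ (funs bools len) (λ X → H (λ p → X p ∷ᶠ τ p)))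
  ⨁-zip n zero H ext = +-congʳ (trans (ext (λ ())) (sym (+-identityʳ _)))
  ⨁-zip n (suc len) H ext = begin
    ⨁ (funs (funs bools (suc n)) (suc len)) H
      ≈⟨ trans (⨁-funs-suc (funs bools (suc n)) len H) (⨁-funs-suc bools n _) ⟩
    ⨁ bools (λ b → ⨁ (funs bools n) (λ v → ⨁ (funs (funs bools (suc n)) len) (λ τ → H ((b ∷ᶠ v) ∷ᶠ τ))))
      ≈⟨ ⨁-cong bools (λ b → ⨁-cong (funs bools n) (λ v → ⨁-zip n len (λ τ → H ((b ∷ᶠ v) ∷ᶠ τ))
           (λ e → ext (λ { zero q → ≡.refl ; (suc p) q → e p q })))) ⟩
    ⨁ bools (λ b → ⨁ (funs bools n) (λ v → ⨁ (funs (funs bools n) len) (λ τ → ⨁ (funs bools len) (λ X →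
      H ((b ∷ᶠ v) ∷ᶠ (λ p → X p ∷ᶠ τ p))))))
      ≈⟨ trans (⨁-swap bools (funs bools n) (λ b v → ⨁ (funs (funs bools n) len) (λ τ → Z b v τ)))
           (⨁-cong (funs bools n) (λ v → ⨁-swap bools (funs (funs bools n) len) (λ b τ → Z b v τ))) ⟩
    ⨁ (funs bools n) (λ v → ⨁ (funs (funs bools n) len) (λ τ → ⨁ bools (λ b → ⨁ (funs bools len) (λ X →
      H ((b ∷ᶠ v) ∷ᶠ (λ p → X p ∷ᶠ τ p))))))
      ≈⟨ ⨁-cong (funs bools n) (λ v → ⨁-cong (funs (funs bools n) len) (λ τ → trans
           (⨁-cong bools (λ b → prepend b v τ)) (sym (⨁-funs-suc bools len _)))) ⟩
    ⨁ (funs bools n) (λ v → ⨁ (funs (funs bools n) len) (λ τ → ⨁ (funs bools (suc len)) (λ X →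
      H (λ p → X p ∷ᶠ (v ∷ᶠ τ) p))))
      ≈⟨ ⨁-funs-suc (funs bools n) len _ ⟨
    ⨁ (funs (funs bools n) (suc len)) (λ τ → ⨁ (funs bools (suc len)) (λ X → H (λ p → X p ∷ᶠ τ p))) ∎
    where
    Z : Bool → (Fin n → Bool) → (Fin len → Fin n → Bool) → C
    Z b v τ = ⨁ (funs bools len) (λ X → H ((b ∷ᶠ v) ∷ᶠ (λ p → X p ∷ᶠ τ p)))
    prepend : ∀ b v τ → Z b v τ ≈ ⨁ (funs bools len) (λ X → H (λ p → (b ∷ᶠ X) p ∷ᶠ (v ∷ᶠ τ) p))
    prepend b v τ = ⨁-cong (funs bools len) (λ X → ext (λ { zero q → ≡.refl ; (suc p) q → ≡.refl }))

  ⨁-rows-columns : ∀ n len (G : (Fin n → Fin len → Bool) → C) → Ext² G →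
    ⨁-rows n len G ≈ ⨁ (funs (funs bools n) len) (λ τ → G (λ q p → τ p q))
  ⨁-rows-columns zero len G ext = sym (trivial len (λ τ → G (λ q p → τ p q)) (λ τ → ext (λ ())))
    where
    trivial : ∀ len (H : (Fin len → Fin 0 → Bool) → C) →
      (∀ τ → H τ ≈ G (λ ())) → ⨁ (funs (funs bools 0) len) H ≈ G (λ ())
    trivial zero      H e = trans (+-identityʳ _) (e _)
    trivial (suc len) H e = trans (⨁-funs-suc (funs bools 0) len H) (trans (+-identityʳ _)
      (trivial len (λ τ → H ((λ ()) ∷ᶠ τ)) (λ τ → e _)))
  ⨁-rows-columns (suc n) len G ext = trans
    (⨁-rows-columns n len (λ σ → ⨁ (funs bools len) (λ X → G (X ∷ᶠ σ)))
      (λ e → ⨁-cong (funs bools len) (λ X → ext (λ { zero p → ≡.refl ; (suc q) p → e q p }))))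
    (sym (trans (⨁-zip n len (λ τ → G (λ q p → τ p q)) (λ e → ext (λ q p → e p q)))
      (⨁-cong (funs (funs bools n) len) (λ τ → ⨁-cong (funs bools len) (λ X →
        ext (λ { zero p → ≡.refl ; (suc q) p → ≡.refl }))))))

  -- A Boolean matrix with exactly one true entry per position is the graph of a map from positions
  -- to states.
  ⨁-partition : ∀ n len (H : (Fin len → Fin n → Bool) → C) → Ext² H →
    ⨁ (funs (funs bools n) len) (λ τ → ⨂ (pos len) (λ p → [ exactlyOne n (τ p) ]) * H τ) ≈
    ⨁ (funs (pos n) len) (λ r → H (λ p → eqF (r p)))
  ⨁-partition n zero H ext = +-congʳ (trans (*-identityˡ _) (ext (λ ())))
  ⨁-partition n (suc len) H ext = begin
    ⨁ (funs (funs bools n) (suc len)) (λ τ → ⨂ (pos (suc len)) (λ p → [ exactlyOne n (τ p) ]) * H τ)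
      ≈⟨ ⨁-funs-suc (funs bools n) len _ ⟩
    ⨁ (funs bools n) (λ v → ⨁ (funs (funs bools n) len) (λ τ →
      ⨂ (pos (suc len)) (λ p → [ exactlyOne n ((v ∷ᶠ τ) p) ]) * H (v ∷ᶠ τ)))
      ≈⟨ ⨁-cong (funs bools n) (λ v → trans (⨁-cong (funs (funs bools n) len) (λ τ → trans
           (*-congʳ (reflexive (⨂-pos-suc len (λ p → [ exactlyOne n ((v ∷ᶠ τ) p) ])))) (*-assoc _ _ _)))
           (trans (sym (⨁-*ˡ (funs (funs bools n) len) _ _)) (*-congˡ (⨁-partition n len (λ τ → H (v ∷ᶠ τ))
             (λ e → ext (λ { zero q → ≡.refl ; (suc p) q → e p q })))))) ⟩
    ⨁ (funs bools n) (λ v → [ exactlyOne n v ] * ⨁ (funs (pos n) len) (λ r → H (v ∷ᶠ (λ p → eqF (r p)))))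
      ≈⟨ ⨁-exactlyOne n (λ v → ⨁ (funs (pos n) len) (λ r → H (v ∷ᶠ (λ p → eqF (r p)))))
           (λ e → ⨁-cong (funs (pos n) len) (λ r → ext (λ { zero q → e q ; (suc p) q → ≡.refl }))) ⟩
    ⨁ (pos n) (λ q → ⨁ (funs (pos n) len) (λ r → H (eqF q ∷ᶠ (λ p → eqF (r p)))))
      ≈⟨ ⨁-cong (pos n) (λ q → ⨁-cong (funs (pos n) len) (λ r →
           ext (λ { zero _ → ≡.refl ; (suc p) _ → ≡.refl }))) ⟩
    ⨁ (pos n) (λ q → ⨁ (funs (pos n) len) (λ r → H (λ p → eqF ((q ∷ᶠ r) p))))
      ≈⟨ ⨁-funs-suc (pos n) len _ ⟨
    ⨁ (funs (pos n) (suc len)) (λ r → H (λ p → eqF (r p))) ∎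

-- From automata to formulas.

module Encoding {c ℓ} (K : CommutativeSemiring c ℓ) (d : ℕ) (A : Weighted.WNWA K d) where
  open CommutativeSemiring K renaming (Carrier to C) hiding (zero)
  open SemiringSum K
  open BigOperators d
  open MatrixSums K
  open Weighted K d
  open Weighted.WNWA A
  open Unambiguous K d
  open Relation.Binary.Reasoning.Setoid setoid

  private
    variable
      i j : ℕ

    Q : Set
    Q = Fin nQ

  firstC : Fin i → MSO d i j
  firstC x = neg (ex1 (ltC zero (suc x)))

  nextC : Fin i → Fin i → MSO d i j
  nextC y x = andC (ltC y x) (neg (ex1 (andC (ltC (suc y) zero) (ltC zero (suc x)))))

  noneC : ∀ k → (Fin k → Fin j) → MSO d (suc i) j
  noneC zero    X = atom (eqA zero zero)
  noneC (suc k) X = andC (neg (atom (memA zero (X zero)))) (noneC k (X ∘ suc))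

  exactlyOneC : ∀ k → (Fin k → Fin j) → MSO d (suc i) j
  exactlyOneC zero    X = neg (atom (eqA zero zero))
  exactlyOneC (suc k) X = or (andC (atom (memA zero (X zero))) (noneC k (X ∘ suc)))
                             (andC (neg (atom (memA zero (X zero)))) (exactlyOneC k (X ∘ suc)))

  -- The set variable q holds the positions after which the run is in state q; the initial state q₀ is a parameter.
  nextInC : Q → Fin i → MSO d i nQ
  nextInC p x = ex1 (andC (nextC zero (suc x)) (atom (memA zero p)))

  -- No position lies before the first one, so there the parameter `q₀` stands for the preceding
  -- state. Both states are known when the formula is built, and their comparison is not part of the
  -- formula.
  beforeC : Q → Q → Fin i → MSO d i nQ
  beforeC q₀ p x with eqF q₀ p
  ... | true  = or (firstC x) (nextInC p x)
  ... | false = nextInC p x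

  lastC : Q → MSO d i nQ
  lastC q = ex1 (andC (neg (ex1 (ltC (suc zero) zero))) (atom (memA zero q)))

  callerC : Q → Q → MSO d 1 nQ
  callerC q₀ p = ex1 (andC (atom (nuA zero (suc zero))) (beforeC q₀ p zero))

  isRetC isCallC : MSO d 1 nQ
  isRetC  = ex1 (atom (nuA zero (suc zero)))
  isCallC = ex1 (atom (nuA (suc zero) zero))

  sumF : ∀ k → (Fin k → WMSO C d i j) → WMSO C d i j
  sumF zero    φ = const 0#
  sumF (suc k) φ = or (φ zero) (sumF k (φ ∘ suc))

  caseF : ∀ k → (Fin k → MSO d i j) → (Fin k → WMSO C d i j) → WMSO C d i j
  caseF k χ φ = sumF k (λ p → and (χ p ⁺) (φ p))

  targetF : (Fin d → Q → C) → WMSO C d 1 nQ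
  targetF δ = caseF nQ (λ q → atom (memA zero q)) (λ q → caseF d (λ a → atom (labA a zero)) (λ a → const (δ a q)))

  localF : Q → (Q → Fin d → Q → C) → WMSO C d 1 nQ
  localF q₀ δ = caseF nQ (λ p → beforeC q₀ p zero) (λ p → targetF (δ p))

  returnF : Q → WMSO C d 1 nQ
  returnF q₀ = caseF nQ (λ p → beforeC q₀ p zero) (λ p → caseF nQ (callerC q₀) (λ p' → targetF (δret p p')))

  noReturnF : Q → WMSO C d 1 nQ
  noReturnF q₀ = or (and (isCallC ⁺) (localF q₀ δcall)) (and (isCallC ⁻) (localF q₀ δint))

  -- The tests follow the order of the searches in `posWeight`, so that the two agree case by case.
  stepF : Q → WMSO C d 1 nQ
  stepF q₀ = or (and (isRetC ⁺) (returnF q₀)) (and (isRetC ⁻) (noReturnF q₀))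

  runF : Q → WMSO C d 0 nQ
  runF q₀ = and (const (ι q₀)) (and (all1 (stepF q₀)) (caseF nQ lastC (λ q → const (κ q))))

  bodyF : WMSO C d 0 nQ
  bodyF = and (all1 (exactlyOneC nQ id ⁺)) (sumF nQ runF)

  exs : ∀ n → WMSO C d 0 n → WMSO C d 0 0
  exs zero    φ = φ
  exs (suc n) φ = exs n (ex2 φ)

  formula : WMSO C d 0 0
  formula = exs nQ bodyF

  -- What `sRFO` asks of the body of a universal quantifier, carried through the constructions as
  -- one property.
  record Tame {i j} (φ : WMSO C d i j) : Set c where
    field
      inAUMSO    : aUMSO φ
      restricted : Restricted aUMSO φ
      noSetQ     : NoSetQ φ
  open Tame

  tame-const : ∀ k → Tame {i} {j} (const k)
  tame-const k = record { inAUMSO = const k ; restricted = const k ; noSetQ = const k }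

  tame-and : {φ ψ : WMSO C d i j} → Tame φ → Tame ψ → Tame (and φ ψ)
  tame-and p q = record { inAUMSO = and (inAUMSO p) (inAUMSO q)
    ; restricted = and (restricted p) (restricted q) ; noSetQ = and (noSetQ p) (noSetQ q) }

  tame-or : {φ ψ : WMSO C d i j} → Tame φ → Tame ψ → Tame (or φ ψ)
  tame-or p q = record { inAUMSO = or (inAUMSO p) (inAUMSO q)
    ; restricted = or (restricted p) (restricted q) ; noSetQ = or (noSetQ p) (noSetQ q) }

  tame⁺ : {χ : MSO d i j} → FO χ → Tame (χ ⁺)
  tame⁺ {χ = χ} h = record { inAUMSO = su (χ , inj₁ ≡.refl)
    ; restricted = proj₁ (pm-restricted su χ) ; noSetQ = proj₁ (pmR-noSetQ h id id) }

  tame⁻ : {χ : MSO d i j} → FO χ → Tame (χ ⁻)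
  tame⁻ {χ = χ} h = record { inAUMSO = su (χ , inj₂ ≡.refl)
    ; restricted = proj₂ (pm-restricted su χ) ; noSetQ = proj₂ (pmR-noSetQ h id id) }

  tame-caseF : ∀ k {χ : Fin k → MSO d i j} {φ : Fin k → WMSO C d i j} →
    (∀ p → FO (χ p)) → (∀ p → Tame (φ p)) → Tame (caseF k χ φ)
  tame-caseF zero    hχ hφ = tame-const 0#
  tame-caseF (suc k) hχ hφ = tame-or (tame-and (tame⁺ (hχ zero)) (hφ zero)) (tame-caseF k (hχ ∘ suc) (hφ ∘ suc))

  andC-FO : {φ ψ : MSO d i j} → FO φ → FO ψ → FO (andC φ ψ)
  andC-FO p q = neg (or (neg p) (neg q))

  nextInC-FO : ∀ p (x : Fin i) → FO (nextInC p x)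
  nextInC-FO p x = ex1 (andC-FO (andC-FO (neg (atom _)) (neg (ex1 (andC-FO (neg (atom _)) (neg (atom _)))))) (atom _))

  beforeC-FO : ∀ q₀ p (x : Fin i) → FO (beforeC q₀ p x)
  beforeC-FO q₀ p x with eqF q₀ p
  ... | true  = or (neg (ex1 (neg (atom _)))) (nextInC-FO p x)
  ... | false = nextInC-FO p x

  lastC-FO : ∀ q → FO {i} (lastC q)
  lastC-FO q = ex1 (andC-FO (neg (ex1 (neg (atom _)))) (atom _))

  noneC-FO : ∀ k (X : Fin k → Fin j) → FO {suc i} (noneC k X)
  noneC-FO zero    X = atom _
  noneC-FO (suc k) X = andC-FO (neg (atom _)) (noneC-FO k (X ∘ suc))

  exactlyOneC-FO : ∀ k (X : Fin k → Fin j) → FO {suc i} (exactlyOneC k X)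
  exactlyOneC-FO zero    X = neg (atom _)
  exactlyOneC-FO (suc k) X = or (andC-FO (atom _) (noneC-FO k (X ∘ suc)))
    (andC-FO (neg (atom _)) (exactlyOneC-FO k (X ∘ suc)))

  targetF-tame : ∀ δ → Tame (targetF δ)
  targetF-tame δ = tame-caseF nQ (λ q → atom _) (λ q → tame-caseF d (λ a → atom _) (λ a → tame-const (δ a q)))

  localF-tame : ∀ q₀ δ → Tame (localF q₀ δ)
  localF-tame q₀ δ = tame-caseF nQ (λ p → beforeC-FO q₀ p zero) (λ p → targetF-tame (δ p))

  stepF-tame : ∀ q₀ → Tame (stepF q₀)
  stepF-tame q₀ = tame-or
    (tame-and (tame⁺ (ex1 (atom _))) (tame-caseF nQ (λ p → beforeC-FO q₀ p zero) (λ p →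
      tame-caseF nQ (λ p' → ex1 (andC-FO (atom _) (beforeC-FO q₀ p' zero))) (λ p' → targetF-tame (δret p p')))))
    (tame-and (tame⁻ (ex1 (atom _))) (tame-or
      (tame-and (tame⁺ (ex1 (atom _))) (localF-tame q₀ δcall))
      (tame-and (tame⁻ (ex1 (atom _))) (localF-tame q₀ δint))))

  sRFO-and : {φ ψ : WMSO C d i j} → sRFO φ → sRFO ψ → sRFO (and φ ψ)
  sRFO-and (p , p') (q , q') = and p q , and p' q'

  sRFO-all1 : {φ : WMSO C d (suc i) j} → Tame φ → sRFO (all1 φ)
  sRFO-all1 h = all1 (inAUMSO h) (restricted h) , all1 (noSetQ h)

  sRFO-sumF : ∀ k {φ : Fin k → WMSO C d i j} → (∀ p → sRFO (φ p)) → sRFO (sumF k φ)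
  sRFO-sumF zero    h = const 0# , const 0#
  sRFO-sumF (suc k) h = or (proj₁ (h zero)) (proj₁ r) , or (proj₂ (h zero)) (proj₂ r)
    where r = sRFO-sumF k (h ∘ suc)

  bodyF-sRFO : sRFO bodyF
  bodyF-sRFO = sRFO-and (sRFO-all1 (tame⁺ (exactlyOneC-FO nQ id))) (sRFO-sumF nQ (λ q₀ →
      sRFO-and (const _ , const _) (sRFO-and (sRFO-all1 (stepF-tame q₀)) (restricted last , noSetQ last))))
    where
    last : Tame (caseF nQ lastC (λ q → const (κ q)))
    last = tame-caseF nQ lastC-FO (λ q → tame-const (κ q))

  formula-sREMSO : sREMSO formula
  formula-sREMSO = close nQ (base bodyF-sRFO)
    where
    close : ∀ n {φ : WMSO C d 0 n} → sREMSO φ → sREMSO (exs n φ)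
    close zero    h = h
    close (suc n) h = close n (ex2 h)

  module _ (nw : NestedWord d) where
    open NestedWord nw renaming (nest to ν)

    evalA-ext : (a : Atom d i j) {ρ ρ' : Fin i → Fin len} {σ σ' : Fin j → Fin len → Bool} →
      ρ ≗ ρ' → (∀ X → σ X ≗ σ' X) → evalA nw a ρ σ ≡ evalA nw a ρ' σ'
    evalA-ext (eqA x y)  e e' = ≡.cong₂ (λ p q → ⌊ p FP.≟ q ⌋) (e x) (e y)
    evalA-ext (labA a x) e e' = ≡.cong (λ p → ⌊ lab p FP.≟ a ⌋) (e x)
    evalA-ext (leqA x y) e e' = ≡.cong₂ (λ p q → ⌊ p FP.≤? q ⌋) (e x) (e y)
    evalA-ext (nuA x y)  e e' = ≡.cong₂ ν (e x) (e y)
    evalA-ext (memA x X) {σ' = σ'} e e' = ≡.trans (e' X _) (≡.cong (σ' X) (e x))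

    private
      cons-ext : ∀ {B : Set} {f g : Fin j → B → Bool} X → (∀ Y → f Y ≗ g Y) → ∀ Y → (X ∷ᶠ f) Y ≗ (X ∷ᶠ g) Y
      cons-ext X e zero    p = ≡.refl
      cons-ext X e (suc Y) p = e Y p

    -- Rearranging sums over set variables changes assignments up to pointwise equality only; this
    -- makes formulas admissible summands.
    ⟦⟧-ext : (φ : WMSO C d i j) {ρ ρ' : Fin i → Fin len} {σ σ' : Fin j → Fin len → Bool} →
      ρ ≗ ρ' → (∀ X → σ X ≗ σ' X) → ⟦ nw ⟧ φ ρ σ ≈ ⟦ nw ⟧ φ ρ' σ'
    ⟦⟧-ext (const k) e e' = refl
    ⟦⟧-ext (atom a)  e e' = trans (⟦atom⟧ nw a _ _) (trans
      (reflexive (≡.cong [_] (evalA-ext a e e'))) (sym (⟦atom⟧ nw a _ _)))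
    ⟦⟧-ext (natom a) e e' = trans (⟦natom⟧ nw a _ _) (trans
      (reflexive (≡.cong (λ b → [ not b ]) (evalA-ext a e e'))) (sym (⟦natom⟧ nw a _ _)))
    ⟦⟧-ext (or φ ψ)  e e' = +-cong (⟦⟧-ext φ e e') (⟦⟧-ext ψ e e')
    ⟦⟧-ext (and φ ψ) e e' = *-cong (⟦⟧-ext φ e e') (⟦⟧-ext ψ e e')
    ⟦⟧-ext (ex1 φ)   e e' = trans (∑-⨁ len _) (trans
      (⨁-cong (pos len) (λ p → ⟦⟧-ext φ (∷ᶠ-cong p e) e')) (sym (∑-⨁ len _)))
    ⟦⟧-ext (ex2 φ)   e e' = trans (∑-sets len _) (trans
      (⨁-cong (funs bools len) (λ X → ⟦⟧-ext φ e (cons-ext X e'))) (sym (∑-sets len _)))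
    ⟦⟧-ext (all1 φ)  e e' = trans (∏-⨂ len _) (trans
      (⨂-cong (pos len) (λ p → ⟦⟧-ext φ (∷ᶠ-cong p e) e')) (sym (∏-⨂ len _)))
    ⟦⟧-ext (all2 φ)  e e' = trans (bigFun-⨂ len _) (trans
      (⨂-cong (funs bools len) (λ X → ⟦⟧-ext φ e (cons-ext X e'))) (sym (bigFun-⨂ len _)))

    ⟦⁺⟧ : (χ : MSO d i j) → ∀ ρ σ → ⟦ nw ⟧ (χ ⁺) ρ σ ≈ [ sat nw χ ρ σ ]
    ⟦⁺⟧ χ ρ σ = proj₁ (pm-means nw χ ρ σ)

    ⟦⁻⟧ : (χ : MSO d i j) → ∀ ρ σ → ⟦ nw ⟧ (χ ⁻) ρ σ ≈ [ not (sat nw χ ρ σ) ]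
    ⟦⁻⟧ χ ρ σ = proj₂ (pm-means nw χ ρ σ)

    ⟦sumF⟧ : ∀ k (φ : Fin k → WMSO C d i j) ρ σ → ⟦ nw ⟧ (sumF k φ) ρ σ ≈ ⨁ (pos k) (λ p → ⟦ nw ⟧ (φ p) ρ σ)
    ⟦sumF⟧ zero    φ ρ σ = refl
    ⟦sumF⟧ (suc k) φ ρ σ = trans (+-congˡ (⟦sumF⟧ k (φ ∘ suc) ρ σ)) (sym (reflexive (⨁-pos-suc k _)))

    ⟦caseF⟧ : ∀ k (χ : Fin k → MSO d i j) (φ : Fin k → WMSO C d i j) ρ σ p →
      (∀ q → sat nw (χ q) ρ σ ≡ eqF p q) → ⟦ nw ⟧ (caseF k χ φ) ρ σ ≈ ⟦ nw ⟧ (φ p) ρ σ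
    ⟦caseF⟧ k χ φ ρ σ p e = trans (⟦sumF⟧ k _ ρ σ) (trans
      (⨁-cong (pos k) (λ q → *-congʳ (trans (⟦⁺⟧ (χ q) ρ σ) (reflexive (≡.cong [_] (e q))))))
      (⨁-pick (λ q → ⟦ nw ⟧ (φ q) ρ σ) p))

    private
      ∧-not : ∀ a b → not (not a ∨ not b) ≡ a ∧ b
      ∧-not true  b = BP.not-involutive b
      ∧-not false b = ≡.refl

    sat-andC : (φ ψ : MSO d i j) → ∀ ρ σ → sat nw (andC φ ψ) ρ σ ≡ sat nw φ ρ σ ∧ sat nw ψ ρ σ
    sat-andC φ ψ ρ σ = ∧-not (sat nw φ ρ σ) (sat nw ψ ρ σ)

    sat-ltC : ∀ (y x : Fin i) ρ (σ : Fin j → _) → sat nw (ltC y x) ρ σ ≡ ltF (ρ y) (ρ x)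
    sat-ltC y x ρ σ = ≡.cong not (leF-≤? (ρ x) (ρ y))

    sat-firstC : ∀ (x : Fin i) ρ (σ : Fin j → _) → sat nw (firstC x) ρ σ ≡ isFirst (ρ x)
    sat-firstC x ρ σ = ≡.trans (≡.cong not (Or.⨁-cong (pos len) (λ y → sat-ltC zero (suc x) (y ∷ᶠ ρ) σ)))
      (first-isFirst (ρ x))

    sat-nextC : ∀ (y x : Fin i) ρ (σ : Fin j → _) → sat nw (nextC y x) ρ σ ≡ isNext (ρ y) (ρ x)
    sat-nextC y x ρ σ = ≡.trans (sat-andC (ltC y x) (neg (ex1 (andC (ltC (suc y) zero) (ltC zero (suc x))))) ρ σ) (≡.trans
      (≡.cong₂ (λ a b → a ∧ not b) (sat-ltC y x ρ σ) (Or.⨁-cong (pos len) (λ z → ≡.trans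
        (sat-andC (ltC (suc y) zero) (ltC zero (suc x)) (z ∷ᶠ ρ) σ)
        (≡.cong₂ _∧_ (sat-ltC (suc y) zero (z ∷ᶠ ρ) σ) (sat-ltC zero (suc x) (z ∷ᶠ ρ) σ)))))
      (next-isNext (ρ y) (ρ x)))

    sat-eq-refl : ∀ (ρ : Fin (suc i) → Fin len) (σ : Fin j → _) → sat nw (atom (eqA zero zero)) ρ σ ≡ true
    sat-eq-refl ρ σ = ≡.trans (eqF-≟ (ρ zero) (ρ zero)) (eqF-refl (ρ zero))

    sat-noneC : ∀ k (X : Fin k → Fin j) (ρ : Fin (suc i) → Fin len) σ →
      sat nw (noneC k X) ρ σ ≡ none k (λ q → σ (X q) (ρ zero))
    sat-noneC zero    X ρ σ = sat-eq-refl ρ σ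
    sat-noneC (suc k) X ρ σ = ≡.trans (sat-andC (neg (atom (memA zero (X zero)))) (noneC k (X ∘ suc)) ρ σ)
      (≡.cong (not (σ (X zero) (ρ zero)) ∧_) (sat-noneC k (X ∘ suc) ρ σ))

    sat-exactlyOneC : ∀ k (X : Fin k → Fin j) (ρ : Fin (suc i) → Fin len) σ →
      sat nw (exactlyOneC k X) ρ σ ≡ exactlyOne k (λ q → σ (X q) (ρ zero))
    sat-exactlyOneC zero    X ρ σ = ≡.cong not (sat-eq-refl ρ σ)
    sat-exactlyOneC (suc k) X ρ σ = ≡.cong₂ _∨_
      (≡.trans (sat-andC (atom (memA zero (X zero))) (noneC k (X ∘ suc)) ρ σ) (≡.cong (_ ∧_) (sat-noneC k (X ∘ suc) ρ σ)))
      (≡.trans (sat-andC (neg (atom (memA zero (X zero)))) (exactlyOneC k (X ∘ suc)) ρ σ)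
        (≡.cong (_ ∧_) (sat-exactlyOneC k (X ∘ suc) ρ σ)))

    module _ (r : Fin len → Q) (q₀ : Q) where

      private
        σʳ : Q → Fin len → Bool
        σʳ q p = eqF (r p) q

        R : Fin (suc len) → Q
        R = q₀ ∷ᶠ r

      sat-nextInC : ∀ p (x : Fin i) ρ → sat nw (nextInC p x) ρ σʳ ≡ any (pos len) (λ y → isNext y (ρ x) ∧ eqF (r y) p)
      sat-nextInC p x ρ = Or.⨁-cong (pos len) (λ y → ≡.trans
        (sat-andC (nextC zero (suc x)) (atom (memA zero p)) (y ∷ᶠ ρ) σʳ)
        (≡.cong (_∧ eqF (r y) p) (sat-nextC zero (suc x) (y ∷ᶠ ρ) σʳ)))

      sat-beforeC : ∀ p (x : Fin i) ρ → sat nw (beforeC q₀ p x) ρ σʳ ≡ eqF (R (F.inject₁ (ρ x))) p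
      sat-beforeC p x ρ with eqF q₀ p in eq
      ... | true  = ≡.trans (≡.cong₂ _∨_ (sat-firstC x ρ σʳ) (sat-nextInC p x ρ)) (value r (ρ x))
        where
        value : ∀ {L} (t : Fin L → Q) x → isFirst x ∨ any (pos L) (λ y → isNext y x ∧ eqF (t y) p)
          ≡ eqF ((q₀ ∷ᶠ t) (F.inject₁ x)) p
        value t zero    = ≡.sym eq
        value t (suc x) = any-select (F.inject₁ x) (λ y → isNext y (suc x)) (λ y → eqF (t y) p) (λ y → isNext-inject₁ y x)
      ... | false = ≡.trans (sat-nextInC p x ρ) (value r (ρ x))
        where
        value : ∀ {L} (t : Fin L → Q) x → any (pos L) (λ y → isNext y x ∧ eqF (t y) p) ≡ eqF ((q₀ ∷ᶠ t) (F.inject₁ x)) p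
        value {L} t zero = ≡.trans (any-false (pos L) (λ y → ≡.refl)) (≡.sym eq)
        value t (suc x)  = any-select (F.inject₁ x) (λ y → isNext y (suc x)) (λ y → eqF (t y) p) (λ y → isNext-inject₁ y x)

      sat-lastC : ∀ q (ρ : Fin 0 → Fin len) → sat nw (lastC q) ρ σʳ ≡ eqF (R (F.fromℕ len)) q
      sat-lastC q ρ = ≡.trans
        (Or.⨁-cong (pos len) (λ y → ≡.trans
          (sat-andC (neg (ex1 (ltC (suc zero) zero))) (atom (memA zero q)) (y ∷ᶠ ρ) σʳ)
          (≡.cong (λ b → not b ∧ eqF (r y) q) (Or.⨁-cong (pos len) (λ z → sat-ltC (suc zero) zero (z ∷ᶠ (y ∷ᶠ ρ)) σʳ)))))
        -- As the word is nonempty, the final state is recorded at its last position.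
        (value nonempty r)
        where
        value : ∀ {L} → 1 ℕ.≤ L → (t : Fin L → Q) →
          any (pos L) (λ y → not (any (pos L) (λ z → ltF y z)) ∧ eqF (t y) q) ≡ eqF ((q₀ ∷ᶠ t) (F.fromℕ L)) q
        value {suc L} _ t = any-select (F.fromℕ L) _ (λ y → eqF (t y) q) (last-fromℕ L)

      sat-callerC : ∀ i x p → ν i x ≡ true → ∀ ρ → sat nw (callerC q₀ p) (x ∷ᶠ ρ) σʳ ≡ eqF (R (F.inject₁ i)) p
      sat-callerC i x p c ρ = ≡.trans
        (Or.⨁-cong (pos len) (λ y → ≡.trans
          (sat-andC (atom (nuA zero (suc zero))) (beforeC q₀ p zero) (y ∷ᶠ (x ∷ᶠ ρ)) σʳ)
          (≡.cong (ν y x ∧_) (sat-beforeC p zero (y ∷ᶠ (x ∷ᶠ ρ))))))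
        (any-select i (λ y → ν y x) (λ y → eqF (R (F.inject₁ y)) p) unique)
        where
        unique : ∀ y → ν y x ≡ eqF i y
        unique y with ν y x in e | eqF i y in e'
        ... | true  | true  = ≡.refl
        ... | false | false = ≡.refl
        ... | true  | false rewrite nest-inj y i x e c with ≡.trans (≡.sym e') (eqF-refl i)
        ...   | ()
        unique y | false | true rewrite eqF-sound i y e' with ≡.trans (≡.sym e) c
        ...   | ()

      ⟦targetF⟧ : ∀ δ x ρ → ⟦ nw ⟧ (targetF δ) (x ∷ᶠ ρ) σʳ ≈ δ (lab x) (R (suc x))
      ⟦targetF⟧ δ x ρ = trans (⟦caseF⟧ nQ (λ q → atom (memA zero q))
          (λ q → caseF d (λ a → atom (labA a zero)) (λ a → const (δ a q)))
          (x ∷ᶠ ρ) σʳ (r x) (λ q → ≡.refl))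
        (⟦caseF⟧ d (λ a → atom (labA a zero)) (λ a → const (δ a (r x))) (x ∷ᶠ ρ) σʳ (lab x) (λ a → eqF-≟ (lab x) a))

      ⟦localF⟧ : ∀ δ x ρ → ⟦ nw ⟧ (localF q₀ δ) (x ∷ᶠ ρ) σʳ ≈ δ (R (F.inject₁ x)) (lab x) (R (suc x))
      ⟦localF⟧ δ x ρ = trans
        (⟦caseF⟧ nQ (λ p → beforeC q₀ p zero) (λ p → targetF (δ p)) (x ∷ᶠ ρ) σʳ (R (F.inject₁ x))
          (λ p → sat-beforeC p zero (x ∷ᶠ ρ)))
        (⟦targetF⟧ (δ (R (F.inject₁ x))) x ρ)

      ⟦returnF⟧ : ∀ i x ρ → ν i x ≡ true →
        ⟦ nw ⟧ (returnF q₀) (x ∷ᶠ ρ) σʳ ≈ δret (R (F.inject₁ x)) (R (F.inject₁ i)) (lab x) (R (suc x))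
      ⟦returnF⟧ i x ρ c = trans
        (⟦caseF⟧ nQ (λ p → beforeC q₀ p zero) (λ p → caseF nQ (callerC q₀) (λ p' → targetF (δret p p')))
          (x ∷ᶠ ρ) σʳ (R (F.inject₁ x)) (λ p → sat-beforeC p zero (x ∷ᶠ ρ))) (trans
        (⟦caseF⟧ nQ (callerC q₀) (λ p' → targetF (δret (R (F.inject₁ x)) p')) (x ∷ᶠ ρ) σʳ (R (F.inject₁ i))
          (λ p → sat-callerC i x p c ρ))
        (⟦targetF⟧ (δret (R (F.inject₁ x)) (R (F.inject₁ i))) x ρ))

      private
        choose : ∀ {x y b} u v → x ≈ [ b ] → y ≈ [ not b ] → x * u + y * v ≈ (if b then u else v)
        choose {b = true}  u v ex ey = trans (+-cong (trans (*-congʳ ex) (*-identityˡ u)) (trans (*-congʳ ey) (zeroˡ v)))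
          (+-identityʳ u)
        choose {b = false} u v ex ey = trans (+-cong (trans (*-congʳ ex) (zeroˡ u)) (trans (*-congʳ ey) (*-identityˡ v)))
          (+-identityˡ v)

        branch : ∀ (χ : MSO d 1 nQ) {b} φ ψ ρ → sat nw χ ρ σʳ ≡ b →
          ⟦ nw ⟧ (or (and (χ ⁺) φ) (and (χ ⁻) ψ)) ρ σʳ ≈ (if b then ⟦ nw ⟧ φ ρ σʳ else ⟦ nw ⟧ ψ ρ σʳ)
        branch χ φ ψ ρ e = choose _ _ (trans (⟦⁺⟧ χ ρ σʳ) (reflexive (≡.cong [_] e)))
          (trans (⟦⁻⟧ χ ρ σʳ) (reflexive (≡.cong (λ b → [ not b ]) e)))

      ⟦stepF⟧ : ∀ x ρ → ⟦ nw ⟧ (stepF q₀) (x ∷ᶠ ρ) σʳ ≈ posWeight A nw R x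
      ⟦stepF⟧ x ρ with FP.any? (λ i → ν i x BP.≟ true)
      ... | yes (i , c) = trans
        (branch isRetC (returnF q₀) (noReturnF q₀) (x ∷ᶠ ρ) (any-true (λ i → ν i x) i c)) (⟦returnF⟧ i x ρ c)
      ... | no ¬r with FP.any? (λ j → ν x j BP.≟ true)
      ...   | yes (j , c) = trans
        (branch isRetC (returnF q₀) (noReturnF q₀) (x ∷ᶠ ρ) (any-false (pos len) (λ i → BP.¬-not (λ e → ¬r (i , e))))) (trans
        (branch isCallC (localF q₀ δcall) (localF q₀ δint) (x ∷ᶠ ρ) (any-true (ν x) j c))
        (⟦localF⟧ δcall x ρ))
      ...   | no ¬c = trans
        (branch isRetC (returnF q₀) (noReturnF q₀) (x ∷ᶠ ρ) (any-false (pos len) (λ i → BP.¬-not (λ e → ¬r (i , e))))) (trans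
        (branch isCallC (localF q₀ δcall) (localF q₀ δint) (x ∷ᶠ ρ) (any-false (pos len) (λ j → BP.¬-not (λ e → ¬c (j , e)))))
        (⟦localF⟧ δint x ρ))

      ⟦runF⟧ : ∀ ρ → ⟦ nw ⟧ (runF q₀) ρ σʳ ≈ (ι q₀ * runWeight A nw R) * κ (R (F.fromℕ len))
      ⟦runF⟧ ρ = trans (*-congˡ (*-cong
          (trans (∏-⨂ len _) (trans (⨂-cong (pos len) (λ x → ⟦stepF⟧ x ρ)) (sym (∏-⨂ len _))))
          (⟦caseF⟧ nQ lastC (λ q → const (κ q)) ρ σʳ (R (F.fromℕ len)) (λ q → sat-lastC q ρ))))
        (sym (*-assoc _ _ _))

    exs-rows : ∀ n (φ : WMSO C d 0 n) ρ σ → ⟦ nw ⟧ (exs n φ) ρ σ ≈ ⨁-rows n len (λ τ → ⟦ nw ⟧ φ ρ τ)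
    exs-rows zero    φ ρ σ = ⟦⟧-ext φ (λ _ → ≡.refl) (λ ())
    exs-rows (suc n) φ ρ σ = trans (exs-rows n (ex2 φ) ρ σ) (rows-cong n (λ τ → ∑-sets len _))
      where
      rows-cong : ∀ n {G H : (Fin n → Fin len → Bool) → C} → (∀ τ → G τ ≈ H τ) → ⨁-rows n len G ≈ ⨁-rows n len H
      rows-cong zero    e = e _
      rows-cong (suc n) e = rows-cong n (λ τ → ⨁-cong (funs bools len) (λ X → e _))

    -- The quantified sets form a Boolean matrix, and the partition condition leaves the maps `r`
    -- from positions to states. These are the states of a run except the first, which the sum over
    -- `q₀` in `bodyF` supplies.
    formula-behaviour : ∀ ρ σ → behaviour A nw ≈ ⟦ nw ⟧ formula ρ σ
    formula-behaviour ρ σ = sym (begin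
      ⟦ nw ⟧ formula ρ σ
        ≈⟨ exs-rows nQ bodyF ρ σ ⟩
      ⨁-rows nQ len (λ τ → ⟦ nw ⟧ bodyF ρ τ)
        ≈⟨ ⨁-rows-columns nQ len (λ τ → ⟦ nw ⟧ bodyF ρ τ) (⟦⟧-ext bodyF (λ _ → ≡.refl)) ⟩
      ⨁ (funs (funs bools nQ) len) (λ τ → ⟦ nw ⟧ bodyF ρ (λ q p → τ p q))
        ≈⟨ ⨁-cong (funs (funs bools nQ) len) (λ τ → *-congʳ (trans (∏-⨂ len _) (⨂-cong (pos len) (λ p → trans
             (⟦⁺⟧ (exactlyOneC nQ id) (p ∷ᶠ ρ) _) (reflexive (≡.cong [_] (sat-exactlyOneC nQ id (p ∷ᶠ ρ) _))))))) ⟩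
      ⨁ (funs (funs bools nQ) len) (λ τ → ⨂ (pos len) (λ p → [ exactlyOne nQ (τ p) ]) *
        ⟦ nw ⟧ (sumF nQ runF) ρ (λ q p → τ p q))
        ≈⟨ ⨁-partition nQ len (λ τ → ⟦ nw ⟧ (sumF nQ runF) ρ (λ q p → τ p q))
             (λ e → ⟦⟧-ext (sumF nQ runF) (λ _ → ≡.refl) (λ q p → e p q)) ⟩
      ⨁ (funs (pos nQ) len) (λ r → ⟦ nw ⟧ (sumF nQ runF) ρ (λ q p → eqF (r p) q))
        ≈⟨ ⨁-cong (funs (pos nQ) len) (λ r → trans (⟦sumF⟧ nQ runF ρ _) (⨁-cong (pos nQ) (λ q₀ → ⟦runF⟧ r q₀ ρ))) ⟩
      ⨁ (funs (pos nQ) len) (λ r → ⨁ (pos nQ) (λ q₀ →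
        (ι q₀ * runWeight A nw (q₀ ∷ᶠ r)) * κ ((q₀ ∷ᶠ r) (F.fromℕ len))))
        ≈⟨ ⨁-swap (funs (pos nQ) len) (pos nQ) _ ⟩
      ⨁ (pos nQ) (λ q₀ → ⨁ (funs (pos nQ) len) (λ r →
        (ι q₀ * runWeight A nw (q₀ ∷ᶠ r)) * κ ((q₀ ∷ᶠ r) (F.fromℕ len))))
        ≈⟨ ⨁-funs-suc (pos nQ) len _ ⟨
      ⨁ (funs (pos nQ) (suc len)) (λ r → (ι (r zero) * runWeight A nw r) * κ (r (F.fromℕ len)))
        ≈⟨ ∑-runs nQ (suc len) _ ⟨
      behaviour A nw ∎)

-- The equivalences.

module Equivalence {c ℓ} (K : CommutativeSemiring c ℓ) (d : ℕ) where
  open CommutativeSemiring K using (trans)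
  open Weighted K d
  open FormulaSemantics K d
  open LocalFiniteness K d

  formula-regular : ∀ {S} (φ : WMSO (CommutativeSemiring.Carrier K) d 0 0) → Regularᶠ φ →
    (∀ nw → CommutativeSemiring._≈_ K (S nw) (⟦ φ ⟧ₛ nw)) → Regular S
  formula-regular φ R e = automaton , λ nw → trans (e nw) (trans
      (Regularᶠ.agrees R nw (proj₁ (shape nw)) (proj₂ (shape nw)) (λ ()) (λ ()))
      (automaton-correct nw (proj₁ (shape nw)) (proj₂ (shape nw))))
    where open Construction K d (Regularᶠ.recognisable R)

  sREMSO⇒sRMSO : ∀ {i j} {φ : WMSO (CommutativeSemiring.Carrier K) d i j} → sREMSO φ → sRMSO φ
  sREMSO⇒sRMSO (base (h , _)) = h
  sREMSO⇒sRMSO (ex2 h)        = ex2 (sREMSO⇒sRMSO h)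

  aUMSO⇒wUMSO : ∀ {i j} {φ : WMSO (CommutativeSemiring.Carrier K) d i j} → aUMSO φ → wUMSO φ
  aUMSO⇒wUMSO (const k) = const k
  aUMSO⇒wUMSO (su u)    = su u
  aUMSO⇒wUMSO (and p q) = and (aUMSO⇒wUMSO p) (aUMSO⇒wUMSO q)
  aUMSO⇒wUMSO (or p q)  = or (aUMSO⇒wUMSO p) (aUMSO⇒wUMSO q)

  sRMSO⇒swRMSO : ∀ {i j} {φ : WMSO (CommutativeSemiring.Carrier K) d i j} → sRMSO φ → swRMSO φ
  sRMSO⇒swRMSO (const k)  = const k
  sRMSO⇒swRMSO (atom a)   = atom a
  sRMSO⇒swRMSO (natom a)  = natom a
  sRMSO⇒swRMSO (or p q)   = or (sRMSO⇒swRMSO p) (sRMSO⇒swRMSO q)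
  sRMSO⇒swRMSO (and p q)  = and (sRMSO⇒swRMSO p) (sRMSO⇒swRMSO q)
  sRMSO⇒swRMSO (ex1 p)    = ex1 (sRMSO⇒swRMSO p)
  sRMSO⇒swRMSO (ex2 p)    = ex2 (sRMSO⇒swRMSO p)
  sRMSO⇒swRMSO (all1 u p) = all1 (aUMSO⇒wUMSO u) (sRMSO⇒swRMSO p)
  sRMSO⇒swRMSO (all2 u p) = all2 u (sRMSO⇒swRMSO p)

  -- One formula covers every logic that contains `sREMSO`.
  regular-definable : ∀ {Z S} → (∀ {φ} → sREMSO φ → Z φ) → Regular S → Definable Z S
  regular-definable sREMSO⊆Z (A , e) = formula , sREMSO⊆Z formula-sREMSO ,
      λ nw → trans (e nw) (formula-behaviour nw (λ ()) (λ ()))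
    where open Encoding K d A

  regular⇔sRMSO : ∀ S → Regular S ⇔ Definable sRMSO S
  regular⇔sRMSO S = mk⇔ (regular-definable sREMSO⇒sRMSO)
    (λ (φ , h , e) → formula-regular φ (restricted-regular aUMSO-step h) e)

  regular⇔sREMSO : ∀ S → Regular S ⇔ Definable sREMSO S
  regular⇔sREMSO S = mk⇔ (regular-definable (λ h → h))
    (λ (φ , h , e) → formula-regular φ (restricted-regular aUMSO-step (sREMSO⇒sRMSO h)) e)

  regular⇔swRMSO : AddLocallyFinite → ∀ S → Regular S ⇔ Definable swRMSO S
  regular⇔swRMSO fin S = mk⇔ (regular-definable (λ h → sRMSO⇒swRMSO (sREMSO⇒sRMSO h)))
    (λ (φ , h , e) → formula-regular φ (restricted-regular (wUMSO-step (+-periodic fin)) h) e)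

  regular⇔MSO : LocallyFinite → ∀ S → Regular S ⇔ Definable anyMSO S
  regular⇔MSO fin S = mk⇔ (regular-definable (λ _ → tt))
    (λ (φ , _ , e) → formula-regular φ (step-regular (anyMSO-step (+-periodic′ fin) (*-periodic fin) φ)) e)

theorem3p6 : ∀ {c ℓ} (K : CommutativeSemiring c ℓ) →
    ¬ (CommutativeSemiring._≈_ K (CommutativeSemiring.0# K) (CommutativeSemiring.1# K)) →
    (d : ℕ) (S : Weighted.Series K d) →
    ((Weighted.Regular K d S ⇔ Weighted.Definable K d (Weighted.sRMSO K d) S)
    × (Weighted.Regular K d S ⇔ Weighted.Definable K d (Weighted.sREMSO K d) S))
    × (Weighted.AddLocallyFinite K d →
    (Weighted.Regular K d S ⇔ Weighted.Definable K d (Weighted.swRMSO K d) S))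
    × (Weighted.LocallyFinite K d →
    (Weighted.Regular K d S ⇔ Weighted.Definable K d (Weighted.anyMSO K d) S))
theorem3p6 K _ d S =
  (regular⇔sRMSO S , regular⇔sREMSO S) , (λ fin → regular⇔swRMSO fin S) , (λ fin → regular⇔MSO fin S)
  where open Equivalence K d
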